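{- Let $q$ be an odd prime power, $m$ a positive integer and $\varepsilon \in \{+1,-1\}$. The graph $NO_{2m+1}^{\varepsilon}(q)$ satisfies the $4$-vertex condition.
   Context: Let $V$ be a vector space of dimension $2m+1$ over $\mathbb{F}_q$, $q$ odd, and let $Q$ be a nondegenerate quadratic form on $V$. A projective point ($1$-dimensional subspace) $\langle x\rangle$ is singular if $Q(x)=0$ and nonsingular otherwise. A nonsingular point $x$ has type $\varepsilon=+1$ if the hyperplane $x^\perp$ of points orthogonal to $x$ is hyperbolic, and type $\varepsilon=-1$ if $x^\perp$ is elliptic. A projective line is a tangent if it contains exactly one singular point. The graph $NO_{2m+1}^{\varepsilon}(q)$ has as vertex set the set of nonsingular points of type $\varepsilon$, where two distinct points are adjacent when the line joining them is a tangent. A graph $\Gamma$ satisfies the $t$-vertex condition if, for all triples $(T,x_0,y_0)$ consisting of a $t$-vertex graph $T$ together with two distinct distinguished vertices $x_0,y_0$ of $T$, and all pairs of distinct vertices $x,y$ of $\Gamma$, the number of isomorphic copies of $T$ in $\Gamma$ (as induced subgraphs), where the isomorphism maps $x_0$ to $x$ and $y_0$ to $y$, does not depend on the choice of the pair $x,y$ but only on whether $x,y$ are adjacent or nonadjacent. -}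

module Defs where

open import Algebra.Bundles using (CommutativeRing)
open import Algebra.Module.Bundles using (Module)
import Algebra.Definitions as AlgebraDefinitions
import Algebra.Properties.Monoid.Sum as MonoidSum
open import Data.Fin.Base using (Fin)
open import Data.Nat.Base using (ℕ; suc; _≤_; _^_)
import Data.Nat.Base as ℕ
open import Data.Nat.Primality using (Prime)
open import Data.Product.Base using (∃-syntax; ∃₂; _×_; _,_; proj₁; proj₂)
open import Data.Sign.Base using (Sign)
open import Function.Base using (_on_)
open import Function.Bundles using (Inverse; _⇔_)
open import Level using (Level; _⊔_; 0ℓ) renaming (suc to lsuc)
open import Relation.Binary.Bundles using (Setoid)
open import Relation.Binary.Core using (Rel)
open import Relation.Binary.Definitions using (Irreflexive; Symmetric; Decidable; _Respects₂_)
open import Relation.Binary.PropositionalEquality.Core using (_≡_; _≢_)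
import Relation.Binary.Construct.On as On
import Relation.Binary.PropositionalEquality.Properties as ≡
open import Relation.Nullary.Negation using (¬_)
open import Relation.Unary using (Pred; _∈_; _⊆_; U)

PrimePower : ℕ → Set
PrimePower q = ∃₂ λ p k → Prime p × 1 ≤ k × q ≡ p ^ k

HasCardinality : ∀ {a ℓ} → Setoid a ℓ → ℕ → Set (a ⊔ ℓ)
HasCardinality S n = Inverse S (≡.setoid (Fin n))

record Graph {a ℓ} (S : Setoid a ℓ) (r : Level) : Set (a ⊔ ℓ ⊔ lsuc r) where
  open Setoid S using (Carrier; _≈_)
  field
    Adj        : Rel Carrier r
    Adj-resp   : Adj Respects₂ _≈_
    Adj-sym    : Symmetric Adj
    Adj-irrefl : Irreflexive _≈_ Adj

module _ {t : ℕ} {s : Level} (T : Graph (≡.setoid (Fin t)) s) (x₀ y₀ : Fin t)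
         {a ℓ r : Level} {S : Setoid a ℓ} (Γ : Graph S r) (x y : Setoid.Carrier S)
  where
  private
    module T = Graph T
    module Γ = Graph Γ
  open Setoid S

  record Copy : Set (s ⊔ a ⊔ ℓ ⊔ r) where
    field
      embed     : Fin t → Carrier
      injective : ∀ {i j} → embed i ≈ embed j → i ≡ j
      induced   : ∀ {i j} → T.Adj i j ⇔ Γ.Adj (embed i) (embed j)
      x₀↦x      : embed x₀ ≈ x
      y₀↦y      : embed y₀ ≈ y

  image : Copy → Pred Carrier ℓ
  image c v = ∃[ i ] Copy.embed c i ≈ v

  -- A copy is an induced subgraph, i.e. a set of vertices of Γ: isomorphisms
  -- from T onto the same set of vertices are not counted separately.
  copies : Setoid (s ⊔ a ⊔ ℓ ⊔ r) (a ⊔ ℓ)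
  copies = record
    { Carrier       = Copy
    ; _≈_           = λ c d → image c ⊆ image d × image d ⊆ image c
    ; isEquivalence = record
      { refl  = (λ p → p) , (λ p → p)
      ; sym   = λ (f , g) → g , f
      ; trans = λ (f , g) (f′ , g′) → (λ p → f′ (f p)) , (λ p → g (g′ p))
      }
    }

-- Up to isomorphism the vertex set of T is Fin t.  Decidability of adjacency
-- in T is automatic classically.
VertexCondition : ∀ {a ℓ r} {S : Setoid a ℓ} → ℕ → Graph S r → Set (lsuc 0ℓ ⊔ a ⊔ ℓ ⊔ r)
VertexCondition {S = S} t Γ =
  (T : Graph (≡.setoid (Fin t)) 0ℓ) → Decidable (Graph.Adj T) →
  (x₀ y₀ : Fin t) → x₀ ≢ y₀ →
  ∃₂ λ (n₁ n₂ : ℕ) → ∀ (x y : Carrier) → ¬ (x ≈ y) →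
    (Adj x y → HasCardinality (copies T x₀ y₀ Γ x y) n₁) ×
    (¬ Adj x y → HasCardinality (copies T x₀ y₀ Γ x y) n₂)
  where
  open Setoid S using (Carrier; _≈_)
  open Graph Γ using (Adj)

module _ {c ℓ} (F : CommutativeRing c ℓ) where
  open CommutativeRing F
  open AlgebraDefinitions _≈_ using (Invertible)

  record IsField : Set (c ⊔ ℓ) where
    field
      1≉0     : ¬ (1# ≈ 0#)
      inverse : ∀ x → ¬ (x ≈ 0#) → Invertible 1# _*_ x

  record IsFiniteField (q : ℕ) : Set (c ⊔ ℓ) where
    field
      isField     : IsField
      cardinality : HasCardinality setoid q

module _ {c ℓ m ℓm} {F : CommutativeRing c ℓ} (V : Module F m ℓm) where
  open CommutativeRing F using (Carrier; _≈_; 0#)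
  open Module V
  open MonoidSum +ᴹ-monoid using (sum)

  linearCombination : ∀ {n} → (Fin n → Carrier) → (Fin n → Carrierᴹ) → Carrierᴹ
  linearCombination a b = sum (λ i → a i *ₗ b i)

  span : ∀ {n} → (Fin n → Carrierᴹ) → Pred Carrierᴹ (c ⊔ ℓm)
  span b v = ∃[ a ] v ≈ᴹ linearCombination a b

  LinearlyIndependent : ∀ {n} → (Fin n → Carrierᴹ) → Set (c ⊔ ℓ ⊔ ℓm)
  LinearlyIndependent b = ∀ a → linearCombination a b ≈ᴹ 0ᴹ → ∀ i → a i ≈ 0#

  HasDimension : ∀ {p} → Pred Carrierᴹ p → ℕ → Set (c ⊔ ℓ ⊔ m ⊔ ℓm ⊔ p)
  HasDimension W n = ∃[ b ] LinearlyIndependent {n} b × span b ⊆ W × W ⊆ span b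

module _ {c ℓ m ℓm} {F : CommutativeRing c ℓ} (V : Module F m ℓm) where
  open CommutativeRing F using (Carrier; _*_)
  open Module V

  ⟨_⟩ : Carrierᴹ → Pred Carrierᴹ (c ⊔ ℓm)
  ⟨ x ⟩ v = ∃[ a ] v ≈ᴹ a *ₗ x

  Line : Carrierᴹ → Carrierᴹ → Pred Carrierᴹ (c ⊔ ℓm)
  Line x y v = ∃₂ λ a b → v ≈ᴹ a *ₗ x +ᴹ b *ₗ y

  record Point : Set (m ⊔ ℓm) where
    field
      vector  : Carrierᴹ
      nonzero : ¬ (vector ≈ᴹ 0ᴹ)

  open Point public

  private
    ⟨⟩-trans : ∀ {x y z} → x ∈ ⟨ y ⟩ → y ∈ ⟨ z ⟩ → x ∈ ⟨ z ⟩
    ⟨⟩-trans {z = z} (a , x≈ay) (b , y≈bz) =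
      a * b , ≈ᴹ-trans x≈ay (≈ᴹ-trans (*ₗ-congˡ y≈bz) (≈ᴹ-sym (*ₗ-assoc a b z)))

  -- x and y are equal as points when ⟨ x ⟩ and ⟨ y ⟩ are the same subspace.
  points : Setoid (m ⊔ ℓm) (c ⊔ ℓm)
  points = record
    { Carrier       = Point
    ; _≈_           = λ P R → vector P ∈ ⟨ vector R ⟩ × vector R ∈ ⟨ vector P ⟩
    ; isEquivalence = record
      { refl  = ∈-refl , ∈-refl
      ; sym   = λ (p , r) → r , p
      ; trans = λ (p , r) (p′ , r′) → ⟨⟩-trans p p′ , ⟨⟩-trans r′ r
      }
    }
    where
    ∈-refl : ∀ {x} → x ∈ ⟨ x ⟩
    ∈-refl {x} = CommutativeRing.1# F , ≈ᴹ-sym (*ₗ-identityˡ x)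

  Line-mono : ∀ {x y x′ y′} → x ∈ ⟨ x′ ⟩ → y ∈ ⟨ y′ ⟩ → Line x y ⊆ Line x′ y′
  Line-mono {x′ = x′} {y′} (d , x≈) (e , y≈) (a , b , v≈) =
    a * d , b * e , ≈ᴹ-trans v≈ (+ᴹ-cong
      (≈ᴹ-trans (*ₗ-congˡ x≈) (≈ᴹ-sym (*ₗ-assoc a d x′)))
      (≈ᴹ-trans (*ₗ-congˡ y≈) (≈ᴹ-sym (*ₗ-assoc b e y′))))

  Line-swap : ∀ {x y} → Line x y ⊆ Line y x
  Line-swap (a , b , v≈) = b , a , ≈ᴹ-trans v≈ (+ᴹ-comm _ _)

module _ {c ℓ m ℓm} {F : CommutativeRing c ℓ} (V : Module F m ℓm)
         (Q : Module.Carrierᴹ V → CommutativeRing.Carrier F)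
  where
  open CommutativeRing F
  open Module V

  polar : Carrierᴹ → Carrierᴹ → Carrier
  polar x y = Q (x +ᴹ y) - Q x - Q y

  -- Bilinearity is only required in the first argument: polar is symmetric.
  record IsQuadraticForm : Set (c ⊔ ℓ ⊔ m ⊔ ℓm) where
    field
      Q-cong      : ∀ {x y} → x ≈ᴹ y → Q x ≈ Q y
      Q-*ₗ        : ∀ a x → Q (a *ₗ x) ≈ a * a * Q x
      polar-+ᴹ    : ∀ x y z → polar (x +ᴹ y) z ≈ polar x z + polar y z
      polar-*ₗ    : ∀ a x y → polar (a *ₗ x) y ≈ a * polar x y

  -- In odd characteristic, Q is nondegenerate on W exactly when the radical
  -- of its polar form on W is zero.
  NondegenerateOn : ∀ {p} → Pred Carrierᴹ p → Set (ℓ ⊔ m ⊔ ℓm ⊔ p)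
  NondegenerateOn W = ∀ x → x ∈ W → (∀ y → y ∈ W → polar x y ≈ 0#) → x ≈ᴹ 0ᴹ

  Nondegenerate : Set (ℓ ⊔ m ⊔ ℓm)
  Nondegenerate = NondegenerateOn U

  _⊥ : Carrierᴹ → Pred Carrierᴹ ℓ
  (x ⊥) y = polar x y ≈ 0#

  -- b is a basis of a totally singular subspace of W.
  TotallySingularBasis : ∀ {p} → Pred Carrierᴹ p → ∀ {k} → (Fin k → Carrierᴹ) →
                         Set (c ⊔ ℓ ⊔ m ⊔ ℓm ⊔ p)
  TotallySingularBasis W b =
    LinearlyIndependent V b × span V b ⊆ W × (∀ v → v ∈ span V b → Q v ≈ 0#)

  -- The maximal dimension of a totally singular subspace of W is k.
  HasWittIndex : ∀ {p} → Pred Carrierᴹ p → ℕ → Set (c ⊔ ℓ ⊔ m ⊔ ℓm ⊔ p)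
  HasWittIndex W k =
    (∃[ b ] TotallySingularBasis W {k} b) ×
    (∀ j (b : Fin j → Carrierᴹ) → TotallySingularBasis W b → j ≤ k)

  record Hyperbolic {p} (W : Pred Carrierᴹ p) (n : ℕ) : Set (c ⊔ ℓ ⊔ m ⊔ ℓm ⊔ p) where
    field
      dimension     : HasDimension V W (2 ℕ.* n)
      nondegenerate : NondegenerateOn W
      wittIndex     : HasWittIndex W n

  record Elliptic {p} (W : Pred Carrierᴹ p) (n : ℕ) : Set (c ⊔ ℓ ⊔ m ⊔ ℓm ⊔ p) where
    field
      dimension     : HasDimension V W (2 ℕ.* n)
      nondegenerate : NondegenerateOn W
      wittIndex     : ∃[ k ] suc k ≡ n × HasWittIndex W k

  Singular : Point V → Set ℓ
  Singular P = Q (vector P) ≈ 0#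

  HasType : ℕ → Sign → Point V → Set (c ⊔ ℓ ⊔ m ⊔ ℓm)
  HasType n Sign.+ P = Hyperbolic (vector P ⊥) n
  HasType n Sign.- P = Elliptic (vector P ⊥) n

  private
    module Pt = Setoid (points V)

  Tangent : Pred Carrierᴹ (c ⊔ ℓm) → Set (c ⊔ ℓ ⊔ m ⊔ ℓm)
  Tangent L = ∃[ P ] vector P ∈ L × Singular P ×
    (∀ R → vector R ∈ L → Singular R → R Pt.≈ P)

  Tangent-resp : ∀ {L L′} → L ⊆ L′ → L′ ⊆ L → Tangent L → Tangent L′
  Tangent-resp f g (P , P∈L , sP , unique) =
    P , f P∈L , sP , λ R R∈L′ → unique R (g R∈L′)

  record Vertex (n : ℕ) (ε : Sign) : Set (c ⊔ ℓ ⊔ m ⊔ ℓm) where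
    field
      point       : Point V
      nonsingular : ¬ Singular point
      hasType     : HasType n ε point

  vertices : ℕ → Sign → Setoid (c ⊔ ℓ ⊔ m ⊔ ℓm) (c ⊔ ℓm)
  vertices n ε = record
    { Carrier       = Vertex n ε
    ; _≈_           = Pt._≈_ on Vertex.point
    ; isEquivalence = On.isEquivalence Vertex.point Pt.isEquivalence
    }

  -- The graph NO^ε of (V , Q), where V has dimension 2n + 1.
  NO : (n : ℕ) (ε : Sign) → Graph (vertices n ε) (c ⊔ ℓ ⊔ m ⊔ ℓm)
  NO n ε = record
    { Adj        = Adj on Vertex.point
    ; Adj-resp   =
        (λ {x} {y} {z} → resp (pt x) (pt x) (pt y) (pt z) (Pt.refl {pt x})) ,
        (λ {x} {y} {z} y≈z → resp (pt y) (pt z) (pt x) (pt x) y≈z (Pt.refl {pt x}))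
    ; Adj-sym    = λ {x} {y} (x≉y , tan) →
        (λ y≈x → x≉y (Pt.sym {pt y} {pt x} y≈x)) ,
        Tangent-resp (Line-swap V) (Line-swap V) tan
    ; Adj-irrefl = λ x≈y (x≉y , _) → x≉y x≈y
    }
    where
    pt = Vertex.point {n} {ε}

    Adj : Rel (Point V) (c ⊔ ℓ ⊔ m ⊔ ℓm)
    Adj P R = ¬ (P Pt.≈ R) × Tangent (Line V (vector P) (vector R))

    resp : ∀ P P′ R R′ → P Pt.≈ P′ → R Pt.≈ R′ → Adj P R → Adj P′ R′
    resp P P′ R R′ P≈P′ R≈R′ (P≉R , tan) =
      (λ P′≈R′ → P≉R (Pt.trans {P} {P′} {R} P≈P′
                       (Pt.trans {P′} {R′} {R} P′≈R′ (Pt.sym {R} {R′} R≈R′)))) ,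
      Tangent-resp
        (Line-mono V (proj₁ P≈P′) (proj₁ R≈R′))
        (Line-mono V (proj₂ P≈P′) (proj₂ R≈R′))
        tan

{-# OPTIONS --safe #-}
module Submission where

-- Let P be the polar form of Q. All vertices of the graph can be scaled to have the same norm Q(x) = ν; a vertex
-- is then a pair ±x, and x, y are adjacent if and only if P(x,y) = ±2ν and y ≠ ±x. By a theorem of Hestenes and
-- Higman it suffices that the graph is strongly regular and that the number of edges among the common neighbours
-- of two distinct vertices depends only on their adjacency.
--
-- Reflections act transitively on vertices and on adjacent pairs, which settles the valency and the adjacent pairs.
-- If x, y are nonadjacent, then their common neighbours x + s correspond to the singular vectors s of x⊥ with one
-- of two nonzero values of P(y,s); these are counted in two ways, using that the reflections of x⊥ are transitive
-- on the vectors of a given nonzero norm. If z is such a common neighbour, with P(x,z) = P(y,z) = 2ν, then x - z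
-- and y - z span a hyperbolic plane H of z⊥, and the common neighbours of x, y, z are counted by the numbers of
-- vectors of norm 0 and of one nonzero norm in the complement of H in z⊥.
--
-- All these numbers are determined by the number N(f) of vectors of norm f in x⊥. Splitting off hyperbolic planes
-- reduces x⊥ to the zero space or, for elliptic type, to an anisotropic plane, whence N(0) - N(f) = ε q^m for all
-- f ≠ 0. Counting the vectors of a given norm in V = ⟨x⟩ ⊕ x⊥ then shows that ε determines Q(x) up to squares, so
-- that the common scaling is possible.

open import Defs
open import Algebra.Bundles using (CommutativeMonoid; CommutativeRing; RawRing)
open import Algebra.Module.Bundles using (Module)
import Algebra.Solver.Ring
import Algebra.Solver.Ring.AlmostCommutativeRing as ACR
open import Data.Bool.Base using (Bool; true; false; if_then_else_)
import Data.Bool.Properties as Boolₚ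
open import Data.Fin.Base as Fin using (Fin; zero; suc; toℕ; funToFin; finToFun)
import Data.Fin.Properties as Finₚ
import Data.Integer.Properties as ℤₚ
open import Data.List.Base using (List; []; _∷_)
open import Data.List.Relation.Unary.All as All using (All; []; _∷_)
open import Data.Maybe.Base using (Maybe; just; nothing)
open import Data.Nat.Base as ℕ using (ℕ; zero; suc; _^_; _≤_; _<_; z≤n)
open import Data.Nat.Divisibility using (_∣_; divides)
import Data.Nat.Properties as ℕₚ
open import Data.Nat.Solver using (module +-*-Solver)
open import Data.Product.Base using (Σ; ∃-syntax; ∃₂; _×_; _,_; proj₁; proj₂)
open import Data.Sign.Base as Sign using (Sign)
open import Data.Sum.Base using (_⊎_; inj₁; inj₂; [_,_]′)
import Data.Vec.Functional as Vector
open import Function.Base using (_∘_)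
open import Function.Bundles using (Inverse; _⇔_; Equivalence; mk⇔)
open import Level using (Level; _⊔_; 0ℓ)
open import Relation.Binary.Bundles using (Setoid)
open import Relation.Binary.Definitions using (Decidable; tri<; tri≈; tri>)
open import Relation.Binary.PropositionalEquality as ≡ using (_≡_; _≢_)
import Relation.Binary.Reasoning.Setoid as SetoidReasoning
open import Relation.Nullary.Decidable
  using (Dec; yes; no; does; _×-dec_; _⊎-dec_; _→-dec_; ¬?; map′; toWitness; decidable-stable; dec-true; dec-false)
open import Relation.Nullary.Negation using (¬_; contradiction)
open import Relation.Unary using (Pred; _∈_; _⊆_; U)

module FiniteSums where
  open ≡ using (refl; sym; trans; cong; cong₂; module ≡-Reasoning)
  open import Data.Nat.Base using (_+_; _*_)
  import Algebra.Properties.Semiring.Sum ℕₚ.+-*-semiring as Sum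
  open Sum using (sum)

  sum-mono : ∀ {n} {f g : Fin n → ℕ} → (∀ i → f i ≤ g i) → sum f ≤ sum g
  sum-mono {zero}  f≤g = z≤n
  sum-mono {suc n} f≤g = ℕₚ.+-mono-≤ (f≤g zero) (sum-mono (f≤g ∘ suc))

  sum-mono-≡ : ∀ {n} {f g : Fin n → ℕ} → (∀ i → f i ≤ g i) → sum f ≡ sum g → ∀ i → f i ≡ g i
  sum-mono-≡ {suc n} {f} {g} f≤g eq = λ
    { zero    → eq₀
    ; (suc i) → sum-mono-≡ (f≤g ∘ suc) (ℕₚ.+-cancelˡ-≡ (f zero) _ _ (trans eq (cong (_+ sum (g ∘ suc)) (sym eq₀)))) i
    }
    where
    eq₀ : f zero ≡ g zero
    eq₀ = ℕₚ.≤-antisym (f≤g zero)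
      (ℕₚ.+-cancelʳ-≤ (sum (f ∘ suc)) _ _
        (ℕₚ.≤-trans (ℕₚ.+-monoʳ-≤ (g zero) (sum-mono (f≤g ∘ suc))) (ℕₚ.≤-reflexive (sym eq))))

  sum-const : ∀ n {k} → sum {n} (λ _ → k) ≡ n * k
  sum-const zero    = refl
  sum-const (suc n) {k} = cong (k +_) (sum-const n)

  𝟙 : ∀ {p} {P : Set p} → Dec P → ℕ
  𝟙 (yes _) = 1
  𝟙 (no  _) = 0

  𝟙-yes : ∀ {p} {P : Set p} (d : Dec P) → P → 𝟙 d ≡ 1
  𝟙-yes (yes _) _ = refl
  𝟙-yes (no ¬p) p = contradiction p ¬p

  𝟙-no : ∀ {p} {P : Set p} (d : Dec P) → ¬ P → 𝟙 d ≡ 0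
  𝟙-no (yes p) ¬p = contradiction p ¬p
  𝟙-no (no  _) _  = refl

  𝟙-cong : ∀ {p r} {P : Set p} {R : Set r} (d : Dec P) (e : Dec R) → (P → R) → (R → P) → 𝟙 d ≡ 𝟙 e
  𝟙-cong (yes p) e f g = sym (𝟙-yes e (f p))
  𝟙-cong (no ¬p) e f g = sym (𝟙-no e (¬p ∘ g))

  𝟙-mono : ∀ {p r} {P : Set p} {R : Set r} (d : Dec P) (e : Dec R) → (P → R) → 𝟙 d ≤ 𝟙 e
  𝟙-mono (yes p) e f = ℕₚ.≤-reflexive (sym (𝟙-yes e (f p)))
  𝟙-mono (no _)  e f = z≤n

  𝟙-× : ∀ {p r} {P : Set p} {R : Set r} (d : Dec P) (e : Dec R) → 𝟙 (d ×-dec e) ≡ 𝟙 d * 𝟙 e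
  𝟙-× (yes _) (yes _) = refl
  𝟙-× (yes _) (no _)  = refl
  𝟙-× (no _)  (yes _) = refl
  𝟙-× (no _)  (no _)  = refl

  module _ {a ℓ n} {S : Setoid a ℓ} (𝓢 : HasCardinality S n) where
    open Setoid S using (Carrier; _≈_) renaming (refl to ≈-refl; sym to ≈-sym; trans to ≈-trans)
    open Inverse 𝓢 using (to; from; to-cong; strictlyInverseʳ; strictlyInverseˡ)

    from∘to : ∀ x → from (to x) ≈ x
    from∘to = strictlyInverseʳ

    to-injective : ∀ {x y} → to x ≡ to y → x ≈ y
    to-injective {x} {y} eq = ≈-trans (≈-sym (from∘to x)) (≈-trans (Inverse.from-cong 𝓢 eq) (from∘to y))

    opaque
      decEq : ∀ x y → Dec (x ≈ y)
      decEq x y = map′ to-injective to-cong (to x Finₚ.≟ to y)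

    opaque
      ∑ : (Carrier → ℕ) → ℕ
      ∑ f = sum (f ∘ from)

    count : ∀ {p} {P : Carrier → Set p} → (∀ x → Dec (P x)) → ℕ
    count P? = ∑ (λ x → 𝟙 (P? x))

    opaque
      unfolding ∑

      ∑-cong : ∀ {f g} → (∀ x → f x ≡ g x) → ∑ f ≡ ∑ g
      ∑-cong f≗g = Sum.sum-cong-≗ (f≗g ∘ from)

      ∑-mono-≡ : ∀ {f g : Carrier → ℕ} → (∀ {x y} → x ≈ y → f x ≡ f y) → (∀ {x y} → x ≈ y → g x ≡ g y) →
                 (∀ x → f x ≤ g x) → ∑ f ≡ ∑ g → ∀ x → f x ≡ g x
      ∑-mono-≡ {f} {g} f-cong g-cong f≤g eq x = begin
        f x  ≡⟨ f-cong (from∘to x) ⟨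
        f (from (to x)) ≡⟨ sum-mono-≡ (f≤g ∘ from) eq (to x) ⟩
        g (from (to x)) ≡⟨ g-cong (from∘to x) ⟩
        g x ∎
        where open ≡-Reasoning

      ∑-+ : ∀ f g → ∑ (λ x → f x + g x) ≡ ∑ f + ∑ g
      ∑-+ f g = Sum.∑-distrib-+ (f ∘ from) (g ∘ from)

      ∑-*ˡ : ∀ k f → ∑ (λ x → k * f x) ≡ k * ∑ f
      ∑-*ˡ k f = sym (Sum.*-distribˡ-sum k (f ∘ from))

      ∑-*ʳ : ∀ k f → ∑ (λ x → f x * k) ≡ ∑ f * k
      ∑-*ʳ k f = sym (Sum.*-distribʳ-sum k (f ∘ from))

      ∑-const : ∀ k → ∑ (λ _ → k) ≡ n * k
      ∑-const k = sum-const n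

    any? : ∀ {p} {P : Carrier → Set p} → (∀ {x y} → x ≈ y → P x → P y) → (∀ x → Dec (P x)) → Dec (∃[ x ] P x)
    any? resp P? = map′ (λ (i , p) → from i , p) (λ (x , p) → to x , resp (≈-sym (from∘to x)) p) (Finₚ.any? (P? ∘ from))

    private
      sum-𝟙-zero : ∀ {m p} {P : Fin m → Set p} (P? : ∀ i → Dec (P i)) → (∀ i → ¬ P i) → sum (𝟙 ∘ P?) ≡ 0
      sum-𝟙-zero {m} P? ¬P = trans (Sum.sum-cong-≗ (λ i → 𝟙-no (P? i) (¬P i))) (trans (sum-const m) (ℕₚ.*-zeroʳ m))

      sum-𝟙-one : ∀ {m p} {P : Fin m → Set p} (P? : ∀ i → Dec (P i)) i → P i → (∀ j → P j → j ≡ i) → sum (𝟙 ∘ P?) ≡ 1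
      sum-𝟙-one P? zero    Pi unique = cong₂ _+_ (𝟙-yes (P? zero) Pi)
        (sum-𝟙-zero (P? ∘ suc) (λ j Pj → contradiction (unique (suc j) Pj) λ ()))
      sum-𝟙-one P? (suc i) Pi unique = cong₂ _+_ (𝟙-no (P? zero) (λ P₀ → contradiction (unique zero P₀) λ ()))
        (sum-𝟙-one (P? ∘ suc) i Pi (λ j Pj → Finₚ.suc-injective (unique (suc j) Pj)))

    module _ {p} {P : Carrier → Set p} (P? : ∀ x → Dec (P x)) where

      opaque
        unfolding ∑

        count-empty : (∀ x → ¬ P x) → count P? ≡ 0
        count-empty ¬P = sum-𝟙-zero (P? ∘ from) (¬P ∘ from)

        count-unique : (∀ {x y} → x ≈ y → P x → P y) → ∀ x → P x → (∀ y → P y → y ≈ x) → count P? ≡ 1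
        count-unique resp x Px unique = sum-𝟙-one (P? ∘ from) (to x) (resp (≈-sym (from∘to x)) Px)
          (λ j Pj → trans (sym (strictlyInverseˡ j)) (to-cong (unique (from j) Pj)))

      count-inhabited : (∀ {x y} → x ≈ y → P x → P y) → ∀ {x} → P x → count P? ≢ 0
      count-inhabited resp {x} Px none = contradiction (trans (sym (𝟙-yes (P? x) Px)) (sym (∑-mono-≡ (λ _ → refl)
        (λ e → 𝟙-cong (P? _) (P? _) (resp e) (resp (≈-sym e))) (λ _ → z≤n)
          (trans (trans (∑-const 0) (ℕₚ.*-zeroʳ n)) (sym none)) x))) λ ()

      count-cong : ∀ {r} {R : Carrier → Set r} (R? : ∀ x → Dec (R x)) → (∀ x → P x → R x) → (∀ x → R x → P x) →
        count P? ≡ count R?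
      count-cong R? f g = ∑-cong (λ x → 𝟙-cong (P? x) (R? x) (f x) (g x))

      count-⊎ : ∀ {r s} {A : Carrier → Set r} {B : Carrier → Set s} (A? : ∀ x → Dec (A x)) (B? : ∀ x → Dec (B x)) →
                (∀ {x} → P x → A x ⊎ B x) → (∀ {x} → A x → P x) → (∀ {x} → B x → P x) → (∀ {x} → A x → ¬ B x) →
                count P? ≡ count A? + count B?
      count-⊎ A? B? split A⇒P B⇒P disjoint = trans (∑-cong (λ x → cases x (A? x) (B? x))) (∑-+ _ _)
        where
        cases : ∀ x (a : Dec _) (b : Dec _) → 𝟙 (P? x) ≡ 𝟙 a + 𝟙 b
        cases x (yes a) (yes b) = contradiction b (disjoint a)
        cases x (yes a) (no _)  = 𝟙-yes (P? x) (A⇒P a)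
        cases x (no _)  (yes b) = 𝟙-yes (P? x) (B⇒P b)
        cases x (no ¬a) (no ¬b) = 𝟙-no (P? x) (λ p → [ ¬a , ¬b ]′ (split p))

      count-all : (∀ x → P x) → count P? ≡ n
      count-all all = trans (∑-cong (λ x → 𝟙-yes (P? x) (all x))) (trans (∑-const 1) (ℕₚ.*-identityʳ n))

    count-⊆-≡ : ∀ {p r} {P : Carrier → Set p} {R : Carrier → Set r} (P? : ∀ x → Dec (P x)) (R? : ∀ x → Dec (R x)) →
                (∀ {x y} → x ≈ y → P x → P y) → (∀ {x y} → x ≈ y → R x → R y) →
                (∀ x → P x → R x) → count P? ≡ count R? → ∀ x → R x → P x
    count-⊆-≡ P? R? P-resp R-resp P⊆R eq x Rx = equal (P? x)
      (∑-mono-≡ (λ e → 𝟙-cong (P? _) (P? _) (P-resp e) (P-resp (≈-sym e)))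
        (λ e → 𝟙-cong (R? _) (R? _) (R-resp e) (R-resp (≈-sym e)))
        (λ y → 𝟙-mono (P? y) (R? y) (P⊆R y)) eq x)
      where
      equal : (d : Dec _) → 𝟙 d ≡ 𝟙 (R? x) → _
      equal (yes Px) _  = Px
      equal (no _)   e = contradiction (trans e (𝟙-yes (R? x) Rx)) λ ()

    ∑-pick : ∀ {f : Carrier → ℕ} → (∀ {x y} → x ≈ y → f x ≡ f y) → ∀ z → ∑ (λ x → 𝟙 (decEq z x) * f x) ≡ f z
    ∑-pick {f} f-cong z = begin
      ∑ (λ x → 𝟙 (decEq z x) * f x) ≡⟨ ∑-cong (λ x → eq x (decEq z x)) ⟩
      ∑ (λ x → 𝟙 (decEq z x) * f z) ≡⟨ ∑-*ʳ (f z) _ ⟩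
      count (decEq z) * f z
        ≡⟨ cong (_* f z) (count-unique (decEq z) (λ e e′ → ≈-trans e′ e) z ≈-refl (λ _ → ≈-sym)) ⟩
      1 * f z  ≡⟨ ℕₚ.*-identityˡ (f z) ⟩
      f z ∎
      where
      open ≡-Reasoning
      eq : ∀ x (d : Dec (z ≈ x)) → 𝟙 d * f x ≡ 𝟙 d * f z
      eq x (yes z≈x) = cong (1 *_) (f-cong (≈-sym z≈x))
      eq x (no _)    = refl

    ∑-const-but : ∀ {f : Carrier → ℕ} k z → (∀ {x y} → x ≈ y → f x ≡ f y) → (∀ x → ¬ (x ≈ z) → f x ≡ k) →
      ∑ f + k ≡ f z + n * k
    ∑-const-but {f} k z f-cong const = begin
      ∑ f + k  ≡⟨ cong (∑ f +_) (∑-pick (λ _ → refl) z) ⟨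
      ∑ f + ∑ (λ x → 𝟙 (decEq z x) * k)  ≡⟨ ∑-+ f _ ⟨
      ∑ (λ x → f x + 𝟙 (decEq z x) * k)  ≡⟨ ∑-cong (λ x → eq x (decEq z x)) ⟩
      ∑ (λ x → 𝟙 (decEq z x) * f x + k)  ≡⟨ ∑-+ _ _ ⟩
      ∑ (λ x → 𝟙 (decEq z x) * f x) + ∑ (λ x → k)  ≡⟨ cong₂ _+_ (∑-pick f-cong z) (∑-const k) ⟩
      f z + n * k ∎
      where
      open ≡-Reasoning
      eq : ∀ x (d : Dec (z ≈ x)) → f x + 𝟙 d * k ≡ 𝟙 d * f x + k
      eq x (yes _)  = cong₂ _+_ (sym (ℕₚ.*-identityˡ (f x))) (ℕₚ.*-identityˡ k)
      eq x (no z≉x) = trans (ℕₚ.+-identityʳ (f x)) (const x (z≉x ∘ ≈-sym))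

  module _ {a ℓ n} {S : Setoid a ℓ} (𝓢 : HasCardinality S n)
           {a′ ℓ′ n′} {T : Setoid a′ ℓ′} (𝓣 : HasCardinality T n′) where
    private
      module S = Setoid S
      module T = Setoid T

    opaque
      unfolding ∑

      ∑-swap : ∀ (f : S.Carrier → T.Carrier → ℕ) → ∑ 𝓢 (λ s → ∑ 𝓣 (f s)) ≡ ∑ 𝓣 (λ t → ∑ 𝓢 (λ s → f s t))
      ∑-swap f = Sum.∑-comm (λ i j → f (Inverse.from 𝓢 i) (Inverse.from 𝓣 j))

    ∑-fibre : ∀ (h : S.Carrier → T.Carrier) (f : S.Carrier → ℕ) → ∑ 𝓢 f ≡ ∑ 𝓣
      (λ t → ∑ 𝓢 (λ s → 𝟙 (decEq 𝓣 (h s) t) * f s))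
    ∑-fibre h f = begin
      ∑ 𝓢 f  ≡⟨ ∑-cong 𝓢 (λ s → ∑-pick 𝓣 (λ _ → refl) (h s)) ⟨
      ∑ 𝓢 (λ s → ∑ 𝓣 (λ t → 𝟙 (decEq 𝓣 (h s) t) * f s))  ≡⟨ ∑-swap _ ⟩
      ∑ 𝓣 (λ t → ∑ 𝓢 (λ s → 𝟙 (decEq 𝓣 (h s) t) * f s)) ∎
      where open ≡-Reasoning

    count-fibre : ∀ (h : S.Carrier → T.Carrier) {p} {P : S.Carrier → Set p} (P? : ∀ s → Dec (P s)) →
                  count 𝓢 P? ≡ ∑ 𝓣 (λ t → count 𝓢 (λ s → decEq 𝓣 (h s) t ×-dec P? s))
    count-fibre h P? = trans (∑-fibre h (𝟙 ∘ P?)) (∑-cong 𝓣 (λ t → ∑-cong 𝓢 (λ s → sym (𝟙-× (decEq 𝓣 (h s) t) (P? s)))))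

    module _ {p p′ r} {P : S.Carrier → Set p} {P′ : T.Carrier → Set p′} {R : S.Carrier → T.Carrier → Set r}
             (P? : ∀ s → Dec (P s)) (P′? : ∀ t → Dec (P′ t)) (R? : ∀ s t → Dec (R s t))
             (P-resp : ∀ {s s′} → s S.≈ s′ → P s → P s′) (P′-resp : ∀ {t t′} → t T.≈ t′ → P′ t → P′ t′)
             (R-respˡ : ∀ {s s′ t} → s S.≈ s′ → R s t → R s′ t) (R-respʳ : ∀ {s t t′} → t T.≈ t′ → R s t → R s t′)
             where

      count-corr : (∀ {s} → P s → ∃[ t ] P′ t × R s t) → (∀ {t} → P′ t → ∃[ s ] P s × R s t) →
                   (∀ {s t t′} → P s → P′ t → P′ t′ → R s t → R s t′ → t T.≈ t′) →
                   (∀ {s s′ t} → P s → P s′ → P′ t → R s t → R s′ t → s S.≈ s′) →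
                   count 𝓢 P? ≡ count 𝓣 P′?
      count-corr tot surj uniqʳ uniqˡ = begin
        ∑ 𝓢 (λ s → 𝟙 (P? s))  ≡⟨ ∑-cong 𝓢 (λ s → sym (row s (P? s))) ⟩
        ∑ 𝓢 (λ s → ∑ 𝓣 (λ t → 𝟙 (P? s) * (𝟙 (P′? t) * 𝟙 (R? s t))))  ≡⟨ ∑-swap _ ⟩
        ∑ 𝓣 (λ t → ∑ 𝓢 (λ s → 𝟙 (P? s) * (𝟙 (P′? t) * 𝟙 (R? s t))))  ≡⟨ ∑-cong 𝓣 (λ t → col t (P′? t)) ⟩
        ∑ 𝓣 (λ t → 𝟙 (P′? t)) ∎
        where
        open ≡-Reasoning
        row : ∀ s (d : Dec (P s)) → ∑ 𝓣 (λ t → 𝟙 d * (𝟙 (P′? t) * 𝟙 (R? s t))) ≡ 𝟙 d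
        row s (no _)   = trans (∑-const 𝓣 0) (ℕₚ.*-zeroʳ n′)
        row s (yes Ps) = trans
          (∑-cong 𝓣 (λ t → trans (ℕₚ.*-identityˡ _) (sym (𝟙-× (P′? t) (R? s t)))))
          (let t , P′t , Rst = tot Ps in
           count-unique 𝓣 (λ t → P′? t ×-dec R? s t) (λ e (a , b) → P′-resp e a , R-respʳ e b) t (P′t , Rst)
             (λ t′ (P′t′ , Rst′) → uniqʳ Ps P′t′ P′t Rst′ Rst))
        col : ∀ t (d : Dec (P′ t)) → ∑ 𝓢 (λ s → 𝟙 (P? s) * (𝟙 d * 𝟙 (R? s t))) ≡ 𝟙 d
        col t (no _)    = trans (∑-cong 𝓢 (λ s → ℕₚ.*-zeroʳ (𝟙 (P? s)))) (trans (∑-const 𝓢 0) (ℕₚ.*-zeroʳ n))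
        col t (yes P′t) = trans
          (∑-cong 𝓢 (λ s → trans (cong (𝟙 (P? s) *_) (ℕₚ.*-identityˡ _)) (sym (𝟙-× (P? s) (R? s t)))))
          (let s , Ps , Rst = surj P′t in
           count-unique 𝓢 (λ s → P? s ×-dec R? s t) (λ e (a , b) → P-resp e a , R-respˡ e b) s (Ps , Rst)
             (λ s′ (Ps′ , Rs′t) → uniqˡ Ps′ Ps P′t Rs′t Rst))

    count-bij : ∀ {p p′} {P : S.Carrier → Set p} {P′ : T.Carrier → Set p′}
                (P? : ∀ s → Dec (P s)) (P′? : ∀ t → Dec (P′ t))
                (P-resp : ∀ {s s′} → s S.≈ s′ → P s → P s′) (P′-resp : ∀ {t t′} → t T.≈ t′ → P′ t → P′ t′)
                (f : S.Carrier → T.Carrier) (g : T.Carrier → S.Carrier) →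
                (∀ {s s′} → s S.≈ s′ → f s T.≈ f s′) → (∀ {t t′} → t T.≈ t′ → g t S.≈ g t′) →
                (∀ {s} → P s → P′ (f s)) → (∀ {t} → P′ t → P (g t)) →
                (∀ {s} → P s → g (f s) S.≈ s) → (∀ {t} → P′ t → f (g t) T.≈ t) →
                count 𝓢 P? ≡ count 𝓣 P′?
    count-bij P? P′? P-resp P′-resp f g f-cong g-cong P⇒P′ P′⇒P gf fg =
      count-corr P? P′? (λ s t → decEq 𝓣 (f s) t) P-resp P′-resp
        (λ e → T.trans (f-cong (S.sym e))) (λ e e′ → T.trans e′ e)
        (λ {s} Ps → f s , P⇒P′ Ps , T.refl) (λ {t} P′t → g t , P′⇒P P′t , fg P′t)
        (λ _ _ _ e e′ → T.trans (T.sym e) e′)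
        (λ Ps Ps′ _ e e′ → S.trans (S.sym (gf Ps)) (S.trans (g-cong (T.trans e (T.sym e′))) (gf Ps′)))

    ∑-bij : ∀ (h : S.Carrier → T.Carrier) (h⁻¹ : T.Carrier → S.Carrier) →
            (∀ {s s′} → s S.≈ s′ → h s T.≈ h s′) → (∀ {t t′} → t T.≈ t′ → h⁻¹ t S.≈ h⁻¹ t′) →
            (∀ s → h⁻¹ (h s) S.≈ s) → (∀ t → h (h⁻¹ t) T.≈ t) →
            ∀ {g : T.Carrier → ℕ} → (∀ {t t′} → t T.≈ t′ → g t ≡ g t′) → ∑ 𝓢 (g ∘ h) ≡ ∑ 𝓣 g
    ∑-bij h h⁻¹ h-cong h⁻¹-cong left right {g} g-cong = begin
      ∑ 𝓢 (g ∘ h)  ≡⟨ ∑-fibre h (g ∘ h) ⟩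
      ∑ 𝓣 (λ t → ∑ 𝓢 (λ s → 𝟙 (decEq 𝓣 (h s) t) * g (h s)))  ≡⟨ ∑-cong 𝓣 (λ t → ∑-cong 𝓢 (λ s → eq (decEq 𝓣 (h s) t))) ⟩
      ∑ 𝓣 (λ t → ∑ 𝓢 (λ s → 𝟙 (decEq 𝓣 (h s) t) * g t))  ≡⟨ ∑-cong 𝓣 (λ t → ∑-*ʳ 𝓢 (g t) _) ⟩
      ∑ 𝓣 (λ t → count 𝓢 (λ s → decEq 𝓣 (h s) t) * g t)  ≡⟨ ∑-cong 𝓣 (λ t → cong (_* g t) (one t)) ⟩
      ∑ 𝓣 (λ t → 1 * g t)  ≡⟨ ∑-cong 𝓣 (λ t → ℕₚ.*-identityˡ (g t)) ⟩
      ∑ 𝓣 g ∎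
      where
      open ≡-Reasoning
      eq : ∀ {s t} (d : Dec (h s T.≈ t)) → 𝟙 d * g (h s) ≡ 𝟙 d * g t
      eq (yes e) = cong (1 *_) (g-cong e)
      eq (no _)  = refl
      one : ∀ t → count 𝓢 (λ s → decEq 𝓣 (h s) t) ≡ 1
      one t = count-unique 𝓢 (λ s → decEq 𝓣 (h s) t) (λ e e′ → T.trans (h-cong (S.sym e)) e′) (h⁻¹ t) (right t)
        (λ s e → S.trans (S.sym (left s)) (h⁻¹-cong e))

open FiniteSums

module HestenesHigman where
  open ≡ using (refl; sym; trans; cong; cong₂; setoid; module ≡-Reasoning)
  open import Data.Nat.Base using (_+_; _*_)
  open import Function.Construct.Identity using (inverse)

  module PairInvariants {n} (adj : Fin n → Fin n → Bool)
    (adj-sym : ∀ x y → adj x y ≡ adj y x) (adj-irrefl : ∀ x → adj x x ≡ false) where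

    𝓝 : HasCardinality (setoid (Fin n)) n
    𝓝 = inverse (setoid (Fin n))

    Invariant : ∀ {a} {A : Set a} → (Fin n → Fin n → A) → Set a
    Invariant Φ = ∀ {x y x′ y′} → x ≢ y → x′ ≢ y′ → adj x y ≡ adj x′ y′ → Φ x y ≡ Φ x′ y′

    A : Fin n → Fin n → ℕ
    A x y = 𝟙 (adj x y Boolₚ.≟ true)

    A-sym : ∀ x y → A x y ≡ A y x
    A-sym x y = cong (λ b → 𝟙 (b Boolₚ.≟ true)) (adj-sym x y)

    deg : Fin n → ℕ
    deg x = ∑ 𝓝 (A x)

    codeg : Fin n → Fin n → ℕ
    codeg x y = ∑ 𝓝 (λ z → A x z * A y z)

    -- Every edge is counted twice.
    commonEdges : Fin n → Fin n → ℕ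
    commonEdges x y = ∑ 𝓝 (λ z → (A x z * A y z) * ∑ 𝓝 (λ w → (A x w * A y w) * A z w))

    values : ∀ {Φ : Fin n → Fin n → ℕ} → Invariant Φ → ∃[ κ ] (∀ {x y} → x ≢ y → Φ x y ≡ κ (adj x y))
    values {Φ} inv = κ , λ {x} {y} x≢y → sym (κ-adj x y x≢y (search (adj x y)))
      where
      search : ∀ b → Dec (∃[ x ] ∃[ y ] (x ≢ y × adj x y ≡ b))
      search b = Finₚ.any? λ x → Finₚ.any? λ y → ¬? (x Finₚ.≟ y) ×-dec (adj x y Boolₚ.≟ b)
      pick : ∀ {b} → Dec (∃[ x ] ∃[ y ] (x ≢ y × adj x y ≡ b)) → ℕ
      pick (yes (x , y , _)) = Φ x y
      pick (no _)            = 0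
      κ : Bool → ℕ
      κ b = pick (search b)
      κ-adj : ∀ x y → x ≢ y → (d : Dec (∃[ x′ ] ∃[ y′ ] (x′ ≢ y′ × adj x′ y′ ≡ adj x y))) → pick d ≡ Φ x y
      κ-adj x y x≢y (yes (_ , _ , x′≢y′ , eq)) = inv x′≢y′ x≢y eq
      κ-adj x y x≢y (no none)                  = contradiction (x , y , x≢y , refl) none

    Invariant-cancelʳ : ∀ {Φ Ψ Θ : Fin n → Fin n → ℕ} → (∀ {x y} → x ≢ y → Θ x y ≡ Φ x y + Ψ x y) →
                        Invariant Ψ → Invariant Θ → Invariant Φ
    Invariant-cancelʳ {Φ} {Ψ} split Ψ-inv Θ-inv {x} {y} {x′} {y′} p p′ e = ℕₚ.+-cancelʳ-≡ (Ψ x y) _ _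
      (trans (sym (split p)) (trans (Θ-inv p p′ e) (trans (split p′) (cong (Φ x′ y′ +_) (sym (Ψ-inv p p′ e))))))

    Invariant-op : ∀ (_∙_ : ℕ → ℕ → ℕ) {Φ Ψ : Fin n → Fin n → ℕ} → Invariant Φ → Invariant Ψ → Invariant
      (λ x y → Φ x y ∙ Ψ x y)
    Invariant-op _∙_ Φ-inv Ψ-inv p p′ e = cong₂ _∙_ (Φ-inv p p′ e) (Ψ-inv p p′ e)

    Invariant-cong : ∀ {Φ Ψ : Fin n → Fin n → ℕ} → (∀ {x y} → x ≢ y → Φ x y ≡ Ψ x y) → Invariant Ψ → Invariant Φ
    Invariant-cong eq Ψ-inv p p′ e = trans (eq p) (trans (Ψ-inv p p′ e) (sym (eq p′)))

    Invariant-A : Invariant A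
    Invariant-A _ _ e = cong (λ b → 𝟙 (b Boolₚ.≟ true)) e

    Class : Bool → Bool → (x y z : Fin n) → Set
    Class α β x y z = (z ≢ x × z ≢ y) × (adj x z ≡ α × adj y z ≡ β)

    class? : ∀ α β x y z → Dec (Class α β x y z)
    class? α β x y z = (¬? (z Finₚ.≟ x) ×-dec ¬? (z Finₚ.≟ y)) ×-dec ((adj x z Boolₚ.≟ α) ×-dec (adj y z Boolₚ.≟ β))

    C : Bool → Bool → (x y z : Fin n) → ℕ
    C α β x y z = 𝟙 (class? α β x y z)

    private
      data Position (x y z : Fin n) : Set where
        atˡ : z ≡ x → z ≢ y → Position x y z
        atʳ : z ≢ x → z ≡ y → Position x y z
        off : ∀ α β → z ≢ x → z ≢ y → adj x z ≡ α → adj y z ≡ β → Position x y z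

      position : ∀ {x y} → x ≢ y → ∀ z → Position x y z
      position {x} {y} x≢y z with z Finₚ.≟ x | z Finₚ.≟ y
      ... | yes z≡x | yes z≡y = contradiction (trans (sym z≡x) z≡y) x≢y
      ... | yes z≡x | no z≢y  = atˡ z≡x z≢y
      ... | no z≢x  | yes z≡y = atʳ z≢x z≡y
      ... | no z≢x  | no z≢y  = off (adj x z) (adj y z) z≢x z≢y refl refl

      δ : Fin n → Fin n → ℕ
      δ x z = 𝟙 (decEq 𝓝 x z)

      indicator : Bool → Bool → Bool → Bool → ℕ
      indicator α β α′ β′ = 𝟙 ((α Boolₚ.≟ α′) ×-dec (β Boolₚ.≟ β′))

      C-off : ∀ {α β α′ β′ x y z} → z ≢ x → z ≢ y → adj x z ≡ α → adj y z ≡ β → C α′ β′ x y z ≡ indicator α β α′ β′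
      C-off {α} {β} {α′} {β′} {x} {y} {z} z≢x z≢y eα eβ = 𝟙-cong (class? α′ β′ x y z)
        ((α Boolₚ.≟ α′) ×-dec (β Boolₚ.≟ β′))
        (λ (_ , a , b) → trans (sym eα) a , trans (sym eβ) b) (λ (a , b) → (z≢x , z≢y) , trans eα a , trans eβ b)

      C-atˡ : ∀ {α β x y z} → z ≡ x → C α β x y z ≡ 0
      C-atˡ {α} {β} {x} {y} {z} e = 𝟙-no (class? α β x y z) (λ ((p , _) , _) → p e)

      C-atʳ : ∀ {α β x y z} → z ≡ y → C α β x y z ≡ 0
      C-atʳ {α} {β} {x} {y} {z} e = 𝟙-no (class? α β x y z) (λ ((_ , p) , _) → p e)

      δ-≡ : ∀ {x z} → z ≡ x → δ x z ≡ 1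
      δ-≡ {x} {z} e = 𝟙-yes (decEq 𝓝 x z) (sym e)

      δ-≢ : ∀ {x z} → z ≢ x → δ x z ≡ 0
      δ-≢ {x} {z} p = 𝟙-no (decEq 𝓝 x z) (p ∘ sym)

      A-irrefl : ∀ {x z} → z ≡ x → A x z ≡ 0
      A-irrefl {x} refl = cong (λ b → 𝟙 (b Boolₚ.≟ true)) (adj-irrefl x)

      A-≡ : ∀ {x z b} → adj x z ≡ b → A x z ≡ 𝟙 (b Boolₚ.≟ true)
      A-≡ = cong (λ b → 𝟙 (b Boolₚ.≟ true))

      A-xy : ∀ {x y} z → z ≡ y → A x z ≡ A x y
      A-xy {x} z = cong (A x)

    A-splitˡ : ∀ {x y} → x ≢ y → ∀ z → A x z ≡ (C true true x y z + C true false x y z) + A x y * δ y z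
    A-splitˡ {x} {y} x≢y z with position x≢y z
    ... | atˡ z≡x z≢y = trans (A-irrefl z≡x) (sym (cong₂ _+_
      (cong₂ _+_ (C-atˡ {true} {true} z≡x) (C-atˡ {true} {false} z≡x))
      (trans (cong (A x y *_) (δ-≢ z≢y)) (ℕₚ.*-zeroʳ (A x y)))))
    ... | atʳ z≢x z≡y = trans (A-xy z z≡y) (sym (trans
      (cong₂ _+_ (cong₂ _+_ (C-atʳ {true} {true} z≡y) (C-atʳ {true} {false} z≡y)) (cong (A x y *_) (δ-≡ z≡y)))
      (ℕₚ.*-identityʳ (A x y))))
    ... | off α β z≢x z≢y eα eβ = trans (A-≡ eα) (sym (trans
      (cong₂ _+_ (cong₂ _+_ (C-off z≢x z≢y eα eβ) (C-off z≢x z≢y eα eβ))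
      (trans (cong (A x y *_) (δ-≢ z≢y)) (ℕₚ.*-zeroʳ (A x y)))) (table α β)))
      where
      table : ∀ α β → (indicator α β true true + indicator α β true false) + 0 ≡ 𝟙 (α Boolₚ.≟ true)
      table true  true  = refl
      table true  false = refl
      table false true  = refl
      table false false = refl

    A-splitʳ : ∀ {x y} → x ≢ y → ∀ z → A y z ≡ (C true true x y z + C false true x y z) + A x y * δ x z
    A-splitʳ {x} {y} x≢y z with position x≢y z
    ... | atʳ z≢x z≡y = trans (A-irrefl z≡y) (sym (cong₂ _+_
      (cong₂ _+_ (C-atʳ {true} {true} z≡y) (C-atʳ {false} {true} z≡y))
      (trans (cong (A x y *_) (δ-≢ z≢x)) (ℕₚ.*-zeroʳ (A x y)))))
    ... | atˡ z≡x z≢y = trans (trans (A-xy z z≡x) (A-sym y x))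
      (sym (trans (cong₂ _+_ (cong₂ _+_ (C-atˡ {true} {true} z≡x) (C-atˡ {false} {true} z≡x))
      (cong (A x y *_) (δ-≡ z≡x))) (ℕₚ.*-identityʳ (A x y))))
    ... | off α β z≢x z≢y eα eβ = trans (A-≡ eβ) (sym (trans
      (cong₂ _+_ (cong₂ _+_ (C-off z≢x z≢y eα eβ) (C-off z≢x z≢y eα eβ))
      (trans (cong (A x y *_) (δ-≢ z≢x)) (ℕₚ.*-zeroʳ (A x y)))) (table α β)))
      where
      table : ∀ α β → (indicator α β true true + indicator α β false true) + 0 ≡ 𝟙 (β Boolₚ.≟ true)
      table true  true  = refl
      table true  false = refl
      table false true  = refl
      table false false = refl

    1-split : ∀ {x y} → x ≢ y → ∀ z → 1 ≡ C false false x y z +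
      (C true true x y z + (C true false x y z + (C false true x y z + (δ x z + δ y z))))
    1-split {x} {y} x≢y z with position x≢y z
    ... | atˡ z≡x z≢y = sym (cong₂ _+_ (C-atˡ {false} {false} z≡x)
      (cong₂ _+_ (C-atˡ {true} {true} z≡x) (cong₂ _+_ (C-atˡ {true} {false} z≡x)
      (cong₂ _+_ (C-atˡ {false} {true} z≡x) (cong₂ _+_ (δ-≡ z≡x) (δ-≢ z≢y))))))
    ... | atʳ z≢x z≡y = sym (cong₂ _+_ (C-atʳ {false} {false} z≡y)
      (cong₂ _+_ (C-atʳ {true} {true} z≡y) (cong₂ _+_ (C-atʳ {true} {false} z≡y)
      (cong₂ _+_ (C-atʳ {false} {true} z≡y) (cong₂ _+_ (δ-≢ z≢x) (δ-≡ z≡y))))))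
    ... | off α β z≢x z≢y eα eβ = sym (trans (cong₂ _+_ c
      (cong₂ _+_ c (cong₂ _+_ c (cong₂ _+_ c (cong₂ _+_ (δ-≢ z≢x) (δ-≢ z≢y)))))) (table α β))
      where
      c : ∀ {α′ β′} → C α′ β′ x y z ≡ indicator α β α′ β′
      c = C-off z≢x z≢y eα eβ
      table : ∀ α β → indicator α β false false + (indicator α β true true +
        (indicator α β true false + (indicator α β false true + 0))) ≡ 1
      table true  true  = refl
      table true  false = refl
      table false true  = refl
      table false false = refl

    module Refine (g : (x y w : Fin n) → ℕ) where

      S : Bool → Bool → Fin n → Fin n → ℕ
      S α β x y = ∑ 𝓝 (λ w → C α β x y w * g x y w)

      private
        pick : ∀ x y z → ∑ 𝓝 (λ w → δ z w * g x y w) ≡ g x y z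
        pick x y z = ∑-pick 𝓝 (cong (g x y)) z

        sum₃ : ∀ {x y} (f h : Fin n → ℕ) k z → ∑ 𝓝 (λ w → ((f w + h w) + k * δ z w) * g x y w) ≡
               ∑ 𝓝 (λ w → h w * g x y w) + (∑ 𝓝 (λ w → f w * g x y w) + k * g x y z)
        sum₃ {x} {y} f h k z = begin
          ∑ 𝓝 (λ w → ((f w + h w) + k * δ z w) * g x y w)
            ≡⟨ ∑-cong 𝓝 (λ w → +-*-Solver.solve 5 (λ f h k d g → (((f :+ h) :+ k :* d) :* g) := h :* g :+
              (f :* g :+ k :* (d :* g))) refl (f w) (h w) k (δ z w) (g x y w)) ⟩
          ∑ 𝓝 (λ w → h w * g x y w + (f w * g x y w + k * (δ z w * g x y w)))
            ≡⟨ trans (∑-+ 𝓝 _ _) (cong (∑ 𝓝 (λ w → h w * g x y w) +_)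
              (trans (∑-+ 𝓝 _ _) (cong (∑ 𝓝 (λ w → f w * g x y w) +_)
              (trans (∑-*ˡ 𝓝 k _) (cong (k *_) (pick x y z)))))) ⟩
          ∑ 𝓝 (λ w → h w * g x y w) + (∑ 𝓝 (λ w → f w * g x y w) + k * g x y z) ∎
          where
          open ≡-Reasoning
          open +-*-Solver using (_:+_; _:*_; _:=_)

      -- Each neighbourhood total is a sum of two class totals and a boundary term, so the total over the class
      -- (true , true) determines the other three.
      refine : Invariant (λ x y → ∑ 𝓝 (g x y)) →
               Invariant (λ x y → ∑ 𝓝 (λ w → A x w * g x y w)) → Invariant (λ x y → ∑ 𝓝 (λ w → A y w * g x y w)) →
               Invariant (λ x y → g x y x) → Invariant (λ x y → g x y y) →
               Invariant (S true true) → ∀ α β → Invariant (S α β)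
      refine total atX atY gx gy base = result
        where
        TF : Invariant (S true false)
        TF = Invariant-cancelʳ
          (λ {x} {y} x≢y → trans (∑-cong 𝓝 (λ w → cong (_* g x y w) (A-splitˡ x≢y w)))
            (sum₃ (C true true x y) (C true false x y) (A x y) y))
          (Invariant-op _+_ base (Invariant-op _*_ Invariant-A gy)) atX
        FT : Invariant (S false true)
        FT = Invariant-cancelʳ
          (λ {x} {y} x≢y → trans (∑-cong 𝓝 (λ w → cong (_* g x y w) (A-splitʳ x≢y w)))
            (sum₃ (C true true x y) (C false true x y) (A x y) x))
          (Invariant-op _+_ base (Invariant-op _*_ Invariant-A gx)) atY
        expand : ∀ {x y} → x ≢ y → ∑ 𝓝 (g x y) ≡ S false false x y +
          (S true true x y + (S true false x y + (S false true x y + (g x y x + g x y y))))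
        expand {x} {y} x≢y = begin
          ∑ 𝓝 (g x y)
            ≡⟨ ∑-cong 𝓝 (λ w → sym (trans (cong (_* g x y w) (sym (1-split x≢y w))) (ℕₚ.*-identityˡ (g x y w)))) ⟩
          ∑ 𝓝 (λ w → (C false false x y w + (C true true x y w +
            (C true false x y w + (C false true x y w + (δ x w + δ y w))))) * g x y w)
            ≡⟨ ∑-cong 𝓝 (λ w → +-*-Solver.solve 7 (λ a b c d e f g →
              (a :+ (b :+ (c :+ (d :+ (e :+ f))))) :* g := a :* g :+
              (b :* g :+ (c :* g :+ (d :* g :+ (e :* g :+ f :* g))))) refl
                 (C false false x y w) (C true true x y w) (C true false x y w) (C false true x y w) (δ x w) (δ y w)
                   (g x y w)) ⟩
          ∑ 𝓝 (λ w → C false false x y w * g x y w + (C true true x y w * g x y w +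
            (C true false x y w * g x y w + (C false true x y w * g x y w + (δ x w * g x y w + δ y w * g x y w)))))
            ≡⟨ trans (∑-+ 𝓝 _ _) (cong (S false false x y +_)
              (trans (∑-+ 𝓝 _ _) (cong (S true true x y +_) (trans (∑-+ 𝓝 _ _) (cong (S true false x y +_)
                 (trans (∑-+ 𝓝 _ _) (cong (S false true x y +_)
                   (trans (∑-+ 𝓝 _ _) (cong₂ _+_ (pick x y x) (pick x y y)))))))))) ⟩
          S false false x y + (S true true x y + (S true false x y + (S false true x y + (g x y x + g x y y)))) ∎
          where
          open ≡-Reasoning
          open +-*-Solver using (_:+_; _:*_; _:=_)
        result : ∀ α β → Invariant (S α β)
        result true  true  = base
        result true  false = TF
        result false true  = FT
        result false false = Invariant-cancelʳ expand (Invariant-op _+_ base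
          (Invariant-op _+_ TF (Invariant-op _+_ FT (Invariant-op _+_ gx gy)))) total

    module Counts {k} (deg≡k : ∀ x → deg x ≡ k) (codeg-inv : Invariant codeg) (edges-inv : Invariant commonEdges) where

      size : Bool → Bool → Fin n → Fin n → ℕ
      size α β x y = ∑ 𝓝 (C α β x y)

      C-true-true : ∀ x y z → C true true x y z ≡ A x z * A y z
      C-true-true x y z = trans (𝟙-cong (class? true true x y z)
        ((adj x z Boolₚ.≟ true) ×-dec (adj y z Boolₚ.≟ true)) proj₂
        (λ (a , b) → ((λ { refl → contradiction (trans (sym a) (adj-irrefl z)) λ () }) , (λ { refl → contradiction
          (trans (sym b) (adj-irrefl z)) λ () })) , a , b))
        (𝟙-× (adj x z Boolₚ.≟ true) (adj y z Boolₚ.≟ true))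

      size-invariant : ∀ α β → Invariant (size α β)
      size-invariant α β = Invariant-cong (λ {x} {y} _ → ∑-cong 𝓝 (λ w → sym (ℕₚ.*-identityʳ (C α β x y w))))
        (refine (λ _ _ _ → refl) (λ {x} {y} {x′} {y′} _ _ _ → trans (total x) (sym (total x′)))
          (λ {x} {y} {x′} {y′} _ _ _ → trans (total y) (sym (total y′)))
          (λ _ _ _ → refl) (λ _ _ _ → refl)
          (Invariant-cong (λ {x} {y} _ → ∑-cong 𝓝 (λ w → trans (ℕₚ.*-identityʳ _) (C-true-true x y w))) codeg-inv) α β)
        where
        open Refine (λ _ _ _ → 1)
        total : ∀ x → ∑ 𝓝 (λ w → A x w * 1) ≡ k
        total x = trans (∑-cong 𝓝 (λ w → ℕₚ.*-identityʳ (A x w))) (deg≡k x)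

      E : Bool → Bool → Bool → Bool → Fin n → Fin n → ℕ
      E α β γ δ x y = ∑ 𝓝 (λ w → C γ δ x y w * ∑ 𝓝 (λ z → C α β x y z * A z w))

      E-sym : ∀ α β γ δ x y → E α β γ δ x y ≡ E γ δ α β x y
      E-sym α β γ δ x y = begin
        ∑ 𝓝 (λ w → C γ δ x y w * ∑ 𝓝 (λ z → C α β x y z * A z w))  ≡⟨ ∑-cong 𝓝 (λ w → ∑-*ˡ 𝓝 (C γ δ x y w) _) ⟨
        ∑ 𝓝 (λ w → ∑ 𝓝 (λ z → C γ δ x y w * (C α β x y z * A z w)))  ≡⟨ ∑-swap 𝓝 𝓝 _ ⟩
        ∑ 𝓝 (λ z → ∑ 𝓝 (λ w → C γ δ x y w * (C α β x y z * A z w)))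
          ≡⟨ ∑-cong 𝓝 (λ z → ∑-cong 𝓝 (λ w → rearrange z w)) ⟩
        ∑ 𝓝 (λ z → ∑ 𝓝 (λ w → C α β x y z * (C γ δ x y w * A w z)))  ≡⟨ ∑-cong 𝓝 (λ z → ∑-*ˡ 𝓝 (C α β x y z) _) ⟩
        ∑ 𝓝 (λ z → C α β x y z * ∑ 𝓝 (λ w → C γ δ x y w * A w z)) ∎
        where
        open ≡-Reasoning
        rearrange : ∀ z w → C γ δ x y w * (C α β x y z * A z w) ≡ C α β x y z * (C γ δ x y w * A w z)
        rearrange z w = trans (cong (λ a → C γ δ x y w * (C α β x y z * a)) (A-sym z w))
          (+-*-Solver.solve 3 (λ c d a → c :* (d :* a) := d :* (c :* a)) refl (C γ δ x y w) (C α β x y z) (A w z))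
          where open +-*-Solver using (_:*_; _:=_)

      private
        κ = proj₁ (values codeg-inv)

        codeg≡κ : ∀ {x y} → x ≢ y → codeg x y ≡ κ (adj x y)
        codeg≡κ = proj₂ (values codeg-inv)

        class-constant : ∀ α β (φ : (x y z : Fin n) → ℕ) k → (∀ {x y z} → Class α β x y z → φ x y z ≡ k) →
                         ∀ x y → ∑ 𝓝 (λ z → C α β x y z * φ x y z) ≡ size α β x y * k
        class-constant α β φ k const x y = trans (∑-cong 𝓝 (λ z → pointwise z (class? α β x y z))) (∑-*ʳ 𝓝 k _)
          where
          pointwise : ∀ z (d : Dec (Class α β x y z)) → 𝟙 d * φ x y z ≡ 𝟙 d * k
          pointwise z (yes c) = cong (1 *_) (const c)
          pointwise z (no _)  = refl

        scaled : ∀ α β {φ : (x y : Fin n) → ℕ} k → (∀ x y → φ x y ≡ size α β x y * k) → Invariant φ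
        scaled α β k eq = Invariant-cong (λ {x} {y} _ → eq x y) (λ p p′ e → cong (_* k) (size-invariant α β p p′ e))

        weigh : ∀ α β (h : (x y w : Fin n) → ℕ) x y → ∑ 𝓝 (λ w → h x y w * ∑ 𝓝 (λ z → C α β x y z * A z w)) ≡
                ∑ 𝓝 (λ z → C α β x y z * ∑ 𝓝 (λ w → h x y w * A z w))
        weigh α β h x y = begin
          ∑ 𝓝 (λ w → h x y w * ∑ 𝓝 (λ z → C α β x y z * A z w))  ≡⟨ ∑-cong 𝓝 (λ w → ∑-*ˡ 𝓝 (h x y w) _) ⟨
          ∑ 𝓝 (λ w → ∑ 𝓝 (λ z → h x y w * (C α β x y z * A z w)))  ≡⟨ ∑-swap 𝓝 𝓝 _ ⟩
          ∑ 𝓝 (λ z → ∑ 𝓝 (λ w → h x y w * (C α β x y z * A z w)))  ≡⟨ ∑-cong 𝓝 (λ z → ∑-cong 𝓝 (λ w →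
            +-*-Solver.solve 3 (λ c d a → c :* (d :* a) := d :* (c :* a)) refl (h x y w) (C α β x y z) (A z w))) ⟩
          ∑ 𝓝 (λ z → ∑ 𝓝 (λ w → C α β x y z * (h x y w * A z w)))  ≡⟨ ∑-cong 𝓝 (λ z → ∑-*ˡ 𝓝 (C α β x y z) _) ⟩
          ∑ 𝓝 (λ z → C α β x y z * ∑ 𝓝 (λ w → h x y w * A z w)) ∎
          where
          open ≡-Reasoning
          open +-*-Solver using (_:*_; _:=_)

        E-refine : ∀ α β → Invariant (E α β true true) → ∀ γ δ → Invariant (E α β γ δ)
        E-refine α β = refine
          (scaled α β k λ x y → trans (∑-cong 𝓝 (λ w → sym (ℕₚ.*-identityˡ _))) (trans (weigh α β (λ _ _ _ → 1) x y)
            (class-constant α β (λ _ _ z → ∑ 𝓝 (λ w → 1 * A z w)) k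
              (λ {x} {y} {z} _ → trans (∑-cong 𝓝 (λ w → ℕₚ.*-identityˡ (A z w))) (deg≡k z)) x y)))
          (scaled α β (κ α) λ x y → trans (weigh α β (λ x y w → A x w) x y)
            (class-constant α β (λ x _ z → codeg x z) (κ α) (λ { ((z≢x , _) , refl , _) → codeg≡κ (z≢x ∘ sym) }) x y))
          (scaled α β (κ β) λ x y → trans (weigh α β (λ x y w → A y w) x y)
            (class-constant α β (λ _ y z → codeg y z) (κ β) (λ { ((_ , z≢y) , _ , refl) → codeg≡κ (z≢y ∘ sym) }) x y))
          (scaled α β (𝟙 (α Boolₚ.≟ true)) (class-constant α β (λ x _ z → A z x) _
            (λ {x} {y} {z} (_ , e , _) → trans (A-sym z x) (cong (λ b → 𝟙 (b Boolₚ.≟ true)) e))))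
          (scaled α β (𝟙 (β Boolₚ.≟ true)) (class-constant α β (λ _ y z → A z y) _
            (λ {x} {y} {z} (_ , _ , e) → trans (A-sym z y) (cong (λ b → 𝟙 (b Boolₚ.≟ true)) e))))
          where open Refine (λ x y w → ∑ 𝓝 (λ z → C α β x y z * A z w))

      E-invariant : ∀ α β γ δ → Invariant (E α β γ δ)
      E-invariant α β = E-refine α β (Invariant-cong (λ {x} {y} _ → E-sym α β true true x y)
        (E-refine true true base α β))
        where
        base : Invariant (E true true true true)
        base = Invariant-cong (λ {x} {y} _ → ∑-cong 𝓝 (λ z → cong₂ _*_ (C-true-true x y z)
          (∑-cong 𝓝 (λ w → cong₂ _*_ (C-true-true x y w) (A-sym w z))))) edges-inv

      Pattern : (α β γ δ η : Bool) (x y z w : Fin n) → Set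
      Pattern α β γ δ η x y z w = (Class α β x y z × Class γ δ x y w) × (z ≢ w × adj z w ≡ η)

      pattern? : ∀ α β γ δ η x y z w → Dec (Pattern α β γ δ η x y z w)
      pattern? α β γ δ η x y z w = (class? α β x y z ×-dec class? γ δ x y w) ×-dec
        (¬? (z Finₚ.≟ w) ×-dec (adj z w Boolₚ.≟ η))

      patterns : (α β γ δ η : Bool) (x y : Fin n) → ℕ
      patterns α β γ δ η x y = ∑ 𝓝 (λ z → ∑ 𝓝 (λ w → 𝟙 (pattern? α β γ δ η x y z w)))

      private
        patterns-true : ∀ α β γ δ x y → patterns α β γ δ true x y ≡ E γ δ α β x y
        patterns-true α β γ δ x y = ∑-cong 𝓝 λ z → trans (∑-cong 𝓝 λ w → trans
          (𝟙-cong (pattern? α β γ δ true x y z w) (class? α β x y z ×-dec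
            (class? γ δ x y w ×-dec (adj w z Boolₚ.≟ true)))
            (λ ((a , b) , _ , c) → a , b , trans (adj-sym w z) c)
            (λ (a , b , c) → (a , b) , (λ { refl → contradiction (trans (sym c) (adj-irrefl z)) λ
              () }) , trans (adj-sym z w) c))
          (trans (𝟙-× (class? α β x y z) _) (cong (C α β x y z *_) (𝟙-× (class? γ δ x y w) (adj w z Boolₚ.≟ true)))))
          (∑-*ˡ 𝓝 (C α β x y z) _)

        shared : Bool → Bool → Bool → Bool → Fin n → Fin n → ℕ
        shared α β γ δ x y = ∑ 𝓝 (λ z → C α β x y z * C γ δ x y z)

        shared-invariant : ∀ α β γ δ → Invariant (shared α β γ δ)
        shared-invariant α β γ δ = scaled α β (𝟙 ((α Boolₚ.≟ γ) ×-dec (β Boolₚ.≟ δ)))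
          (class-constant α β (λ x y z → C γ δ x y z) _ (λ ((z≢x , z≢y) , e , f) → C-off z≢x z≢y e f))

        product : ∀ α β γ δ x y → size α β x y * size γ δ x y ≡
                  patterns α β γ δ false x y + (patterns α β γ δ true x y + shared α β γ δ x y)
        product α β γ δ x y = begin
          size α β x y * size γ δ x y  ≡⟨ ∑-*ʳ 𝓝 (size γ δ x y) _ ⟨
          ∑ 𝓝 (λ z → C α β x y z * size γ δ x y)
            ≡⟨ ∑-cong 𝓝 (λ z → trans (sym (∑-*ˡ 𝓝 (C α β x y z) _)) (trans (∑-cong 𝓝 (λ w → split z w))
                                                                                  (trans (∑-+ 𝓝 _ _) (cong (∑ 𝓝
                                                                                    (λ w → 𝟙 (pattern? α β γ δ false x
                                                                                    y z w)) +_) (trans (∑-+ 𝓝 _ _)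
                                                                                    (cong (∑ 𝓝 (λ w → 𝟙 (pattern? α β γ
                                                                                      δ true x y z w)) +_) (∑-pick 𝓝
                                                                                      (cong (λ w → C α β x y z * C γ δ
                                                                                      x y w)) z))))))) ⟩
          ∑ 𝓝 (λ z → ∑ 𝓝 (λ w → 𝟙 (pattern? α β γ δ false x y z w)) +
            (∑ 𝓝 (λ w → 𝟙 (pattern? α β γ δ true x y z w)) + C α β x y z * C γ δ x y z))
                                                                              ≡⟨ trans (∑-+ 𝓝 _ _) (cong
                                                                                (patterns α β γ δ false x y +_)
                                                                                (∑-+ 𝓝 _ _)) ⟩
          patterns α β γ δ false x y + (patterns α β γ δ true x y + shared α β γ δ x y) ∎
          where
          open ≡-Reasoning
          split : ∀ z w → C α β x y z * C γ δ x y w ≡ 𝟙 (pattern? α β γ δ false x y z w) +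
            (𝟙 (pattern? α β γ δ true x y z w) + 𝟙 (decEq 𝓝 z w) * (C α β x y z * C γ δ x y w))
          split z w with class? α β x y z | class? γ δ x y w
          ... | no _ | _ = sym (ℕₚ.*-zeroʳ (𝟙 (decEq 𝓝 z w)))
          ... | yes _ | no _ = sym (ℕₚ.*-zeroʳ (𝟙 (decEq 𝓝 z w)))
          ... | yes _ | yes _ with z Finₚ.≟ w | adj z w
          ...   | yes z≡w | _     = sym (trans (ℕₚ.*-identityʳ _) (𝟙-yes (decEq 𝓝 z w) z≡w))
          ...   | no z≢w  | true  = sym (cong suc (trans (ℕₚ.*-identityʳ _) (𝟙-no (decEq 𝓝 z w) z≢w)))
          ...   | no z≢w  | false = sym (cong suc (trans (ℕₚ.*-identityʳ _) (𝟙-no (decEq 𝓝 z w) z≢w)))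

      patterns-invariant : ∀ α β γ δ η → Invariant (patterns α β γ δ η)
      patterns-invariant α β γ δ = λ { true → edge ; false → non-edge }
        where
        edge : Invariant (patterns α β γ δ true)
        edge = Invariant-cong (λ {x} {y} _ → patterns-true α β γ δ x y) (E-invariant γ δ α β)
        non-edge : Invariant (patterns α β γ δ false)
        non-edge = Invariant-cancelʳ (λ {x} {y} _ → product α β γ δ x y)
          (Invariant-op _+_ edge (shared-invariant α β γ δ))
            (Invariant-op _*_ (size-invariant α β) (size-invariant γ δ))

open HestenesHigman

module Copies where
  open ≡ using (refl; sym; trans; cong; cong₂; subst; setoid; module ≡-Reasoning)
  open import Data.Nat.Base using (_+_; _*_)
  open import Algebra.Properties.Semiring.Sum ℕₚ.+-*-semiring using (sum)
  open import Data.Product.Base using (swap)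
  open import Function.Base using (case_of_)
  open import Function.Properties.Inverse using (↔-sym)

  record Enumeration {a ℓ p} (S : Setoid a ℓ) (P : Setoid.Carrier S → Set p) (k : ℕ) : Set (a ⊔ ℓ ⊔ p) where
    open Setoid S using (Carrier; _≈_)
    field
      elem           : Fin k → Carrier
      elem-P         : ∀ i → P (elem i)
      elem-injective : ∀ {i j} → elem i ≈ elem j → i ≡ j
      index          : ∀ {x} → P x → Fin k
      elem-index     : ∀ {x} (p : P x) → elem (index p) ≈ x

  enumerateFin : ∀ {m p} {P : Fin m → Set p} (P? : ∀ i → Dec (P i)) → Enumeration (setoid (Fin m)) P (sum (𝟙 ∘ P?))
  enumerateFin {zero}  P? = record
    { elem = λ () ; elem-P = λ () ; elem-injective = λ { {()} } ; index = λ { {()} } ; elem-index = λ { {()} } }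
  enumerateFin {suc m} P? with P? zero | enumerateFin (P? ∘ suc)
  ... | yes P₀ | rest = record
    { elem           = λ { zero → zero ; (suc i) → suc (elem i) }
    ; elem-P         = λ { zero → P₀ ; (suc i) → elem-P i }
    ; elem-injective = λ { {zero} {zero} _ → refl ; {suc i} {suc j} e → cong suc
      (elem-injective (Finₚ.suc-injective e)) }
    ; index          = λ { {zero} _ → zero ; {suc i} p → suc (index p) }
    ; elem-index     = λ { {zero} _ → refl ; {suc i} p → cong suc (elem-index p) }
    }
    where open Enumeration rest
  ... | no ¬P₀ | rest = record
    { elem           = suc ∘ elem
    ; elem-P         = elem-P
    ; elem-injective = elem-injective ∘ Finₚ.suc-injective
    ; index          = λ { {zero} p → contradiction p ¬P₀ ; {suc i} p → index p }
    ; elem-index     = λ { {zero} p → contradiction p ¬P₀ ; {suc i} p → cong suc (elem-index p) }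
    }
    where open Enumeration rest

  opaque
    unfolding ∑

    enumerate : ∀ {a ℓ n p} {S : Setoid a ℓ} (𝓢 : HasCardinality S n) {P : Setoid.Carrier S → Set p}
      (P? : ∀ x → Dec (P x)) →
                (∀ {x y} → Setoid._≈_ S x y → P x → P y) → Enumeration S P (count 𝓢 P?)
    enumerate {S = S} 𝓢 P? resp = record
      { elem           = from ∘ elem
      ; elem-P         = elem-P
      ; elem-injective = λ {i} {j} e → elem-injective (trans (sym (strictlyInverseˡ (elem i)))
        (trans (to-cong e) (strictlyInverseˡ (elem j))))
      ; index          = λ {x} p → index (resp (S.sym (from∘to 𝓢 x)) p)
      ; elem-index     = λ {x} p → S.trans (from-cong (elem-index (resp (S.sym (from∘to 𝓢 x)) p))) (from∘to 𝓢 x)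
      }
      where
      module S = Setoid S
      open Inverse 𝓢
      open Enumeration (enumerateFin (P? ∘ from))

  private
    Remaining : (x y : Fin 4) → Set
    Remaining x y = ∃[ a ] ∃[ b ] (a ≢ x × a ≢ y × b ≢ x × b ≢ y × a ≢ b × (∀ i → i ≡ x ⊎ i ≡ y ⊎ i ≡ a ⊎ i ≡ b))

    remaining? : ∀ x y → Dec (Remaining x y)
    remaining? x y = Finₚ.any? λ a → Finₚ.any? λ b →
      ¬? (a Finₚ.≟ x) ×-dec (¬? (a Finₚ.≟ y) ×-dec (¬? (b Finₚ.≟ x) ×-dec (¬? (b Finₚ.≟ y) ×-dec (¬? (a Finₚ.≟ b) ×-dec
      (Finₚ.all? λ i → (i Finₚ.≟ x) ⊎-dec ((i Finₚ.≟ y) ⊎-dec ((i Finₚ.≟ a) ⊎-dec (i Finₚ.≟ b))))))))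

  opaque
    remaining-vertices : ∀ x y → x ≢ y → Remaining x y
    remaining-vertices = toWitness {a? = Finₚ.all? λ x → Finₚ.all? λ y → ¬? (x Finₚ.≟ y) →-dec remaining? x y} _

  module CountCopies {n} (adj : Fin n → Fin n → Bool)
    (adj-sym : ∀ x y → adj x y ≡ adj y x) (adj-irrefl : ∀ x → adj x x ≡ false) where
    open PairInvariants adj adj-sym adj-irrefl

    module _ {k} (deg≡k : ∀ x → deg x ≡ k) (codeg-inv : Invariant codeg) (edges-inv : Invariant commonEdges)
             (T : Graph (setoid (Fin 4)) 0ℓ) (T? : Decidable (Graph.Adj T)) (x₀ y₀ : Fin 4) (x₀≢y₀ : x₀ ≢ y₀) where
      open Counts deg≡k codeg-inv edges-inv

      private
        module T = Graph T

        t : Fin 4 → Fin 4 → Bool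
        t i j = does (T? i j)

        others = remaining-vertices x₀ y₀ x₀≢y₀
        a b : Fin 4
        a = proj₁ others
        b = proj₁ (proj₂ others)
        distinct = proj₂ (proj₂ others)
        a≢x₀ = proj₁ distinct
        a≢y₀ = proj₁ (proj₂ distinct)
        b≢x₀ = proj₁ (proj₂ (proj₂ distinct))
        b≢y₀ = proj₁ (proj₂ (proj₂ (proj₂ distinct)))
        a≢b = proj₁ (proj₂ (proj₂ (proj₂ (proj₂ distinct))))

        cover : ∀ i → i ≡ x₀ ⊎ i ≡ y₀ ⊎ i ≡ a ⊎ i ≡ b
        cover = proj₂ (proj₂ (proj₂ (proj₂ (proj₂ distinct))))

        pairs-cover : ∀ {r} (R : Fin 4 → Fin 4 → Set r) → (∀ i → R i i) → (∀ {i j} → R i j → R j i) →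
                      R x₀ y₀ → R x₀ a → R x₀ b → R y₀ a → R y₀ b → R a b → ∀ i j → R i j
        pairs-cover R r s xy xa xb ya yb ab i j with cover i | cover j
        ... | inj₁ refl               | inj₁ refl               = r _
        ... | inj₁ refl               | inj₂ (inj₁ refl)        = xy
        ... | inj₁ refl               | inj₂ (inj₂ (inj₁ refl)) = xa
        ... | inj₁ refl               | inj₂ (inj₂ (inj₂ refl)) = xb
        ... | inj₂ (inj₁ refl)        | inj₁ refl               = s xy
        ... | inj₂ (inj₁ refl)        | inj₂ (inj₁ refl)        = r _
        ... | inj₂ (inj₁ refl)        | inj₂ (inj₂ (inj₁ refl)) = ya
        ... | inj₂ (inj₁ refl)        | inj₂ (inj₂ (inj₂ refl)) = yb
        ... | inj₂ (inj₂ (inj₁ refl)) | inj₁ refl               = s xa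
        ... | inj₂ (inj₂ (inj₁ refl)) | inj₂ (inj₁ refl)        = s ya
        ... | inj₂ (inj₂ (inj₁ refl)) | inj₂ (inj₂ (inj₁ refl)) = r _
        ... | inj₂ (inj₂ (inj₁ refl)) | inj₂ (inj₂ (inj₂ refl)) = ab
        ... | inj₂ (inj₂ (inj₂ refl)) | inj₁ refl               = s xb
        ... | inj₂ (inj₂ (inj₂ refl)) | inj₂ (inj₁ refl)        = s yb
        ... | inj₂ (inj₂ (inj₂ refl)) | inj₂ (inj₂ (inj₁ refl)) = s ab
        ... | inj₂ (inj₂ (inj₂ refl)) | inj₂ (inj₂ (inj₂ refl)) = r _

        t-sym : ∀ i j → t i j ≡ t j i
        t-sym i j with T? i j | T? j i
        ... | yes _ | yes _ = refl
        ... | yes p | no ¬p = contradiction (T.Adj-sym p) ¬p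
        ... | no ¬p | yes p = contradiction (T.Adj-sym p) ¬p
        ... | no _  | no _  = refl

        t-irrefl : ∀ i → t i i ≡ false
        t-irrefl i = dec-false (T? i i) (T.Adj-irrefl refl)

        Pat : (x y z w : Fin n) → Set
        Pat = Pattern (t x₀ a) (t y₀ a) (t x₀ b) (t y₀ b) (t a b)

        pat? : ∀ x y z w → Dec (Pat x y z w)
        pat? = pattern? (t x₀ a) (t y₀ a) (t x₀ b) (t y₀ b) (t a b)

        -- Exactly one of the two orderings of {z , w} that realise T is canonical.
        Canonical : (x y : Fin n) → Fin n × Fin n → Set
        Canonical x y (z , w) = Pat x y z w × (¬ Pat x y w z ⊎ z Fin.< w)

        canonical? : ∀ x y p → Dec (Canonical x y p)
        canonical? x y (z , w) = pat? x y z w ×-dec (¬? (pat? x y w z) ⊎-dec (z Finₚ.<? w))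

        𝓟 : HasCardinality (setoid (Fin n × Fin n)) (n * n)
        𝓟 = ↔-sym Finₚ.*↔×

        ∑-pairs : ∀ f → ∑ 𝓟 f ≡ ∑ 𝓝 (λ z → ∑ 𝓝 (λ w → f (z , w)))
        ∑-pairs f = begin
          ∑ 𝓟 f
            ≡⟨ ∑-fibre 𝓟 𝓝 proj₁ f ⟩
          ∑ 𝓝 (λ z → ∑ 𝓟 (λ p → 𝟙 (decEq 𝓝 (proj₁ p) z) * f p))
            ≡⟨ ∑-cong 𝓝 (λ z → ∑-fibre 𝓟 𝓝 proj₂ _) ⟩
          ∑ 𝓝 (λ z → ∑ 𝓝 (λ w → ∑ 𝓟 (λ p → 𝟙 (decEq 𝓝 (proj₂ p) w) * (𝟙 (decEq 𝓝 (proj₁ p) z) * f p))))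
            ≡⟨ ∑-cong 𝓝 (λ z → ∑-cong 𝓝 (λ w →
                                                                                                              trans (∑-cong 𝓟 (λ p → merge z w p)) (∑-pick 𝓟 (cong f) (z , w)))) ⟩
          ∑ 𝓝 (λ z → ∑ 𝓝 (λ w → f (z , w))) ∎
          where
          open ≡-Reasoning
          merge : ∀ z w p → 𝟙 (decEq 𝓝 (proj₂ p) w) * (𝟙 (decEq 𝓝 (proj₁ p) z) * f p) ≡ 𝟙 (decEq 𝓟 (z , w) p) * f p
          merge z w p = trans (sym (ℕₚ.*-assoc (𝟙 (decEq 𝓝 (proj₂ p) w)) _ (f p)))
            (cong (_* f p) (trans (sym (𝟙-× (decEq 𝓝 (proj₂ p) w) (decEq 𝓝 (proj₁ p) z)))
            (𝟙-cong (decEq 𝓝 (proj₂ p) w ×-dec decEq 𝓝 (proj₁ p) z) (decEq 𝓟 (z , w) p)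
              (λ (e , e′) → sym (cong₂ _,_ e′ e)) (λ { refl → refl , refl }))))

        K : Fin n → Fin n → ℕ
        K x y = count 𝓟 (canonical? x y)

        all : Fin n → Fin n → ℕ
        all = patterns (t x₀ a) (t y₀ a) (t x₀ b) (t y₀ b) (t a b)

        all≡count : ∀ x y → count 𝓟 (λ p → pat? x y (proj₁ p) (proj₂ p)) ≡ all x y
        all≡count x y = ∑-pairs _

        K-invariant : Invariant K
        K-invariant = symmetric? ((t x₀ a Boolₚ.≟ t x₀ b) ×-dec (t y₀ a Boolₚ.≟ t y₀ b))
          where
          symmetric? : Dec (t x₀ a ≡ t x₀ b × t y₀ a ≡ t y₀ b) → Invariant K
          symmetric? (no asymmetric) = Invariant-cong
            (λ {x} {y} _ → trans (count-cong 𝓟 (canonical? x y) (λ p → pat? x y (proj₁ p) (proj₂ p)) (λ _ → proj₁)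
              (λ p pat → pat , inj₁ (λ pat′ → asymmetric (compare pat pat′)))) (all≡count x y))
            (patterns-invariant (t x₀ a) (t y₀ a) (t x₀ b) (t y₀ b) (t a b))
            where
            compare : ∀ {x y z w} → Pat x y z w → Pat x y w z → t x₀ a ≡ t x₀ b × t y₀ a ≡ t y₀ b
            compare (((_ , e , f) , _) , _) ((_ , (_ , e′ , f′)) , _) = trans (sym e) e′ , trans (sym f) f′
          symmetric? (yes (eqx , eqy)) {x} {y} {x′} {y′} p p′ e = halve (trans (sym (doubled x y))
                  (trans (patterns-invariant (t x₀ a) (t y₀ a) (t x₀ b) (t y₀ b) (t a b) p p′ e) (doubled x′ y′)))
            where
            halve : ∀ {m k} → m + m ≡ k + k → m ≡ k
            halve {m} {k} e = ℕₚ.*-cancelˡ-≡ m k 2 (trans (cong (m +_) (ℕₚ.+-identityʳ m))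
              (trans e (cong (k +_) (sym (ℕₚ.+-identityʳ k)))))
            flip : ∀ {x y z w} → Pat x y z w → Pat x y w z
            flip {x} {y} {z} {w} (((a , e , f) , (a′ , e′ , f′)) , z≢w , g) =
              ((a′ , trans e′ (sym eqx) , trans f′ (sym eqy)) , (a , trans e eqx , trans f eqy)) , z≢w ∘ sym , trans
                (adj-sym w z) g
            doubled : ∀ x y → all x y ≡ K x y + K x y
            doubled x y = begin
              all x y  ≡⟨ all≡count x y ⟨
              ∑ 𝓟 (λ p → 𝟙 (pat? x y (proj₁ p) (proj₂ p)))  ≡⟨ ∑-cong 𝓟 (λ p → split p (pat? x y (proj₁ p) (proj₂ p))) ⟩
              ∑ 𝓟 (λ p → 𝟙 (canonical? x y p) + 𝟙 (canonical? x y (swap p))) ≡⟨ ∑-+ 𝓟 _ _ ⟩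
              K x y + ∑ 𝓟 (λ p → 𝟙 (canonical? x y (swap p)))
                ≡⟨ cong (K x y +_) (∑-bij 𝓟 𝓟 swap swap (cong swap) (cong swap) (λ _ → refl) (λ _ → refl)
                                                                                    {λ p → 𝟙 (canonical? x y p)}
                                                                                      (cong (λ p → 𝟙 (canonical? x y
                                                                                      p)))) ⟩
              K x y + K x y ∎
              where
              open ≡-Reasoning
              split : ∀ p (d : Dec (Pat x y (proj₁ p) (proj₂ p))) → 𝟙 d ≡ 𝟙 (canonical? x y p) + 𝟙
                (canonical? x y (swap p))
              split p@(z , w) (no ¬pat) = sym (cong₂ _+_ (𝟙-no (canonical? x y p) (¬pat ∘ proj₁))
                (𝟙-no (canonical? x y (w , z)) (¬pat ∘ flip ∘ proj₁)))
              split p@(z , w) (yes pat) with Finₚ.<-cmp z w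
              ... | tri< z<w _ z≯w = sym (cong₂ _+_ (𝟙-yes (canonical? x y p) (pat , inj₂ z<w))
                      (𝟙-no (canonical? x y (w , z)) (λ { (_ , inj₁ ¬pat) → ¬pat pat ; (_ , inj₂ z>w) → z≯w z>w })))
              ... | tri≈ _ z≡w _   = contradiction z≡w (proj₁ (proj₂ pat))
              ... | tri> z≮w _ z>w = sym (cong₂ _+_ (𝟙-no (canonical? x y p)
                (λ { (_ , inj₁ ¬pat) → ¬pat (flip pat) ; (_ , inj₂ z<w) → z≮w z<w }))
                      (𝟙-yes (canonical? x y (w , z)) (flip pat , inj₂ z>w)))

        number-invariant : Invariant (λ x y → 𝟙 (adj x y Boolₚ.≟ t x₀ y₀) * K x y)
        number-invariant p p′ e = cong₂ _*_ (cong (λ b → 𝟙 (b Boolₚ.≟ t x₀ y₀)) e) (K-invariant p p′ e)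

      number : Bool → ℕ
      number = proj₁ (values number-invariant)

      module _ {s ℓ r : Level} {S : Setoid s ℓ} (Γ : Graph S r) (𝓘 : HasCardinality S n)
               (adj-iso : ∀ u v → Graph.Adj Γ u v ⇔ (adj (Inverse.to 𝓘 u) (Inverse.to 𝓘 v) ≡ true))
               (x y : Setoid.Carrier S) (x≉y : ¬ Setoid._≈_ S x y) where
        private
          module S = Setoid S
          module Γ = Graph Γ
          open Inverse 𝓘 using (to; from; to-cong; from-cong; strictlyInverseˡ)
          X Y : Fin n
          X = to x
          Y = to y

          X≢Y : X ≢ Y
          X≢Y = x≉y ∘ to-injective 𝓘

          reflects : ∀ {p} {P : Set p} (d : Dec P) {b} → does d ≡ b → P ⇔ (b ≡ true)
          reflects (yes p) refl = mk⇔ (λ _ → refl) (λ _ → p)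
          reflects (no ¬p) refl = mk⇔ (λ p → contradiction p ¬p) (λ ())

          reflected : ∀ {p} {P : Set p} (d : Dec P) {b} → P ⇔ (b ≡ true) → does d ≡ b
          reflected (yes p) eq = sym (Equivalence.to eq p)
          reflected (no ¬p) {true}  eq = contradiction (Equivalence.from eq refl) ¬p
          reflected (no ¬p) {false} eq = refl

          module OfCopy (c : Copy T x₀ y₀ Γ x y) where
            open Copy c
            e : Fin 4 → Fin n
            e = to ∘ embed

            e-injective : ∀ {i j} → e i ≡ e j → i ≡ j
            e-injective = injective ∘ to-injective 𝓘

            e-x₀ : e x₀ ≡ X
            e-x₀ = to-cong x₀↦x

            e-y₀ : e y₀ ≡ Y
            e-y₀ = to-cong y₀↦y

            e-adj : ∀ i j → adj (e i) (e j) ≡ t i j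
            e-adj i j = sym (reflected (T? i j) (mk⇔
              (λ p → Equivalence.to (adj-iso (embed i) (embed j)) (Equivalence.to induced p))
              (λ p → Equivalence.from induced (Equivalence.from (adj-iso (embed i) (embed j)) p))))

            class : ∀ i → i ≢ x₀ → i ≢ y₀ → Class (t x₀ i) (t y₀ i) X Y (e i)
            class i i≢x₀ i≢y₀ = ((λ p → i≢x₀ (e-injective (trans p (sym e-x₀)))) ,
              (λ p → i≢y₀ (e-injective (trans p (sym e-y₀))))) ,
              trans (cong (λ u → adj u (e i)) (sym e-x₀)) (e-adj x₀ i) , trans (cong (λ u → adj u (e i)) (sym e-y₀))
                (e-adj y₀ i)

            pat : Pat X Y (e a) (e b)
            pat = (class a a≢x₀ a≢y₀ , class b b≢x₀ b≢y₀) , a≢b ∘ e-injective , e-adj a b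

          canonise : ∀ {z w} → Pat X Y z w → ∃[ p ] Canonical X Y p × (p ≡ (z , w) ⊎ p ≡ (w , z))
          canonise {z} {w} pat with pat? X Y w z | Finₚ.<-cmp z w
          ... | no ¬pat  | _              = (z , w) , (pat , inj₁ ¬pat) , inj₁ refl
          ... | yes _    | tri< z<w _ _   = (z , w) , (pat , inj₂ z<w) , inj₁ refl
          ... | yes _    | tri≈ _ z≡w _   = contradiction z≡w (proj₁ (proj₂ pat))
          ... | yes pat′ | tri> _ _ z>w   = (w , z) , (pat′ , inj₂ z>w) , inj₂ refl

          canonical-unique : ∀ {p p′} → Canonical X Y p → Canonical X Y p′ → p′ ≡ p ⊎ p′ ≡ swap p → p′ ≡ p
          canonical-unique _ _ (inj₁ e) = e
          canonical-unique (pat , inj₁ ¬pat′) (pat′ , _)         (inj₂ refl) = contradiction pat′ ¬pat′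
          canonical-unique (pat , inj₂ _)     (_ , inj₁ ¬pat)    (inj₂ refl) = contradiction pat ¬pat
          canonical-unique (pat , inj₂ z<w)   (pat′ , inj₂ w<z)  (inj₂ refl) = contradiction (ℕₚ.<-trans z<w w<z)
            (ℕₚ.<-irrefl refl)

          norm : (c : Copy T x₀ y₀ Γ x y) → ∃[ p ] Canonical X Y p ×
            (p ≡ (OfCopy.e c a , OfCopy.e c b) ⊎ p ≡ (OfCopy.e c b , OfCopy.e c a))
          norm c = canonise (OfCopy.pat c)

          module FromPair (XY : adj X Y ≡ t x₀ y₀) {z w : Fin n} (pat : Pat X Y z w) where
            e : Fin 4 → Fin n
            e i = if does (i Finₚ.≟ x₀) then X else if does (i Finₚ.≟ y₀) then Y else if does (i Finₚ.≟ a) then z else w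

            e-x₀ : e x₀ ≡ X
            e-x₀ rewrite dec-true (x₀ Finₚ.≟ x₀) refl = refl

            e-y₀ : e y₀ ≡ Y
            e-y₀ rewrite dec-false (y₀ Finₚ.≟ x₀) (x₀≢y₀ ∘ sym) | dec-true (y₀ Finₚ.≟ y₀) refl = refl

            e-a : e a ≡ z
            e-a rewrite dec-false (a Finₚ.≟ x₀) a≢x₀ | dec-false (a Finₚ.≟ y₀) a≢y₀ | dec-true (a Finₚ.≟ a) refl = refl

            e-b : e b ≡ w
            e-b rewrite dec-false (b Finₚ.≟ x₀) b≢x₀ | dec-false (b Finₚ.≟ y₀) b≢y₀ | dec-false (b Finₚ.≟ a)
              (a≢b ∘ sym) = refl

            private
              differ : ∀ {i j u v} → e i ≡ u → e j ≡ v → u ≢ v → e i ≡ e j → i ≡ j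
              differ p p′ u≢v q = contradiction (trans (sym p) (trans q p′)) u≢v

              z-class = proj₁ (proj₁ pat)
              w-class = proj₂ (proj₁ pat)

            e-injective : ∀ i j → e i ≡ e j → i ≡ j
            e-injective = pairs-cover (λ i j → e i ≡ e j → i ≡ j) (λ _ _ → refl) (λ f p → sym (f (sym p)))
              (differ e-x₀ e-y₀ X≢Y)
              (differ e-x₀ e-a (proj₁ (proj₁ z-class) ∘ sym)) (differ e-x₀ e-b (proj₁ (proj₁ w-class) ∘ sym))
              (differ e-y₀ e-a (proj₂ (proj₁ z-class) ∘ sym)) (differ e-y₀ e-b (proj₂ (proj₁ w-class) ∘ sym))
              (differ e-a e-b (proj₁ (proj₂ pat)))

            e-adj : ∀ i j → adj (e i) (e j) ≡ t i j
            e-adj = pairs-cover (λ i j → adj (e i) (e j) ≡ t i j)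
              (λ i → trans (adj-irrefl (e i)) (sym (t-irrefl i)))
                (λ {i} {j} p → trans (adj-sym (e j) (e i)) (trans p (t-sym i j)))
              (trans (cong₂ adj e-x₀ e-y₀) XY)
              (trans (cong₂ adj e-x₀ e-a) (proj₁ (proj₂ z-class))) (trans (cong₂ adj e-x₀ e-b) (proj₁ (proj₂ w-class)))
              (trans (cong₂ adj e-y₀ e-a) (proj₂ (proj₂ z-class))) (trans (cong₂ adj e-y₀ e-b) (proj₂ (proj₂ w-class)))
              (trans (cong₂ adj e-a e-b) (proj₂ (proj₂ pat)))

            copy : Copy T x₀ y₀ Γ x y
            copy = record
              { embed     = from ∘ e
              ; injective = λ {i} {j} p → e-injective i j
                (trans (sym (strictlyInverseˡ (e i))) (trans (to-cong p) (strictlyInverseˡ (e j))))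
              ; induced   = λ {i} {j} → mk⇔
                  (λ p → Equivalence.from (adj-iso _ _) (trans (back i j) (Equivalence.to (reflects (T? i j) refl) p)))
                  (λ p → Equivalence.from (reflects (T? i j) refl)
                    (trans (sym (back i j)) (Equivalence.to (adj-iso _ _) p)))
              ; x₀↦x      = S.trans (from-cong e-x₀) (from∘to 𝓘 x)
              ; y₀↦y      = S.trans (from-cong e-y₀) (from∘to 𝓘 y)
              }
              where
              back : ∀ i j → adj (to (from (e i))) (to (from (e j))) ≡ t i j
              back i j = trans (cong₂ adj (strictlyInverseˡ (e i)) (strictlyInverseˡ (e j))) (e-adj i j)

          image-⊆ : (c d : Copy T x₀ y₀ Γ x y) → (∀ i → ∃[ j ] OfCopy.e d j ≡ OfCopy.e c i) →
                    ∀ {v} → image T x₀ y₀ Γ x y c v → image T x₀ y₀ Γ x y d v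
          image-⊆ c d f (i , ci≈v) = let j , p = f i in j , S.trans (to-injective 𝓘 p) ci≈v

          private
            further : (c d : Copy T x₀ y₀ Γ x y) → (∀ {v} → image T x₀ y₀ Γ x y c v → image T x₀ y₀ Γ x y d v) →
                      ∀ i → i ≢ x₀ → i ≢ y₀ → OfCopy.e c i ≡ OfCopy.e d a ⊎ OfCopy.e c i ≡ OfCopy.e d b
            further c d c⊆d i i≢x₀ i≢y₀ with c⊆d (i , S.refl)
            ... | j , dj≈ci with cover j
            ...   | inj₁ refl               = contradiction
              (OfCopy.e-injective c (trans (sym (to-cong dj≈ci)) (trans (OfCopy.e-x₀ d) (sym (OfCopy.e-x₀ c))))) i≢x₀
            ...   | inj₂ (inj₁ refl)        = contradiction
              (OfCopy.e-injective c (trans (sym (to-cong dj≈ci)) (trans (OfCopy.e-y₀ d) (sym (OfCopy.e-y₀ c))))) i≢y₀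
            ...   | inj₂ (inj₂ (inj₁ refl)) = inj₁ (sym (to-cong dj≈ci))
            ...   | inj₂ (inj₂ (inj₂ refl)) = inj₂ (sym (to-cong dj≈ci))

            match : ∀ {u v z w : Fin n} → u ≢ v → u ≡ z ⊎ u ≡ w → v ≡ z ⊎ v ≡ w → (u , v) ≡ (z , w) ⊎ (u , v) ≡ (w , z)
            match u≢v (inj₁ refl) (inj₁ refl) = contradiction refl u≢v
            match u≢v (inj₁ refl) (inj₂ refl) = inj₁ refl
            match u≢v (inj₂ refl) (inj₁ refl) = inj₂ refl
            match u≢v (inj₂ refl) (inj₂ refl) = contradiction refl u≢v

          norm-cong : (c d : Copy T x₀ y₀ Γ x y) → (∀ {v} → image T x₀ y₀ Γ x y c v → image T x₀ y₀ Γ x y d v) →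
                      proj₁ (norm c) ≡ proj₁ (norm d)
          norm-cong c d c⊆d = canonical-unique (proj₁ (proj₂ (norm d))) (proj₁ (proj₂ (norm c)))
            (chain (proj₂ (proj₂ (norm c))) (match (a≢b ∘ OfCopy.e-injective c) (further c d c⊆d a a≢x₀ a≢y₀)
              (further c d c⊆d b b≢x₀ b≢y₀)) (proj₂ (proj₂ (norm d))))
            where
            chain : ∀ {p p′ : Fin n × Fin n} {u v z w} → p ≡ (u , v) ⊎ p ≡ (v , u) → (u , v) ≡ (z , w) ⊎ (u , v) ≡
              (w , z) →
                    p′ ≡ (z , w) ⊎ p′ ≡ (w , z) → p ≡ p′ ⊎ p ≡ swap p′
            chain (inj₁ refl) (inj₁ refl) (inj₁ refl) = inj₁ refl
            chain (inj₁ refl) (inj₁ refl) (inj₂ refl) = inj₂ refl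
            chain (inj₁ refl) (inj₂ refl) (inj₁ refl) = inj₂ refl
            chain (inj₁ refl) (inj₂ refl) (inj₂ refl) = inj₁ refl
            chain (inj₂ refl) (inj₁ refl) (inj₁ refl) = inj₂ refl
            chain (inj₂ refl) (inj₁ refl) (inj₂ refl) = inj₁ refl
            chain (inj₂ refl) (inj₂ refl) (inj₁ refl) = inj₁ refl
            chain (inj₂ refl) (inj₂ refl) (inj₂ refl) = inj₂ refl

          card-K : adj X Y ≡ t x₀ y₀ → HasCardinality (copies T x₀ y₀ Γ x y) (K X Y)
          card-K XY = record
            { to        = λ c → index (canon c)
            ; from      = λ i → copyAt i
            ; to-cong   = λ {c} {d} (c⊆d , _) → elem-injective
              (trans (elem-index (canon c)) (trans (norm-cong c d c⊆d) (sym (elem-index (canon d)))))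
            ; from-cong = λ { refl → (λ p → p) , (λ p → p) }
            ; inverse   = (λ {i} {c} c≈ → elem-injective
              (trans (elem-index (canon c)) (trans (norm-cong c (copyAt i) (proj₁ c≈)) (norm-copyAt i))))
                        , (λ {c} {i} i≡ → same c i i≡)
            }
            where
            enumeration : Enumeration (setoid (Fin n × Fin n)) (Canonical X Y) (K X Y)
            enumeration = enumerate 𝓟 (canonical? X Y) (λ { refl p → p })
            open Enumeration enumeration
            canon : ∀ c → Canonical X Y (proj₁ (norm c))
            canon c = proj₁ (proj₂ (norm c))
            module At i = FromPair XY (proj₁ (elem-P i))
            copyAt : Fin (K X Y) → Copy T x₀ y₀ Γ x y
            copyAt i = At.copy i
            at-e : ∀ i j → OfCopy.e (copyAt i) j ≡ At.e i j
            at-e i j = strictlyInverseˡ (At.e i j)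
            norm-copyAt : ∀ i → proj₁ (norm (copyAt i)) ≡ elem i
            norm-copyAt i = canonical-unique (elem-P i) (canon (copyAt i)) (relate (proj₂ (proj₂ (norm (copyAt i)))))
              where
              ea = trans (at-e i a) (At.e-a i)
              eb = trans (at-e i b) (At.e-b i)
              relate : ∀ {p} → p ≡ (OfCopy.e (copyAt i) a , OfCopy.e (copyAt i) b) ⊎ p ≡
                (OfCopy.e (copyAt i) b , OfCopy.e (copyAt i) a) →
                       p ≡ elem i ⊎ p ≡ swap (elem i)
              relate (inj₁ e) = inj₁ (trans e (cong₂ _,_ ea eb))
              relate (inj₂ e) = inj₂ (trans e (cong₂ _,_ eb ea))
            same : ∀ c i → i ≡ index (canon c) → Setoid._≈_ (copies T x₀ y₀ Γ x y) (copyAt i) c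
            same c i refl = image-⊆ (copyAt i) c (λ j → forward j (cover j)) , image-⊆ c (copyAt i)
              (λ j → backward j (cover j))
              where
              module C = OfCopy c
              p≡ : elem i ≡ proj₁ (norm c)
              p≡ = elem-index (canon c)
              ends : (elem i ≡ (C.e a , C.e b)) ⊎ (elem i ≡ (C.e b , C.e a))
              ends = case proj₂ (proj₂ (norm c)) of λ { (inj₁ e) → inj₁ (trans p≡ e) ; (inj₂ e) → inj₂ (trans p≡ e) }
              d-x₀ : OfCopy.e (copyAt i) x₀ ≡ C.e x₀
              d-x₀ = trans (OfCopy.e-x₀ (copyAt i)) (sym C.e-x₀)
              d-y₀ : OfCopy.e (copyAt i) y₀ ≡ C.e y₀
              d-y₀ = trans (OfCopy.e-y₀ (copyAt i)) (sym C.e-y₀)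
              d-a : OfCopy.e (copyAt i) a ≡ proj₁ (elem i)
              d-a = trans (at-e i a) (At.e-a i)
              d-b : OfCopy.e (copyAt i) b ≡ proj₂ (elem i)
              d-b = trans (at-e i b) (At.e-b i)
              forward : ∀ j → j ≡ x₀ ⊎ j ≡ y₀ ⊎ j ≡ a ⊎ j ≡ b → ∃[ l ] C.e l ≡ OfCopy.e (copyAt i) j
              forward j (inj₁ refl)        = x₀ , sym d-x₀
              forward j (inj₂ (inj₁ refl)) = y₀ , sym d-y₀
              forward j (inj₂ (inj₂ (inj₁ refl))) = case ends of λ
                { (inj₁ e) → a , sym (trans d-a (cong proj₁ e)) ; (inj₂ e) → b , sym (trans d-a (cong proj₁ e)) }
              forward j (inj₂ (inj₂ (inj₂ refl))) = case ends of λ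
                { (inj₁ e) → b , sym (trans d-b (cong proj₂ e)) ; (inj₂ e) → a , sym (trans d-b (cong proj₂ e)) }
              backward : ∀ j → j ≡ x₀ ⊎ j ≡ y₀ ⊎ j ≡ a ⊎ j ≡ b → ∃[ l ] OfCopy.e (copyAt i) l ≡ C.e j
              backward j (inj₁ refl)        = x₀ , d-x₀
              backward j (inj₂ (inj₁ refl)) = y₀ , d-y₀
              backward j (inj₂ (inj₂ (inj₁ refl))) = case ends of λ
                { (inj₁ e) → a , trans d-a (cong proj₁ e) ; (inj₂ e) → b , trans d-b (cong proj₂ e) }
              backward j (inj₂ (inj₂ (inj₂ refl))) = case ends of λ
                { (inj₁ e) → b , trans d-b (cong proj₂ e) ; (inj₂ e) → a , trans d-a (cong proj₁ e) }

          card-0 : adj X Y ≢ t x₀ y₀ → HasCardinality (copies T x₀ y₀ Γ x y) 0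
          card-0 XY≢ = record
            { to        = λ c → contradiction (XY c) XY≢
            ; from      = λ ()
            ; to-cong   = λ {c} _ → contradiction (XY c) XY≢
            ; from-cong = λ { {()} }
            ; inverse   = (λ { {()} }) , (λ {c} _ → contradiction (XY c) XY≢)
            }
            where
            XY : ∀ c → adj X Y ≡ t x₀ y₀
            XY c = trans (sym (cong₂ adj (OfCopy.e-x₀ c) (OfCopy.e-y₀ c))) (OfCopy.e-adj c x₀ y₀)

        copies-card : HasCardinality (copies T x₀ y₀ Γ x y) (number (adj X Y))
        copies-card = subst (HasCardinality (copies T x₀ y₀ Γ x y)) (proj₂ (values number-invariant) X≢Y)
          (cases (adj X Y Boolₚ.≟ t x₀ y₀))
          where
          cases : (d : Dec (adj X Y ≡ t x₀ y₀)) → HasCardinality (copies T x₀ y₀ Γ x y) (𝟙 d * K X Y)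
          cases (yes XY) = subst (HasCardinality (copies T x₀ y₀ Γ x y)) (sym (ℕₚ.+-identityʳ (K X Y))) (card-K XY)
          cases (no XY≢) = card-0 XY≢

open Copies

open import Data.Integer.Base using (ℤ; +_; -[1+_]; _⊖_)

module RingSolver {c ℓ} (R : CommutativeRing c ℓ) where
  open CommutativeRing R
  open import Algebra.Properties.Semiring.Mult.TCOptimised semiring using (1+×; ×-homo-+; ×1-homo-*) renaming
    (_×_ to _·_)
  open import Algebra.Properties.Ring ring using (-‿distribˡ-*; -‿distribʳ-*; -0#≈0#; -‿involutive)
  open import Algebra.Properties.AbelianGroup +-abelianGroup using (⁻¹-∙-comm)
  open import Algebra.Properties.CommutativeSemigroup +-commutativeSemigroup using (interchange)
  open import Relation.Binary.Reasoning.Setoid setoid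

  private
    pos neg : ℤ → ℕ
    pos (+ n)    = n
    pos -[1+ n ] = 0
    neg (+ n)    = 0
    neg -[1+ n ] = suc n

    ⟦_⟧ : ℤ → Carrier
    ⟦ + n ⟧      = n · 1#
    ⟦ -[1+ n ] ⟧ = - (suc n · 1#)

    ⟦⟧-diff : ∀ i → ⟦ i ⟧ ≈ pos i · 1# - neg i · 1#
    ⟦⟧-diff (+ n)    = sym (trans (+-congˡ -0#≈0#) (+-identityʳ _))
    ⟦⟧-diff -[1+ n ] = sym (+-identityˡ _)

    diff-suc : ∀ a b → (1# + a) - (1# + b) ≈ a - b
    diff-suc a b = begin
      (1# + a) + - (1# + b)  ≈⟨ +-congˡ (⁻¹-∙-comm 1# b) ⟨
      (1# + a) + (- 1# + - b)  ≈⟨ interchange 1# a (- 1#) (- b) ⟩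
      (1# + - 1#) + (a + - b)  ≈⟨ +-congʳ (-‿inverseʳ 1#) ⟩
      0# + (a - b)  ≈⟨ +-identityˡ _ ⟩
      a - b ∎

    ⟦⊖⟧ : ∀ a b → ⟦ a ⊖ b ⟧ ≈ a · 1# - b · 1#
    ⟦⊖⟧ a       zero    = ⟦⟧-diff (+ a)
    ⟦⊖⟧ zero    (suc b) = ⟦⟧-diff -[1+ b ]
    ⟦⊖⟧ (suc a) (suc b) = begin
      ⟦ suc a ⊖ suc b ⟧  ≡⟨ ≡.cong ⟦_⟧ (ℤₚ.[1+m]⊖[1+n]≡m⊖n a b) ⟩
      ⟦ a ⊖ b ⟧  ≈⟨ ⟦⊖⟧ a b ⟩
      a · 1# - b · 1#  ≈⟨ diff-suc _ _ ⟨
      (1# + a · 1#) - (1# + b · 1#) ≈⟨ +-cong (1+× a 1#) (-‿cong (1+× b 1#)) ⟨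
      suc a · 1# - suc b · 1# ∎

    coefficients : RawRing _ _
    coefficients = record
      { Carrier = ℤ
      ; _≈_ = _≡_
      ; _+_ = λ i j → (pos i ℕ.+ pos j) ⊖ (neg i ℕ.+ neg j)
      ; _*_ = λ i j → (pos i ℕ.* pos j ℕ.+ neg i ℕ.* neg j) ⊖ (pos i ℕ.* neg j ℕ.+ neg i ℕ.* pos j)
      ; -_  = λ i → neg i ⊖ pos i
      ; 0#  = + 0
      ; 1#  = + 1
      }

    +-swap : ∀ a b c d → (a - b) + (c - d) ≈ (a + c) - (b + d)
    +-swap a b c d = trans (interchange a (- b) c (- d)) (+-congˡ (⁻¹-∙-comm b d))

    *-expand : ∀ a b c d → (a - b) * (c - d) ≈ (a * c + b * d) - (a * d + b * c)
    *-expand a b c d = begin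
      (a - b) * (c - d)  ≈⟨ distribʳ _ _ _ ⟩
      a * (c - d) + (- b) * (c - d)  ≈⟨ +-cong (distribˡ _ _ _) (sym (-‿distribˡ-* _ _)) ⟩
      (a * c + a * - d) + - (b * (c - d))
        ≈⟨ +-cong (+-congˡ (sym (-‿distribʳ-* _ _))) (-‿cong
          (trans (distribˡ _ _ _) (+-congˡ (sym (-‿distribʳ-* _ _))))) ⟩
      (a * c - a * d) + - (b * c - b * d)  ≈⟨ +-congˡ (⁻¹-∙-comm _ _) ⟨
      (a * c - a * d) + (- (b * c) + - - (b * d))  ≈⟨ +-congˡ (trans (+-comm _ _) (+-congʳ (-‿involutive _))) ⟩
      (a * c - a * d) + (b * d - b * c)  ≈⟨ +-swap _ _ _ _ ⟩
      (a * c + b * d) - (a * d + b * c) ∎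

    morphism : coefficients ACR.-Raw-AlmostCommutative⟶ ACR.fromCommutativeRing R
    morphism = record
      { ⟦_⟧    = ⟦_⟧
      ; +-homo = λ i j → trans (⟦⊖⟧ (pos i ℕ.+ pos j) (neg i ℕ.+ neg j))
          (trans (+-cong (×-homo-+ 1# (pos i) (pos j)) (-‿cong (×-homo-+ 1# (neg i) (neg j))))
            (trans (sym (+-swap _ _ _ _)) (sym (+-cong (⟦⟧-diff i) (⟦⟧-diff j)))))
      ; *-homo = λ i j → trans (⟦⊖⟧ (pos i ℕ.* pos j ℕ.+ neg i ℕ.* neg j) (pos i ℕ.* neg j ℕ.+ neg i ℕ.* pos j))
          (trans (+-cong (×-homo-* (pos i) (pos j) (neg i) (neg j))
            (-‿cong (×-homo-* (pos i) (neg j) (neg i) (pos j))))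
            (trans (sym (*-expand _ _ _ _)) (sym (*-cong (⟦⟧-diff i) (⟦⟧-diff j)))))
      ; -‿homo = λ i → trans (⟦⊖⟧ (neg i) (pos i)) (trans (+-comm _ _)
        (trans (+-congˡ (sym (-‿involutive _))) (trans (⁻¹-∙-comm _ _) (-‿cong (sym (⟦⟧-diff i))))))
      ; 0-homo = refl
      ; 1-homo = refl
      }
      where
      ×-homo-* : ∀ a b c d → (a ℕ.* b ℕ.+ c ℕ.* d) · 1# ≈ (a · 1#) * (b · 1#) + (c · 1#) * (d · 1#)
      ×-homo-* a b c d = trans (×-homo-+ 1# (a ℕ.* b) (c ℕ.* d)) (+-cong (×1-homo-* a b) (×1-homo-* c d))

    coeff≟ : ∀ i j → Maybe (⟦ i ⟧ ≈ ⟦ j ⟧)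
    coeff≟ i j with i ℤₚ.≟ j
    ... | yes ≡.refl = just refl
    ... | no _       = nothing

  open Algebra.Solver.Ring coefficients (ACR.fromCommutativeRing R) morphism coeff≟ public
    using (solve; _:=_; _:+_; _:*_; _:-_; :-_; con)

module ModuleProperties {c ℓ v ℓv} {F : CommutativeRing c ℓ} (V : Module F v ℓv) where
  open CommutativeRing F
  open Module V
  open import Algebra.Properties.CommutativeSemigroup (CommutativeMonoid.commutativeSemigroup +ᴹ-commutativeMonoid)
    public
    using () renaming (interchange to +ᴹ-interchange)

  u-u≈0 : ∀ u → u +ᴹ - 1# *ₗ u ≈ᴹ 0ᴹ
  u-u≈0 u = ≈ᴹ-trans (+ᴹ-congʳ (≈ᴹ-sym (*ₗ-identityˡ u)))
    (≈ᴹ-trans (≈ᴹ-sym (*ₗ-distribʳ u 1# (- 1#))) (≈ᴹ-trans (*ₗ-congʳ (-‿inverseʳ 1#)) (*ₗ-zeroˡ u)))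

module Field {c ℓ} (F : CommutativeRing c ℓ) (isField : IsField F) {q}
  (𝓕 : HasCardinality (CommutativeRing.setoid F) q) where
  open CommutativeRing F public hiding (zero)
  open RingSolver F public
  open IsField isField public
  open import Algebra.Properties.Ring ring public using (-‿distribˡ-*; -‿distribʳ-*; -0#≈0#; -‿involutive; x∙y⁻¹≈ε⇒x≈y)
  open SetoidReasoning setoid

  infix 4 _≟_
  _≟_ : ∀ x y → Dec (x ≈ y)
  _≟_ = decEq 𝓕

  recip : ∀ x → ¬ x ≈ 0# → Carrier
  recip x x≉0 = proj₁ (inverse x x≉0)

  recip-inverse : ∀ x (x≉0 : ¬ x ≈ 0#) → recip x x≉0 * x ≈ 1#
  recip-inverse x x≉0 = proj₁ (proj₂ (inverse x x≉0))

  *-cancelˡ-≉0 : ∀ {x y z} → ¬ x ≈ 0# → x * y ≈ x * z → y ≈ z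
  *-cancelˡ-≉0 {x} {y} {z} x≉0 eq = begin
    y  ≈⟨ cancel y ⟨
    recip x x≉0 * (x * y)  ≈⟨ *-congˡ eq ⟩
    recip x x≉0 * (x * z)  ≈⟨ cancel z ⟩
    z ∎
    where
    cancel : ∀ w → recip x x≉0 * (x * w) ≈ w
    cancel w = trans (sym (*-assoc _ _ _)) (trans (*-congʳ (recip-inverse x x≉0)) (*-identityˡ w))

  x*y≈0 : ∀ {x y} → ¬ x ≈ 0# → x * y ≈ 0# → y ≈ 0#
  x*y≈0 x≉0 eq = *-cancelˡ-≉0 x≉0 (trans eq (sym (zeroʳ _)))

  x*y≉0 : ∀ {x y} → ¬ x ≈ 0# → ¬ y ≈ 0# → ¬ x * y ≈ 0#
  x*y≉0 x≉0 y≉0 = y≉0 ∘ x*y≈0 x≉0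

  recip≉0 : ∀ x (x≉0 : ¬ x ≈ 0#) → ¬ recip x x≉0 ≈ 0#
  recip≉0 x x≉0 r≈0 = 1≉0 (trans (sym (recip-inverse x x≉0)) (trans (*-congʳ r≈0) (zeroˡ x)))

  -x≉0 : ∀ {x} → ¬ x ≈ 0# → ¬ - x ≈ 0#
  -x≉0 x≉0 eq = x≉0 (trans (sym (-‿involutive _)) (trans (-‿cong eq) -0#≈0#))

  -- An equation l ≈ r is proved by writing l - r as a combination of quantities known to vanish.
  from-diff : ∀ {x y z} → x - y ≈ z → z ≈ 0# → x ≈ y
  from-diff eq z≈0 = x∙y⁻¹≈ε⇒x≈y _ _ (trans eq z≈0)

  diff-zero : ∀ {x y} → x ≈ y → x - y ≈ 0#
  diff-zero eq = trans (+-congʳ eq) (-‿inverseʳ _)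

  *-zero : ∀ k {z} → z ≈ 0# → k * z ≈ 0#
  *-zero k z≈0 = trans (*-congˡ z≈0) (zeroʳ k)

  +-zero : ∀ {y z} → y ≈ 0# → z ≈ 0# → y + z ≈ 0#
  +-zero y≈0 z≈0 = trans (+-cong y≈0 z≈0) (+-identityˡ 0#)

  square-roots : ∀ {x y} → x * x ≈ y * y → x ≈ y ⊎ x ≈ - y
  square-roots {x} {y} eq with x - y ≟ 0#
  ... | yes x-y≈0 = inj₁ (x∙y⁻¹≈ε⇒x≈y x y x-y≈0)
  ... | no x-y≉0  = inj₂ (from-diff (solve 2 (λ x y → x :- (:- y) := x :+ y) refl x y)
        (x*y≈0 x-y≉0 (trans (solve 2 (λ x y → (x :- y) :* (x :+ y) := x :* x :- y :* y) refl x y) (diff-zero eq))))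

module Quadratic {c ℓ v ℓv} {F : CommutativeRing c ℓ} (V : Module F v ℓv)
                 (Q : Module.Carrierᴹ V → CommutativeRing.Carrier F) (isQ : IsQuadraticForm V Q) where
  open CommutativeRing F
  open RingSolver F
  open Module V
  open IsQuadraticForm isQ
  open SetoidReasoning setoid

  P : Carrierᴹ → Carrierᴹ → Carrier
  P = polar V Q

  P-cong : ∀ {u u′ w w′} → u ≈ᴹ u′ → w ≈ᴹ w′ → P u w ≈ P u′ w′
  P-cong e f = +-cong (+-cong (Q-cong (+ᴹ-cong e f)) (-‿cong (Q-cong e))) (-‿cong (Q-cong f))

  P-congˡ : ∀ {u w w′} → w ≈ᴹ w′ → P u w ≈ P u w′
  P-congˡ = P-cong ≈ᴹ-refl

  P-congʳ : ∀ {u u′ w} → u ≈ᴹ u′ → P u w ≈ P u′ w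
  P-congʳ e = P-cong e ≈ᴹ-refl

  P-sym : ∀ u w → P u w ≈ P w u
  P-sym u w = begin
    Q (u +ᴹ w) - Q u - Q w ≈⟨ +-congʳ (+-congʳ (Q-cong (+ᴹ-comm u w))) ⟩
    Q (w +ᴹ u) - Q u - Q w ≈⟨ solve 3 (λ a b c → a :- b :- c := a :- c :- b) refl (Q (w +ᴹ u)) (Q u) (Q w) ⟩
    Q (w +ᴹ u) - Q w - Q u ∎

  P-+ʳ : ∀ u w x → P u (w +ᴹ x) ≈ P u w + P u x
  P-+ʳ u w x = trans (P-sym _ _) (trans (polar-+ᴹ w x u) (+-cong (P-sym _ _) (P-sym _ _)))

  P-*ʳ : ∀ a u w → P u (a *ₗ w) ≈ a * P u w
  P-*ʳ a u w = trans (P-sym _ _) (trans (polar-*ₗ a w u) (*-congˡ (P-sym _ _)))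

  P-0ˡ : ∀ w → P 0ᴹ w ≈ 0#
  P-0ˡ w = trans (P-congʳ (≈ᴹ-sym (*ₗ-zeroˡ 0ᴹ))) (trans (polar-*ₗ 0# 0ᴹ w) (zeroˡ _))

  P-0ʳ : ∀ w → P w 0ᴹ ≈ 0#
  P-0ʳ w = trans (P-sym _ _) (P-0ˡ w)

  Q-0 : Q 0ᴹ ≈ 0#
  Q-0 = trans (Q-cong (≈ᴹ-sym (*ₗ-zeroˡ 0ᴹ))) (trans (Q-*ₗ 0# 0ᴹ) (trans (*-congʳ (zeroˡ 0#)) (zeroˡ _)))

  Q-+ : ∀ u w → Q (u +ᴹ w) ≈ Q u + Q w + P u w
  Q-+ u w = solve 3 (λ a b c → a := b :+ c :+ (a :- b :- c)) refl (Q (u +ᴹ w)) (Q u) (Q w)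

  P-diag : ∀ u → P u u ≈ Q u + Q u
  P-diag u = begin
    Q (u +ᴹ u) - Q u - Q u  ≈⟨ +-congʳ (+-congʳ (Q-cong 2u)) ⟩
    Q ((1# + 1#) *ₗ u) - Q u - Q u  ≈⟨ +-congʳ (+-congʳ (Q-*ₗ _ u)) ⟩
    (1# + 1#) * (1# + 1#) * Q u - Q u - Q u
      ≈⟨ solve 1 (λ x → con (+ 2) :* con (+ 2) :* x :- x :- x := x :+ x) refl (Q u) ⟩
    Q u + Q u ∎
    where
    2u : u +ᴹ u ≈ᴹ (1# + 1#) *ₗ u
    2u = ≈ᴹ-sym (≈ᴹ-trans (*ₗ-distribʳ u 1# 1#) (+ᴹ-cong (*ₗ-identityˡ u) (*ₗ-identityˡ u)))

  infixl 6 _+[_]_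
  _+[_]_ : Carrierᴹ → Carrier → Carrierᴹ → Carrierᴹ
  u +[ a ] d = u +ᴹ a *ₗ d

  shift-cong : ∀ {u u′ a a′ d d′} → u ≈ᴹ u′ → a ≈ a′ → d ≈ᴹ d′ → u +[ a ] d ≈ᴹ u′ +[ a′ ] d′
  shift-cong e f g = +ᴹ-cong e (*ₗ-cong f g)

  shift-shift : ∀ u a b d → (u +[ a ] d) +[ b ] d ≈ᴹ u +[ a + b ] d
  shift-shift u a b d = ≈ᴹ-trans (+ᴹ-assoc u _ _) (+ᴹ-congˡ (≈ᴹ-sym (*ₗ-distribʳ d a b)))

  shift-0 : ∀ u d → u +[ 0# ] d ≈ᴹ u
  shift-0 u d = ≈ᴹ-trans (+ᴹ-congˡ (*ₗ-zeroˡ d)) (+ᴹ-identityʳ u)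

  shift-inverse : ∀ u {a b} d → a + b ≈ 0# → (u +[ a ] d) +[ b ] d ≈ᴹ u
  shift-inverse u {a} {b} d e = ≈ᴹ-trans (shift-shift u a b d) (≈ᴹ-trans (shift-cong ≈ᴹ-refl e ≈ᴹ-refl) (shift-0 u d))

  shift-comm : ∀ u a d b e → (u +[ a ] d) +[ b ] e ≈ᴹ (u +[ b ] e) +[ a ] d
  shift-comm u a d b e = ≈ᴹ-trans (+ᴹ-assoc u _ _) (≈ᴹ-trans (+ᴹ-congˡ (+ᴹ-comm _ _)) (≈ᴹ-sym (+ᴹ-assoc u _ _)))

  P-shiftˡ : ∀ u a d w → P (u +[ a ] d) w ≈ P u w + a * P d w
  P-shiftˡ u a d w = trans (polar-+ᴹ u _ w) (+-congˡ (polar-*ₗ a d w))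

  P-shiftʳ : ∀ w u a d → P w (u +[ a ] d) ≈ P w u + a * P w d
  P-shiftʳ w u a d = trans (P-+ʳ w u _) (+-congˡ (P-*ʳ a w d))

  Q-shift : ∀ u a d → Q (u +[ a ] d) ≈ Q u + a * P u d + a * a * Q d
  Q-shift u a d = trans (Q-+ u _) (trans (+-cong (+-congˡ (Q-*ₗ a d)) (P-*ʳ a u d))
    (solve 4 (λ a x y z → x :+ a :* a :* y :+ a :* z := x :+ a :* z :+ a :* a :* y) refl a (Q u) (Q d) (P u d)))

module FiniteQuadratic
  {c ℓ v ℓv} {F : CommutativeRing c ℓ} (isField : IsField F) {q} (𝓕 : HasCardinality (CommutativeRing.setoid F) q)
  (V : Module F v ℓv) {nV} (𝓥 : HasCardinality (Module.≈ᴹ-setoid V) nV)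
  (Q : Module.Carrierᴹ V → CommutativeRing.Carrier F) (isQ : IsQuadraticForm V Q)
  where
  open Field F isField 𝓕 public
  open Module V public
  open ModuleProperties V public
  open Quadratic V Q isQ public
  open IsQuadraticForm isQ public
  open SetoidReasoning setoid

  infix 4 _≟ᴹ_
  _≟ᴹ_ : ∀ x y → Dec (x ≈ᴹ y)
  _≟ᴹ_ = decEq 𝓥

  Perp : List Carrierᴹ → Carrierᴹ → Set _
  Perp xs v = All (λ x → P x v ≈ 0#) xs

  perp? : ∀ xs v → Dec (Perp xs v)
  perp? xs v = All.all? (λ x → P x v ≟ 0#) xs

  Perp-resp : ∀ xs {v w} → v ≈ᴹ w → Perp xs v → Perp xs w
  Perp-resp xs e = All.map (trans (P-congˡ (≈ᴹ-sym e)))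

  Perp-shift : ∀ xs {u d} a → Perp xs u → Perp xs d → Perp xs (u +[ a ] d)
  Perp-shift []       a []       []       = []
  Perp-shift (x ∷ xs) {u} {d} a (p ∷ ps) (r ∷ rs) =
    trans (P-shiftʳ x u a d) (+-zero p (*-zero a r)) ∷ Perp-shift xs a ps rs

  Perp-0 : ∀ xs → Perp xs 0ᴹ
  Perp-0 []       = []
  Perp-0 (x ∷ xs) = P-0ʳ x ∷ Perp-0 xs

  Perp-* : ∀ xs {u} a → Perp xs u → Perp xs (a *ₗ u)
  Perp-* xs {u} a = All.map (λ {x} p → trans (P-*ʳ a x u) (*-zero a p))

  M : List Carrierᴹ → ℕ
  M xs = count 𝓥 (perp? xs)

  N : List Carrierᴹ → Carrier → ℕ
  N xs f = count 𝓥 (λ v → (Q v ≟ f) ×-dec perp? xs v)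

  N-cong : ∀ xs {f g} → f ≈ g → N xs f ≡ N xs g
  N-cong xs {f} {g} e = count-cong 𝓥 (λ v → (Q v ≟ f) ×-dec perp? xs v) (λ v → (Q v ≟ g) ×-dec perp? xs v)
    (λ _ (a , b) → trans a e , b) (λ _ (a , b) → trans a (sym e) , b)

  ∑-N : ∀ xs → ∑ 𝓕 (N xs) ≡ M xs
  ∑-N xs = ≡.sym (count-fibre 𝓥 𝓕 Q (perp? xs))

  -- The level sets of h on A are translates of one another along d.
  module Equidistribution {p} {A : Carrierᴹ → Set p} (A? : ∀ u → Dec (A u)) (A-resp : ∀ {u w} → u ≈ᴹ w → A u → A w)
    (h : Carrierᴹ → Carrier) (h-cong : ∀ {u w} → u ≈ᴹ w → h u ≈ h w)
    (d : Carrierᴹ) (k : Carrier) (k≉0 : ¬ k ≈ 0#)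
    (A-shift : ∀ {u} a → A u → A (u +[ a ] d)) (h-shift : ∀ {u} a → A u → h (u +[ a ] d) ≈ h u + a * k)
    where
    private
      level? : ∀ i u → Dec (h u ≈ i × A u)
      level? i u = (h u ≟ i) ×-dec A? u

      level-resp : ∀ {i u w} → u ≈ᴹ w → h u ≈ i × A u → h w ≈ i × A w
      level-resp e (a , b) = trans (h-cong (≈ᴹ-sym e)) a , A-resp e b

      move : ∀ {i j a u} → a * k ≈ j - i → h u ≈ i × A u → h (u +[ a ] d) ≈ j × A (u +[ a ] d)
      move {i} {j} {a} ak≈ (hu≈i , Au) =
        trans (h-shift a Au) (trans (+-cong hu≈i ak≈) (solve 2 (λ i j → i :+ (j :- i) := j) refl i j)) , A-shift a Au

      divide : ∀ x → (x * recip k k≉0) * k ≈ x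
      divide x = trans (*-assoc _ _ _) (trans (*-congˡ (recip-inverse k k≉0)) (*-identityʳ x))

    level-≡ : ∀ i j → count 𝓥 (level? i) ≡ count 𝓥 (level? j)
    level-≡ i j = count-bij 𝓥 𝓥 (level? i) (level? j) level-resp level-resp
      (λ u → u +[ a ] d) (λ u → u +[ b ] d)
      (λ e → shift-cong e refl ≈ᴹ-refl) (λ e → shift-cong e refl ≈ᴹ-refl)
      (move (divide _)) (move (divide _))
      (λ {u} _ → shift-inverse u d (a+b j i)) (λ {u} _ → shift-inverse u d (a+b i j))
      where
      a = (j - i) * recip k k≉0
      b = (i - j) * recip k k≉0
      a+b : ∀ i j → (i - j) * recip k k≉0 + (j - i) * recip k k≉0 ≈ 0#
      a+b i j = solve 3 (λ i j r → (i :- j) :* r :+ (j :- i) :* r := con (+ 0)) refl i j (recip k k≉0)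

    level-count : ∀ i → count 𝓥 A? ≡ q ℕ.* count 𝓥 (level? i)
    level-count i = ≡.trans (count-fibre 𝓥 𝓕 h A?) (≡.trans (∑-cong 𝓕 (λ j → level-≡ j i)) (∑-const 𝓕 _))

  perp-slice : ∀ xs {s r} → Perp xs r → ¬ P s r ≈ 0# → ∀ i → M xs ≡ q ℕ.* count 𝓥 (λ u → (P s u ≟ i) ×-dec perp? xs u)
  perp-slice xs {s} {r} Wr k≉0 = level-count
    where
    W-shift : ∀ {u} a → Perp xs u → Perp xs (u +[ a ] r)
    W-shift a Wu = Perp-shift xs a Wu Wr
    P-shift′ : ∀ {u} a → Perp xs u → P s (u +[ a ] r) ≈ P s u + a * P s r
    P-shift′ {u} a _ = P-shiftʳ s u a r
    open Equidistribution (perp? xs) (Perp-resp xs) (P s) P-congˡ r (P s r) k≉0 W-shift P-shift′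

  M-∷ : ∀ xs {s r} → Perp xs r → ¬ P s r ≈ 0# → M xs ≡ q ℕ.* M (s ∷ xs)
  M-∷ xs {s} Wr k≉0 = ≡.trans (perp-slice xs Wr k≉0 0#)
    (≡.cong (q ℕ.*_) (count-cong 𝓥 (λ u → (P s u ≟ 0#) ×-dec perp? xs u) (perp? (s ∷ xs)) (λ _ (a , b) → a ∷ b)
      (λ { _ (a ∷ b) → a , b })))

  Q-slice : ∀ xs {s e} → Perp xs s → Q s ≈ 0# → ¬ e ≈ 0# → ∀ f →
            count 𝓥 (λ u → (P s u ≟ e) ×-dec perp? xs u) ≡
            q ℕ.* count 𝓥 (λ u → (Q u ≟ f) ×-dec ((P s u ≟ e) ×-dec perp? xs u))
  Q-slice xs {s} {e} Ws Qs≈0 e≉0 = level-count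
    where
    Pss≈0 : P s s ≈ 0#
    Pss≈0 = trans (P-diag s) (+-zero Qs≈0 Qs≈0)
    A? : ∀ u → Dec (P s u ≈ e × Perp xs u)
    A? u = (P s u ≟ e) ×-dec perp? xs u
    A-resp : ∀ {u w} → u ≈ᴹ w → P s u ≈ e × Perp xs u → P s w ≈ e × Perp xs w
    A-resp eq (a , b) = trans (P-congˡ (≈ᴹ-sym eq)) a , Perp-resp xs eq b
    A-shift : ∀ {u} a → P s u ≈ e × Perp xs u → P s (u +[ a ] s) ≈ e × Perp xs (u +[ a ] s)
    A-shift {u} a (Psu , Wu) = trans (P-shiftʳ s u a s)
      (trans (+-cong Psu (*-zero a Pss≈0)) (+-identityʳ e)) , Perp-shift xs a Wu Ws
    Q-shift′ : ∀ {u} a → P s u ≈ e × Perp xs u → Q (u +[ a ] s) ≈ Q u + a * e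
    Q-shift′ {u} a (Psu , Wu) = trans (Q-shift u a s) (trans
      (+-cong (+-congˡ (*-congˡ (trans (P-sym u s) Psu))) (*-zero (a * a) Qs≈0)) (+-identityʳ _))
    open Equidistribution A? A-resp Q Q-cong s e e≉0 A-shift Q-shift′

  module Split (xs : List Carrierᴹ) {s t : Carrierᴹ} (Ws : Perp xs s) (Wt : Perp xs t)
               (Qs≈0 : Q s ≈ 0#) (Qt≈0 : Q t ≈ 0#) (h≉0 : ¬ P s t ≈ 0#) where
    private
      h κ : Carrier
      h = P s t
      κ = recip h h≉0

      κh≈1 : κ * h ≈ 1#
      κh≈1 = recip-inverse h h≉0

      xs′ : List Carrierᴹ
      xs′ = s ∷ t ∷ xs

      Pss≈0 : P s s ≈ 0#
      Pss≈0 = trans (P-diag s) (+-zero Qs≈0 Qs≈0)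

      Ptt≈0 : P t t ≈ 0#
      Ptt≈0 = trans (P-diag t) (+-zero Qt≈0 Qt≈0)

      shift : Carrier → Carrier → Carrierᴹ → Carrierᴹ
      shift α β r = (r +[ α ] s) +[ β ] t

      shift-P-s : ∀ α β r → P s (shift α β r) ≈ P s r + β * h
      shift-P-s α β r = begin
        P s (shift α β r)  ≈⟨ P-shiftʳ s _ β t ⟩
        P s (r +[ α ] s) + β * h  ≈⟨ +-congʳ (P-shiftʳ s r α s) ⟩
        P s r + α * P s s + β * h  ≈⟨ +-congʳ (trans (+-congˡ (*-zero α Pss≈0)) (+-identityʳ _)) ⟩
        P s r + β * h ∎

      shift-P-t : ∀ α β r → P t (shift α β r) ≈ P t r + α * h
      shift-P-t α β r = begin
        P t (shift α β r)  ≈⟨ P-shiftʳ t _ β t ⟩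
        P t (r +[ α ] s) + β * P t t  ≈⟨ trans (+-congˡ (*-zero β Ptt≈0)) (+-identityʳ _) ⟩
        P t (r +[ α ] s)  ≈⟨ P-shiftʳ t r α s ⟩
        P t r + α * P t s  ≈⟨ +-congˡ (*-congˡ (P-sym t s)) ⟩
        P t r + α * h ∎

      shift-Q : ∀ α β r → Q (shift α β r) ≈ Q r + α * P s r + β * P t r + α * β * h
      shift-Q α β r = begin
        Q (shift α β r)  ≈⟨ Q-shift _ β t ⟩
        Q (r +[ α ] s) + β * P (r +[ α ] s) t + β * β * Q t
          ≈⟨ trans (+-congˡ (*-zero _ Qt≈0)) (+-identityʳ _) ⟩
        Q (r +[ α ] s) + β * P (r +[ α ] s) t
          ≈⟨ +-cong (trans (Q-shift r α s) (trans (+-congˡ (*-zero _ Qs≈0)) (+-identityʳ _)))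
            (*-congˡ (trans (P-shiftˡ r α s t) (+-congʳ (P-sym r t)))) ⟩
        (Q r + α * P r s) + β * (P t r + α * h)  ≈⟨ +-congʳ (+-congˡ (*-congˡ (P-sym r s))) ⟩
        (Q r + α * P s r) + β * (P t r + α * h)
          ≈⟨ solve 6 (λ a b x y z w → (x :+ a :* y) :+ b :* (z :+ a :* w) := x :+ a :* y :+ b :* z :+ a :* b :* w) refl
            α β (Q r) (P s r) (P t r) h ⟩
        Q r + α * P s r + β * P t r + α * β * h ∎

      shift-cong′ : ∀ α β {u w} → u ≈ᴹ w → shift α β u ≈ᴹ shift α β w
      shift-cong′ α β e = shift-cong (shift-cong e refl ≈ᴹ-refl) refl ≈ᴹ-refl

      shift-inv : ∀ {α α′ β β′} → α + α′ ≈ 0# → β + β′ ≈ 0# → ∀ r → shift α′ β′ (shift α β r) ≈ᴹ r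
      shift-inv {α} {α′} {β} {β′} e f r =
        ≈ᴹ-trans (shift-cong (shift-comm _ β t α′ s) refl ≈ᴹ-refl)
        (≈ᴹ-trans (shift-inverse _ t f) (shift-inverse r s e))

    coordinates? : ∀ f i j r → Dec (P t r ≈ j × P s r ≈ i × Q r ≈ f × Perp xs r)
    coordinates? f i j r = (P t r ≟ j) ×-dec ((P s r ≟ i) ×-dec ((Q r ≟ f) ×-dec perp? xs r))

    count-coordinates : ∀ f i j → count 𝓥 (coordinates? f i j) ≡ N xs′ (f - i * (j * κ))
    count-coordinates f i j = count-bij 𝓥 𝓥 (coordinates? f i j) (λ r → (Q r ≟ f′) ×-dec perp? xs′ r)
      (λ e (a , b , c , d) → trans (P-congˡ (≈ᴹ-sym e)) a , trans (P-congˡ (≈ᴹ-sym e)) b , trans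
        (Q-cong (≈ᴹ-sym e)) c , Perp-resp xs e d)
      (λ e (a , b) → trans (Q-cong (≈ᴹ-sym e)) a , Perp-resp xs′ e b)
      (shift (- α) (- β)) (shift α β) (shift-cong′ _ _) (shift-cong′ _ _)
      (λ {r} (a , b , c , d) →
        trans (shift-Q (- α) (- β) r) (trans (+-congʳ (+-cong (+-cong c (*-congˡ b)) (*-congˡ a)))
          (from-diff (solve 5 (λ f i j k h → f :+ (:- (j :* k)) :* i :+ (:- (i :* k)) :* j :+ (:- (j :* k)) :*
            (:- (i :* k)) :* h :- (f :- i :* (j :* k))
                               := (i :* j :* k) :* (k :* h :- con (+ 1))) refl f i j κ h)
            (*-zero _ (diff-zero κh≈1)))) ,
        trans (shift-P-s (- α) (- β) r) (trans (+-congʳ b) (cancel i)) ∷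
        trans (shift-P-t (- α) (- β) r) (trans (+-congʳ a) (cancel j)) ∷
        Perp-shift xs _ (Perp-shift xs _ d Ws) Wt)
      (λ { {r} (a , b ∷ c ∷ d) →
        trans (shift-P-t α β r) (trans (+-congʳ c) (gain j)) ,
        trans (shift-P-s α β r) (trans (+-congʳ b) (gain i)) ,
        trans (shift-Q α β r) (trans (+-congʳ (+-cong (+-cong a (*-congˡ b)) (*-congˡ c)))
          (from-diff (solve 5 (λ f i j k h → f :- i :*
            (j :* k) :+ j :* k :* con (+ 0) :+ i :* k :* con (+ 0) :+ j :* k :* (i :* k) :* h :- f
                               := (i :* j :* k) :* (k :* h :- con (+ 1))) refl f i j κ h)
            (*-zero _ (diff-zero κh≈1)))) ,
        Perp-shift xs _ (Perp-shift xs _ d Ws) Wt })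
      (λ _ → shift-inv (-‿inverseˡ α) (-‿inverseˡ β) _) (λ _ → shift-inv (-‿inverseʳ α) (-‿inverseʳ β) _)
      where
      α = j * κ
      β = i * κ
      f′ = f - i * (j * κ)
      cancel : ∀ i → i + (- (i * κ)) * h ≈ 0#
      cancel i = trans (solve 3 (λ i k h → i :+ (:- (i :* k)) :* h := (:- i) :* (k :* h :- con (+ 1))) refl i κ h)
        (*-zero _ (diff-zero κh≈1))
      gain : ∀ i → 0# + (i * κ) * h ≈ i
      gain i = trans (+-identityˡ _) (trans (*-assoc i κ h) (trans (*-congˡ κh≈1) (*-identityʳ i)))

    M-split : M xs ≡ q ℕ.* (q ℕ.* M xs′)
    M-split = ≡.trans (M-∷ xs Ws (h≉0 ∘ trans (P-sym s t)))
      (≡.cong (q ℕ.*_) (M-∷ (t ∷ xs) (Ptt≈0 ∷ Wt) h≉0))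

    N-split : ∀ f → N xs f ℕ.+ M xs′ ≡ q ℕ.* N xs′ f ℕ.+ q ℕ.* M xs′
    N-split f = ≡.trans (≡.cong (ℕ._+ M xs′) N≡∑g)
      (≡.trans (∑-const-but 𝓕 (M xs′) 0# g-cong g-≉0) (≡.cong (ℕ._+ q ℕ.* M xs′) g-0))
      where
      g : Carrier → ℕ
      g i = ∑ 𝓕 (λ j → N xs′ (f - i * (j * κ)))
      N≡∑g : N xs f ≡ ∑ 𝓕 g
      N≡∑g = ≡.trans (count-fibre 𝓥 𝓕 (P s) (λ v → (Q v ≟ f) ×-dec perp? xs v))
        (∑-cong 𝓕 (λ i → ≡.trans (count-fibre 𝓥 𝓕 (P t) (λ v → (P s v ≟ i) ×-dec ((Q v ≟ f) ×-dec perp? xs v)))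
          (∑-cong 𝓕 (count-coordinates f i))))
      g-cong : ∀ {i i′} → i ≈ i′ → g i ≡ g i′
      g-cong e = ∑-cong 𝓕 (λ j → N-cong xs′ (+-congˡ (-‿cong (*-congʳ e))))
      g-0 : g 0# ≡ q ℕ.* N xs′ f
      g-0 = ≡.trans (∑-cong 𝓕 (λ j → N-cong xs′ (solve 3 (λ f j k → f :- con (+ 0) :* (j :* k) := f) refl f j κ)))
        (∑-const 𝓕 _)
      g-≉0 : ∀ i → ¬ i ≈ 0# → g i ≡ M xs′
      g-≉0 i i≉0 = ≡.trans (∑-bij 𝓕 𝓕 (λ j → f - i * (j * κ)) (λ x → (f - x) * (h * ι))
          (λ e → +-congˡ (-‿cong (*-congˡ (*-congʳ e)))) (λ e → *-congʳ (+-congˡ (-‿cong e)))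
          (λ j → from-diff (solve 6 (λ f i k h l j → (f :- (f :- i :* (j :* k))) :* (h :* l) :- j := j :* k :* h :*
            (l :* i :- con (+ 1)) :+ j :* (k :* h :- con (+ 1))) refl f i κ h ι j) vanish)
          (λ x → from-diff (solve 6 (λ f i k h l x → (f :- i :* ((f :- x) :* (h :* l) :* k)) :- x :=
            (:- (f :- x)) :* k :* h :* (l :* i :- con (+ 1)) :+ (:- (f :- x)) :* (k :* h :- con (+ 1))) refl f i κ h ι
            x) vanish)
          (N-cong xs′)) (∑-N xs′)
        where
        ι = recip i i≉0
        vanish : ∀ {a b} → a * (ι * i - 1#) + b * (κ * h - 1#) ≈ 0#
        vanish = +-zero (*-zero _ (diff-zero (recip-inverse i i≉0))) (*-zero _ (diff-zero κh≈1))

  NonDeg : List Carrierᴹ → Set _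
  NonDeg xs = ∀ u → Perp xs u → (∀ w → Perp xs w → P u w ≈ 0#) → u ≈ᴹ 0ᴹ

  nonorthogonal : ∀ xs → NonDeg xs → ∀ {u} → Perp xs u → ¬ u ≈ᴹ 0ᴹ → ∃[ r ] Perp xs r × ¬ P u r ≈ 0#
  nonorthogonal xs nd {u} Wu u≉0
    with any? 𝓥 (λ e (a , b) → Perp-resp xs e a , λ p → b (trans (P-congˡ e) p))
      (λ r → perp? xs r ×-dec ¬? (P u r ≟ 0#))
  ... | yes found = found
  ... | no none   = contradiction (nd u Wu (λ w Ww → decidable-stable (P u w ≟ 0#) (λ p → none (w , Ww , p)))) u≉0

  hyperbolic-partner : ∀ xs → NonDeg xs → ∀ {s} → Perp xs s → ¬ s ≈ᴹ 0ᴹ → Q s ≈ 0# →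
                       ∃[ t ] Perp xs t × Q t ≈ 0# × ¬ P s t ≈ 0#
  hyperbolic-partner xs nd {s} Ws s≉0 Qs≈0 = r +[ a ] s , Perp-shift xs a Wr Ws , Qt≈0 , Pst≉0
    where
    partner = nonorthogonal xs nd Ws s≉0
    r = proj₁ partner
    Wr = proj₁ (proj₂ partner)
    k≉0 = proj₂ (proj₂ partner)
    κ = recip (P s r) k≉0
    a = - (Q r * κ)
    Qt≈0 : Q (r +[ a ] s) ≈ 0#
    Qt≈0 = begin
      Q (r +[ a ] s)  ≈⟨ Q-shift r a s ⟩
      Q r + a * P r s + a * a * Q s  ≈⟨ +-cong (+-congˡ (*-congˡ (P-sym r s))) (*-zero _ Qs≈0) ⟩
      Q r + a * P s r + 0#
        ≈⟨ solve 3 (λ x k p → x :+ (:- (x :* k)) :* p :+ con (+ 0) := (:- x) :* (k :* p :- con (+ 1))) refl (Q r) κ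
          (P s r) ⟩
      (- Q r) * (κ * P s r - 1#)  ≈⟨ *-zero _ (diff-zero (recip-inverse _ k≉0)) ⟩
      0# ∎
    Pst≉0 : ¬ P s (r +[ a ] s) ≈ 0#
    Pst≉0 p = k≉0 (trans (sym (trans (P-shiftʳ s r a s)
      (trans (+-congˡ (*-zero a (trans (P-diag s) (+-zero Qs≈0 Qs≈0)))) (+-identityʳ _)))) p)

  NonDeg-split : ∀ xs → NonDeg xs → ∀ {s t} → Perp xs s → Perp xs t → Q s ≈ 0# → Q t ≈ 0# → ¬ P s t ≈ 0# → NonDeg
    (s ∷ t ∷ xs)
  NonDeg-split xs nd {s} {t} Ws Wt Qs≈0 Qt≈0 h≉0 u (Psu ∷ Ptu ∷ Wu) orth = nd u Wu λ w Ww → begin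
    P u w
      ≈⟨ solve 3 (λ x y z → x := x :+ y :* con (+ 0) :+ z :* con (+ 0)) refl (P u w) (α w) (β w) ⟩
    P u w + α w * 0# + β w * 0#
      ≈⟨ +-cong (+-congˡ (*-congˡ (trans (P-sym u s) Psu))) (*-congˡ (trans (P-sym u t) Ptu)) ⟨
    P u w + α w * P u s + β w * P u t  ≈⟨ +-congʳ (P-shiftʳ u w (α w) s) ⟨
    P u (w +[ α w ] s) + β w * P u t  ≈⟨ P-shiftʳ u _ (β w) t ⟨
    P u (proj w)  ≈⟨ orth (proj w) (project w Ww) ⟩
    0# ∎
    where
    κ = recip (P s t) h≉0
    α β : Carrierᴹ → Carrier
    α w = - (P t w * κ)
    β w = - (P s w * κ)
    proj : Carrierᴹ → Carrierᴹ
    proj w = (w +[ α w ] s) +[ β w ] t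
    cancel : ∀ i → i + (- (i * κ)) * P s t ≈ 0#
    cancel i = trans (solve 3 (λ i k h → i :+ (:- (i :* k)) :* h := (:- i) :* (k :* h :- con (+ 1))) refl i κ (P s t))
      (*-zero _ (diff-zero (recip-inverse _ h≉0)))
    diag : ∀ {x} → Q x ≈ 0# → P x x ≈ 0#
    diag p = trans (P-diag _) (+-zero p p)
    project : ∀ w → Perp xs w → Perp (s ∷ t ∷ xs) (proj w)
    project w Ww =
      trans (P-shiftʳ s _ (β w) t) (trans (+-congʳ (trans (P-shiftʳ s w (α w) s)
        (trans (+-congˡ (*-zero _ (diag Qs≈0))) (+-identityʳ _)))) (cancel (P s w))) ∷
      trans (P-shiftʳ t _ (β w) t) (trans (+-congˡ (*-zero _ (diag Qt≈0)))
        (trans (+-identityʳ _) (trans (P-shiftʳ t w (α w) s)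
        (trans (+-congˡ (*-congˡ (P-sym t s))) (cancel (P t w)))))) ∷
      Perp-shift xs _ (Perp-shift xs _ Ww Ws) Wt

  LC : ∀ {n} → (Fin n → Carrier) → (Fin n → Carrierᴹ) → Carrierᴹ
  LC = linearCombination V

  LC-shift : ∀ {n} (a : Fin n → Carrier) (b : Fin n → Carrierᴹ) (γ : Fin n → Carrier) s → ∃[ g ] LC a
    (λ i → b i +[ γ i ] s) ≈ᴹ LC a b +[ g ] s
  LC-shift {zero}  a b γ s = 0# , ≈ᴹ-sym (shift-0 _ s)
  LC-shift {suc n} a b γ s = a zero * γ zero + g ,
    ≈ᴹ-trans (+ᴹ-cong (≈ᴹ-trans (*ₗ-distribˡ (a zero) _ _) (+ᴹ-congˡ (≈ᴹ-sym (*ₗ-assoc _ _ s)))) eq)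
    (≈ᴹ-trans (+ᴹ-interchange _ _ _ _) (+ᴹ-congˡ (≈ᴹ-sym (*ₗ-distribʳ s _ g))))
    where
    rest = LC-shift (a ∘ suc) (b ∘ suc) (γ ∘ suc) s
    g = proj₁ rest
    eq = proj₂ rest

  LC-perp : ∀ {n} x (a : Fin n → Carrier) (b : Fin n → Carrierᴹ) → (∀ i → P x (b i) ≈ 0#) → P x (LC a b) ≈ 0#
  LC-perp {zero}  x a b x⊥b = P-0ʳ x
  LC-perp {suc n} x a b x⊥b = trans (P-+ʳ x _ _)
    (+-zero (trans (P-*ʳ _ x _) (*-zero _ (x⊥b zero))) (LC-perp x (a ∘ suc) (b ∘ suc) (x⊥b ∘ suc)))

  LC-0 : ∀ {n} (b : Fin n → Carrierᴹ) → LC (λ _ → 0#) b ≈ᴹ 0ᴹ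
  LC-0 {zero}  b = ≈ᴹ-refl
  LC-0 {suc n} b = ≈ᴹ-trans (+ᴹ-cong (*ₗ-zeroˡ _) (LC-0 (b ∘ suc))) (+ᴹ-identityˡ 0ᴹ)

  TSB : List Carrierᴹ → ∀ {k} → (Fin k → Carrierᴹ) → Set _
  TSB xs = TotallySingularBasis V Q (Perp xs)

  2≤q : ∃[ p ] q ≡ suc (suc p)
  2≤q = helper q 𝓕
    where
    helper : ∀ n → HasCardinality (CommutativeRing.setoid F) n → ∃[ p ] n ≡ suc (suc p)
    helper zero          𝓒 = contradiction (Inverse.to 𝓒 0#) λ ()
    helper (suc zero)    𝓒 = contradiction (to-injective 𝓒 (fin1 (Inverse.to 𝓒 1#) (Inverse.to 𝓒 0#))) 1≉0
      where
      fin1 : ∀ (i j : Fin 1) → i ≡ j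
      fin1 zero zero = ≡.refl
    helper (suc (suc p)) _ = p , ≡.refl

  instance
    q-nonZero : ℕ.NonZero q
    q-nonZero = ℕ.≢-nonZero λ q≡0 → contradiction (≡.trans (≡.sym (proj₂ 2≤q)) q≡0) λ ()

  module Descent (xs : List Carrierᴹ) (nd : NonDeg xs) {k} (b : Fin (suc k) → Carrierᴹ) (tsb : TSB xs b) where
    private
      independent = proj₁ tsb
      span⊆W = proj₁ (proj₂ tsb)
      singular = proj₂ (proj₂ tsb)

    s : Carrierᴹ
    s = b zero

    private
      1∷0 : Fin (suc k) → Carrier
      1∷0 = 1# Vector.∷ λ _ → 0#

      s≈LC : s ≈ᴹ LC 1∷0 b
      s≈LC = ≈ᴹ-sym (≈ᴹ-trans (+ᴹ-cong (*ₗ-identityˡ s) (LC-0 (b ∘ suc))) (+ᴹ-identityʳ s))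

      s∈span : s ∈ span V b
      s∈span = 1∷0 , s≈LC

    Ws : Perp xs s
    Ws = span⊆W s∈span

    Qs≈0 : Q s ≈ 0#
    Qs≈0 = singular s s∈span

    private
      s≉0 : ¬ s ≈ᴹ 0ᴹ
      s≉0 s≈0 = 1≉0 (independent 1∷0 (≈ᴹ-trans (≈ᴹ-sym s≈LC) s≈0) zero)

      partner = hyperbolic-partner xs nd Ws s≉0 Qs≈0

    t : Carrierᴹ
    t = proj₁ partner

    Wt : Perp xs t
    Wt = proj₁ (proj₂ partner)

    Qt≈0 : Q t ≈ 0#
    Qt≈0 = proj₁ (proj₂ (proj₂ partner))

    h≉0 : ¬ P s t ≈ 0#
    h≉0 = proj₂ (proj₂ (proj₂ partner))

    xs′ : List Carrierᴹ
    xs′ = s ∷ t ∷ xs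

    private
      κ = recip (P s t) h≉0

      γ : Fin k → Carrier
      γ i = - (P t (b (suc i)) * κ)

    b′ : Fin k → Carrierᴹ
    b′ i = b (suc i) +[ γ i ] s

    private
      t⊥b′ : ∀ i → P t (b′ i) ≈ 0#
      t⊥b′ i = begin
        P t (b′ i)  ≈⟨ P-shiftʳ t _ (γ i) s ⟩
        P t (b (suc i)) + γ i * P t s  ≈⟨ +-congˡ (*-congˡ (P-sym t s)) ⟩
        P t (b (suc i)) + γ i * P s t
          ≈⟨ solve 3 (λ x k h → x :+ (:- (x :* k)) :* h := (:- x) :* (k :* h :- con (+ 1))) refl (P t (b (suc i))) κ
            (P s t) ⟩
        (- P t (b (suc i))) * (κ * P s t - 1#)  ≈⟨ *-zero _ (diff-zero (recip-inverse _ h≉0)) ⟩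
        0# ∎

      lift : ∀ a → ∃[ g ] LC a b′ ≈ᴹ LC (g Vector.∷ a) b
      lift a = let g , eq = LC-shift a (b ∘ suc) γ s in g , ≈ᴹ-trans eq (+ᴹ-comm _ _)

    span-b′ : ∀ {w} → w ∈ span V b′ → w ∈ span V b
    span-b′ (a , w≈) = let g , eq = lift a in g Vector.∷ a , ≈ᴹ-trans w≈ eq

    private
      s+w : ∀ {w} → w ∈ span V b → s +ᴹ w ∈ span V b
      s+w {w} (a , w≈) = (1# + a zero) Vector.∷ (a ∘ suc) , ≈ᴹ-trans (+ᴹ-congˡ w≈)
        (≈ᴹ-trans (≈ᴹ-sym (+ᴹ-assoc s _ _)) (+ᴹ-congʳ (≈ᴹ-trans (+ᴹ-congʳ (≈ᴹ-sym (*ₗ-identityˡ s)))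
          (≈ᴹ-sym (*ₗ-distribʳ s 1# (a zero))))))

      s⊥span : ∀ {w} → w ∈ span V b → P s w ≈ 0#
      s⊥span {w} w∈ = trans (+-cong (+-cong (singular _ (s+w w∈)) (-‿cong Qs≈0)) (-‿cong (singular w w∈)))
        (solve 0 (con (+ 0) :- con (+ 0) :- con (+ 0) := con (+ 0)) refl)

    tsb′ : TSB xs′ b′
    tsb′ = (λ a e i → let g , eq = lift a in independent (g Vector.∷ a) (≈ᴹ-trans (≈ᴹ-sym eq) e) (suc i)) ,
           (λ {w} w∈@(a , w≈) → s⊥span (span-b′ w∈) ∷ trans (P-congˡ w≈) (LC-perp t a b′ t⊥b′) ∷ span⊆W (span-b′ w∈)) ,
           (λ w w∈ → singular w (span-b′ w∈))

    extend : ∀ {j} {d : Fin j → Carrierᴹ} → TSB xs′ d → TSB xs (s Vector.∷ d)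
    extend {j} {d} (ind , sp , sing) = independent′ , inside , singular′
      where
      decompose : ∀ {w} → w ∈ span V (s Vector.∷ d) → ∃[ a ] ∃[ u ] w ≈ᴹ u +[ a ] s × Perp xs′ u × Q u ≈ 0#
      decompose (a , w≈) = a zero , LC (a ∘ suc) d , ≈ᴹ-trans w≈ (+ᴹ-comm _ _) , sp ((a ∘ suc) , ≈ᴹ-refl) , sing _
        ((a ∘ suc) , ≈ᴹ-refl)
      independent′ : LinearlyIndependent V (s Vector.∷ d)
      independent′ a e = λ { zero → a₀≈0 ; (suc i) → ind (a ∘ suc) rest≈0 i }
        where
        rest = LC (a ∘ suc) d
        t⊥rest : P t rest ≈ 0#
        t⊥rest with sp {rest} ((a ∘ suc) , ≈ᴹ-refl)
        ... | _ ∷ p ∷ _ = p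
        a₀≈0 : a zero ≈ 0#
        a₀≈0 = x*y≈0 (λ p → h≉0 (trans (P-sym s t) p)) (begin
          P t s * a zero  ≈⟨ solve 2 (λ x y → x :* y := y :* x :+ con (+ 0)) refl _ _ ⟩
          a zero * P t s + 0#  ≈⟨ +-cong (P-*ʳ _ t s) t⊥rest ⟨
          P t (a zero *ₗ s) + P t rest  ≈⟨ P-+ʳ t _ _ ⟨
          P t (a zero *ₗ s +ᴹ rest)  ≈⟨ P-congˡ e ⟩
          P t 0ᴹ  ≈⟨ P-0ʳ t ⟩
          0# ∎)
        rest≈0 : rest ≈ᴹ 0ᴹ
        rest≈0 = ≈ᴹ-trans (≈ᴹ-sym (≈ᴹ-trans (+ᴹ-congʳ (≈ᴹ-trans (*ₗ-congʳ a₀≈0) (*ₗ-zeroˡ s))) (+ᴹ-identityˡ rest))) e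
      inside : span V (s Vector.∷ d) ⊆ Perp xs
      inside w∈ with decompose w∈
      ... | a , u , w≈ , _ ∷ _ ∷ Wu , _ = Perp-resp xs (≈ᴹ-sym w≈) (Perp-shift xs a Wu Ws)
      singular′ : ∀ w → w ∈ span V (s Vector.∷ d) → Q w ≈ 0#
      singular′ w w∈ with decompose w∈
      ... | a , u , w≈ , Psu ∷ _ , Qu = trans (Q-cong w≈) (trans (Q-shift u a s)
        (+-zero (+-zero Qu (*-zero a (trans (P-sym u s) Psu))) (*-zero _ Qs≈0)))

    open Split xs Ws Wt Qs≈0 Qt≈0 h≉0 public using (M-split; N-split)

    nd′ : NonDeg xs′
    nd′ = NonDeg-split xs nd Ws Wt Qs≈0 Qt≈0 h≉0

    M′ : ∀ {n} → M xs ≡ (q ℕ.* n) ℕ.* (q ℕ.* n) → M xs′ ≡ n ℕ.* n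
    M′ {n} eq = ℕₚ.*-cancelˡ-≡ _ _ q (ℕₚ.*-cancelˡ-≡ _ _ q (≡.trans (≡.sym M-split) (≡.trans eq
      (+-*-Solver.solve 2 (λ q n → (q :*: n) :*: (q :*: n) :=: q :*: (q :*: (n :*: n))) ≡.refl q n))))
      where open +-*-Solver using () renaming (_:*_ to _:*:_; _:=_ to _:=:_)

  -- N xs 0# minus N xs f is q ^ n or - q ^ n, with both sides moved so that no subtraction occurs.
  NumericType : Sign → ℕ → List Carrierᴹ → Set _
  NumericType Sign.+ n xs = ∀ f → ¬ f ≈ 0# → N xs 0# ≡ N xs f ℕ.+ q ^ n
  NumericType Sign.- n xs = ∀ f → ¬ f ≈ 0# → N xs f ≡ N xs 0# ℕ.+ q ^ n

  private
    N-0≡1 : ∀ xs → (∀ u → Perp xs u → Q u ≈ 0# → u ≈ᴹ 0ᴹ) → N xs 0# ≡ 1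
    N-0≡1 xs anisotropic = count-unique 𝓥 (λ u → (Q u ≟ 0#) ×-dec perp? xs u)
      (λ e (a , b) → trans (Q-cong (≈ᴹ-sym e)) a , Perp-resp xs e b)
      0ᴹ (Q-0 , Perp-0 xs) (λ u (Qu , Wu) → anisotropic u Wu Qu)

    lift-split : ∀ {a a′ b b′ m p} → a ℕ.+ m ≡ q ℕ.* a′ ℕ.+ q ℕ.* m → b ℕ.+ m ≡ q ℕ.* b′ ℕ.+ q ℕ.* m → a′ ≡ b′ ℕ.+ p →
      a ≡ b ℕ.+ q ℕ.* p
    lift-split {a} {a′} {b} {b′} {m} {p} eqa eqb eq = ℕₚ.+-cancelʳ-≡ m _ _
      (≡.trans eqa (≡.trans (≡.cong (λ x → q ℕ.* x ℕ.+ q ℕ.* m) eq)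
      (≡.trans (S.solve 4 (λ q b p m → q S.:* (b S.:+ p) S.:+ q S.:* m S.:= (q S.:* b S.:+ q S.:* m) S.:+ q S.:* p)
        ≡.refl q b′ p m)
      (≡.trans (≡.cong (ℕ._+ q ℕ.* p) (≡.sym eqb)) (S.solve 3
        (λ b m x → b S.:+ m S.:+ x S.:= b S.:+ x S.:+ m) ≡.refl b m (q ℕ.* p))))))
      where module S = +-*-Solver

  hyperbolic-count : ∀ n xs → NonDeg xs → M xs ≡ q ^ n ℕ.* q ^ n → (b : Fin n → Carrierᴹ) → TSB xs b →
    NumericType Sign.+ n xs
  hyperbolic-count zero xs nd M≡1 b tsb f f≉0 = ≡.trans (N-0≡1 xs (λ u Wu _ → trivial u Wu))
    (≡.cong (ℕ._+ 1) (≡.sym (count-empty 𝓥 (λ u → (Q u ≟ f) ×-dec perp? xs u)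
      (λ u (Qu , Wu) → f≉0 (trans (sym Qu) (trans (Q-cong (trivial u Wu)) Q-0))))))
    where
    trivial : ∀ u → Perp xs u → u ≈ᴹ 0ᴹ
    trivial = count-⊆-≡ 𝓥 (λ u → u ≟ᴹ 0ᴹ) (perp? xs) (λ e f → ≈ᴹ-trans (≈ᴹ-sym e) f) (Perp-resp xs)
      (λ u e → Perp-resp xs (≈ᴹ-sym e) (Perp-0 xs))
      (≡.trans (count-unique 𝓥 (λ u → u ≟ᴹ 0ᴹ) (λ e f → ≈ᴹ-trans (≈ᴹ-sym e) f) 0ᴹ ≈ᴹ-refl (λ _ e → e)) (≡.sym M≡1))
  hyperbolic-count (suc n) xs nd Mxs b tsb f f≉0 =
    lift-split (N-split 0#) (N-split f) (hyperbolic-count n xs′ nd′ (M′ Mxs) b′ tsb′ f f≉0)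
    where open Descent xs nd b tsb

  module AnisotropicPlane (2≉0 : ¬ 1# + 1# ≈ 0#) (xs : List Carrierᴹ) (Mxs : M xs ≡ q ℕ.* q)
                          (anisotropic : ∀ u → Perp xs u → Q u ≈ 0# → u ≈ᴹ 0ᴹ) where

    -- Summing over λ the solutions d of Q d + λ P(e,d) = 0: for λ ≠ 0 the map d ↦ e + λ⁻¹ d carries them to the
    -- vectors of norm f, and every d outside e⊥ solves exactly one of these equations.
    represented : ∀ {e f} → Perp xs e → Q e ≈ f → ¬ f ≈ 0# → N xs f ≡ suc q
    represented {e} {f} We Qe≈f f≉0 = finish q 2≤q total
      where
      Pee≉0 : ¬ P e e ≈ 0#
      Pee≉0 p = x*y≉0 2≉0 f≉0 (trans (solve 1 (λ x → con (+ 2) :* x := x :+ x) refl f)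
        (trans (+-cong (sym Qe≈f) (sym Qe≈f)) (trans (sym (P-diag e)) p)))
      M-e : M (e ∷ xs) ≡ q
      M-e = ℕₚ.*-cancelˡ-≡ _ _ q (≡.trans (≡.sym (M-∷ xs We Pee≉0)) Mxs)
      sol? : ∀ l d → Dec (Q d + l * P e d ≈ 0# × Perp xs d)
      sol? l d = (Q d + l * P e d ≟ 0#) ×-dec perp? xs d
      sol-resp : ∀ {l d d′} → d ≈ᴹ d′ → Q d + l * P e d ≈ 0# × Perp xs d → Q d′ + l * P e d′ ≈ 0# × Perp xs d′
      sol-resp eq (a , b) = trans (+-cong (Q-cong (≈ᴹ-sym eq)) (*-congˡ (P-congˡ (≈ᴹ-sym eq)))) a , Perp-resp xs eq b
      C : Carrier → ℕ
      C l = count 𝓥 (sol? l)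
      C-cong : ∀ {l l′} → l ≈ l′ → C l ≡ C l′
      C-cong {l} {l′} eq = count-cong 𝓥 (sol? l) (sol? l′) (λ _ (a , b) → trans (+-congˡ (*-congʳ (sym eq))) a , b)
        (λ _ (a , b) → trans (+-congˡ (*-congʳ eq)) a , b)
      C-0 : C 0# ≡ 1
      C-0 = ≡.trans (count-cong 𝓥 (sol? 0#) (λ u → (Q u ≟ 0#) ×-dec perp? xs u)
        (λ d (a , b) → trans (sym (drop d)) a , b) (λ d (a , b) → trans (drop d) a , b)) (N-0≡1 xs anisotropic)
        where
        drop : ∀ d → Q d + 0# * P e d ≈ Q d
        drop d = trans (+-congˡ (zeroˡ _)) (+-identityʳ _)
      C-≉0 : ∀ l → ¬ l ≈ 0# → C l ≡ N xs f
      C-≉0 l l≉0 = count-bij 𝓥 𝓥 (sol? l) (λ u → (Q u ≟ f) ×-dec perp? xs u) sol-resp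
        (λ eq (a , b) → trans (Q-cong (≈ᴹ-sym eq)) a , Perp-resp xs eq b)
        (λ d → e +[ μ ] d) (λ u → l *ₗ (u +[ - 1# ] e))
        (λ eq → shift-cong ≈ᴹ-refl refl eq) (λ eq → *ₗ-congˡ (shift-cong eq refl ≈ᴹ-refl))
        (λ {d} (a , Wd) → (begin
          Q (e +[ μ ] d)  ≈⟨ Q-shift e μ d ⟩
          Q e + μ * P e d + μ * μ * Q d  ≈⟨ +-congʳ (+-congʳ Qe≈f) ⟩
          f + μ * P e d + μ * μ * Q d
            ≈⟨ from-diff (solve 5 (λ f m l p x → f :+ m :* p :+ m :* m :* x :- f := m :* m :* (x :+ l :* p) :+
              (:- (m :* p)) :* (m :* l :- con (+ 1))) refl f μ l (P e d) (Q d))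
                                                                   (+-zero (*-zero _ a) (*-zero _ (diff-zero μl≈1))) ⟩
          f ∎) , Perp-shift xs μ We Wd)
        (λ {u} (Qu , Wu) → (begin
          Q (l *ₗ (u +[ - 1# ] e)) + l * P e (l *ₗ (u +[ - 1# ] e))  ≈⟨ +-cong (Q-*ₗ l _) (*-congˡ (P-*ʳ l e _)) ⟩
          l * l * Q (u +[ - 1# ] e) + l * (l * P e (u +[ - 1# ] e))
            ≈⟨ +-cong (*-congˡ (trans (Q-shift u (- 1#) e) (+-cong (+-cong Qu (*-congˡ (P-sym u e))) (*-congˡ Qe≈f))))
                                                                          (*-congˡ (*-congˡ (trans (P-shiftʳ e u
                                                                            (- 1#) e) (+-congˡ (*-congˡ
                                                                            (trans (P-diag e) (+-cong Qe≈f Qe≈f))))))) ⟩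
          l * l * (f + - 1# * P e u + - 1# * - 1# * f) + l * (l * (P e u + - 1# * (f + f)))
                                                                       ≈⟨ solve 3 (λ l f p → l :* l :*
                                                                         (f :+ (:- con (+ 1)) :* p :+ (:- con (+ 1)) :*
                                                                         (:- con (+ 1)) :* f) :+ l :*
                                                                         (l :* (p :+ (:- con (+ 1)) :* (f :+ f))) :=
                                                                         con (+ 0)) refl l f (P e u) ⟩
          0# ∎) , Perp-* xs l (Perp-shift xs _ Wu We))
        (λ {d} _ → ≈ᴹ-trans (*ₗ-congˡ (≈ᴹ-trans (shift-cong (+ᴹ-comm _ _) refl ≈ᴹ-refl) (≈ᴹ-trans (+ᴹ-assoc _ _ _)
              (≈ᴹ-trans (+ᴹ-congˡ (≈ᴹ-trans (+ᴹ-congʳ (≈ᴹ-sym (*ₗ-identityˡ e)))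
                (≈ᴹ-trans (≈ᴹ-sym (*ₗ-distribʳ e 1# (- 1#))) (≈ᴹ-trans (*ₗ-congʳ (-‿inverseʳ 1#)) (*ₗ-zeroˡ e)))))
                (+ᴹ-identityʳ _)))))
            (unscale lμ≈1 d))
        (λ {u} _ → ≈ᴹ-trans (+ᴹ-congˡ (unscale μl≈1 _)) (≈ᴹ-trans (+ᴹ-comm _ _) (≈ᴹ-trans (+ᴹ-assoc _ _ _)
            (≈ᴹ-trans (+ᴹ-congˡ (≈ᴹ-trans (+ᴹ-congˡ (≈ᴹ-sym (*ₗ-identityˡ e)))
              (≈ᴹ-trans (≈ᴹ-sym (*ₗ-distribʳ e (- 1#) 1#)) (≈ᴹ-trans (*ₗ-congʳ (-‿inverseˡ 1#)) (*ₗ-zeroˡ e)))))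
              (+ᴹ-identityʳ u)))))
        where
        μ = recip l l≉0
        μl≈1 : μ * l ≈ 1#
        μl≈1 = recip-inverse l l≉0
        lμ≈1 : l * μ ≈ 1#
        lμ≈1 = trans (*-comm l μ) μl≈1
        unscale : ∀ {a b} → a * b ≈ 1# → ∀ d → a *ₗ (b *ₗ d) ≈ᴹ d
        unscale ab≈1 d = ≈ᴹ-trans (≈ᴹ-sym (*ₗ-assoc _ _ d)) (≈ᴹ-trans (*ₗ-congʳ ab≈1) (*ₗ-identityˡ d))
      row : ∀ d → ∑ 𝓕 (λ l → 𝟙 (sol? l d)) ℕ.+ 𝟙 (perp? (e ∷ xs) d) ≡ 𝟙 (perp? xs d) ℕ.+ q ℕ.* 𝟙 (d ≟ᴹ 0ᴹ)
      row d = cases (perp? xs d) (P e d ≟ 0#) (d ≟ᴹ 0ᴹ)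
        where
        A = ∑ 𝓕 (λ l → 𝟙 (sol? l d))
        B = 𝟙 (perp? (e ∷ xs) d)
        combine : ∀ {a b c d′} → A ≡ a → B ≡ b → 𝟙 (perp? xs d) ≡ c → 𝟙 (d ≟ᴹ 0ᴹ) ≡ d′ → a ℕ.+ b ≡ c ℕ.+ q ℕ.* d′ →
                  A ℕ.+ B ≡ 𝟙 (perp? xs d) ℕ.+ q ℕ.* 𝟙 (d ≟ᴹ 0ᴹ)
        combine a b c d′ eq = ≡.trans (≡.cong₂ ℕ._+_ a b) (≡.trans eq (≡.sym (≡.cong₂ (λ x y → x ℕ.+ q ℕ.* y) c d′)))
        0∈W : d ≈ᴹ 0ᴹ → Perp xs d
        0∈W d≈0 = Perp-resp xs (≈ᴹ-sym d≈0) (Perp-0 xs)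
        cases : Dec (Perp xs d) → Dec (P e d ≈ 0#) → Dec (d ≈ᴹ 0ᴹ) → A ℕ.+ B ≡ 𝟙 (perp? xs d) ℕ.+ q ℕ.* 𝟙 (d ≟ᴹ 0ᴹ)
        cases (no ¬Wd) _ _ = combine (count-empty 𝓕 (λ l → sol? l d) (λ _ → ¬Wd ∘ proj₂))
          (𝟙-no (perp? (e ∷ xs) d) (λ { (_ ∷ Wd) → ¬Wd Wd }))
          (𝟙-no (perp? xs d) ¬Wd) (𝟙-no (d ≟ᴹ 0ᴹ) (¬Wd ∘ 0∈W)) (≡.sym (ℕₚ.*-zeroʳ q))
        cases (yes Wd) (no p≉0) _ = combine
          (count-unique 𝓕 (λ l → sol? l d) (λ eq (a , b) → trans (+-congˡ (*-congʳ (sym eq))) a , b) l₀ (l₀-solves , Wd)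
            (λ l (a , _) → *-cancelˡ-≉0 p≉0 (from-diff
              (solve 4 (λ p l m x → p :* l :- p :* m := (x :+ l :* p) :+ (:- con (+ 1)) :* (x :+ m :* p)) refl
              (P e d) l l₀ (Q d)) (+-zero a (*-zero _ l₀-solves)))))
          (𝟙-no (perp? (e ∷ xs) d) (λ { (p ∷ _) → p≉0 p })) (𝟙-yes (perp? xs d) Wd)
          (𝟙-no (d ≟ᴹ 0ᴹ) (λ d≈0 → p≉0 (trans (P-congˡ d≈0) (P-0ʳ e)))) (≡.cong suc (≡.sym (ℕₚ.*-zeroʳ q)))
          where
          l₀ = - (Q d * recip (P e d) p≉0)
          l₀-solves : Q d + l₀ * P e d ≈ 0#
          l₀-solves = trans (solve 3 (λ x r p → x :+ (:- (x :* r)) :* p := (:- x) :* (r :* p :- con (+ 1))) refl (Q d)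
            (recip (P e d) p≉0) (P e d))
            (*-zero _ (diff-zero (recip-inverse _ p≉0)))
        cases (yes Wd) (yes p≈0) (yes d≈0) = combine
          (count-all 𝓕 (λ l → sol? l d) (λ l → +-zero (trans (Q-cong d≈0) Q-0) (*-zero l p≈0) , Wd))
          (𝟙-yes (perp? (e ∷ xs) d) (p≈0 ∷ Wd)) (𝟙-yes (perp? xs d) Wd) (𝟙-yes (d ≟ᴹ 0ᴹ) d≈0)
          (≡.trans (ℕₚ.+-comm q 1) (≡.cong suc (≡.sym (ℕₚ.*-identityʳ q))))
        cases (yes Wd) (yes p≈0) (no d≉0) = combine
          (count-empty 𝓕 (λ l → sol? l d) (λ l (a , _) → d≉0
            (anisotropic d Wd (trans (trans (sym (+-identityʳ _)) (+-congˡ (sym (*-zero l p≈0)))) a))))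
          (𝟙-yes (perp? (e ∷ xs) d) (p≈0 ∷ Wd)) (𝟙-yes (perp? xs d) Wd) (𝟙-no (d ≟ᴹ 0ᴹ) d≉0)
            (≡.cong suc (≡.sym (ℕₚ.*-zeroʳ q)))
      ∑C : ∑ 𝓕 C ≡ q ℕ.* q
      ∑C = ℕₚ.+-cancelʳ-≡ q _ _ (≡.trans (≡.cong₂ ℕ._+_ (∑-swap 𝓕 𝓥 (λ l d → 𝟙 (sol? l d))) (≡.sym M-e))
        (≡.trans (≡.sym (∑-+ 𝓥 _ _)) (≡.trans (∑-cong 𝓥 row) (≡.trans (∑-+ 𝓥 _ _)
        (≡.cong₂ ℕ._+_ Mxs (≡.trans (∑-*ˡ 𝓥 q _) (≡.trans (≡.cong (q ℕ.*_)
          (count-unique 𝓥 (λ u → u ≟ᴹ 0ᴹ) (λ e f → ≈ᴹ-trans (≈ᴹ-sym e) f) 0ᴹ ≈ᴹ-refl (λ _ e → e)))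
            (ℕₚ.*-identityʳ q))))))))
      total : q ℕ.* q ℕ.+ N xs f ≡ 1 ℕ.+ q ℕ.* N xs f
      total = ≡.trans (≡.cong (ℕ._+ N xs f) (≡.sym ∑C))
        (≡.trans (∑-const-but 𝓕 (N xs f) 0# C-cong C-≉0) (≡.cong (ℕ._+ q ℕ.* N xs f) C-0))
      finish : ∀ q → ∃[ p ] q ≡ suc (suc p) → q ℕ.* q ℕ.+ N xs f ≡ 1 ℕ.+ q ℕ.* N xs f → N xs f ≡ suc q
      finish .(suc (suc p)) (p , ≡.refl) eq = ≡.sym (ℕₚ.*-cancelˡ-≡ _ _ (suc p) (ℕₚ.+-cancelʳ-≡ (1 ℕ.+ n) _ _
        (≡.trans (S.solve 2 (λ p n → (S.con 1 S.:+ p) S.:* (S.con 3 S.:+ p) S.:+ (S.con 1 S.:+ n) S.:=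
          (S.con 2 S.:+ p) S.:* (S.con 2 S.:+ p) S.:+ n) ≡.refl p n)
          (≡.trans eq (S.solve 2 (λ p n → S.con 1 S.:+ (S.con 2 S.:+ p) S.:* n S.:= (S.con 1 S.:+ p) S.:* n S.:+
            (S.con 1 S.:+ n)) ≡.refl p n)))))
        where
        module S = +-*-Solver
        n = N xs f

    N-const : ∀ f → ¬ f ≈ 0# → N xs f ≡ suc q
    N-const f f≉0 = ≡.trans (∑-mono-≡ 𝓕 (N-cong xs) g-cong N≤g (≡.trans (∑-N xs) (≡.trans Mxs (≡.sym ∑g))) f)
      (g-≉0 f f≉0)
      where
      g : Carrier → ℕ
      g f = 𝟙 (f ≟ 0#) ℕ.+ 𝟙 (¬? (f ≟ 0#)) ℕ.* suc q
      g-≉0 : ∀ f → ¬ f ≈ 0# → g f ≡ suc q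
      g-≉0 f f≉0 = ≡.trans (≡.cong₂ (λ x y → x ℕ.+ y ℕ.* suc q) (𝟙-no (f ≟ 0#) f≉0) (𝟙-yes (¬? (f ≟ 0#)) f≉0))
        (ℕₚ.*-identityˡ (suc q))
      g-≈0 : ∀ f → f ≈ 0# → g f ≡ 1
      g-≈0 f f≈0 = ≡.cong₂ (λ x y → x ℕ.+ y ℕ.* suc q) (𝟙-yes (f ≟ 0#) f≈0) (𝟙-no (¬? (f ≟ 0#)) (λ p → p f≈0))
      g-cong : ∀ {x y} → x ≈ y → g x ≡ g y
      g-cong {x} {y} e = ≡.cong₂ (λ x y → x ℕ.+ y ℕ.* suc q) (𝟙-cong (x ≟ 0#) (y ≟ 0#) (trans (sym e)) (trans e))
        (𝟙-cong (¬? (x ≟ 0#)) (¬? (y ≟ 0#)) (λ p → p ∘ trans e) (λ p → p ∘ trans (sym e)))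
      ∑g : ∑ 𝓕 g ≡ q ℕ.* q
      ∑g = ℕₚ.+-cancelʳ-≡ (suc q) _ _ (≡.trans (∑-const-but 𝓕 (suc q) 0# g-cong g-≉0)
        (≡.trans (≡.cong (ℕ._+ q ℕ.* suc q) (g-≈0 0# refl))
        (+-*-Solver.solve 1 (λ q → S.con 1 S.:+ q S.:* (S.con 1 S.:+ q) S.:= q S.:* q S.:+ (S.con 1 S.:+ q)) ≡.refl q)))
        where module S = +-*-Solver
      N≤g : ∀ f → N xs f ≤ g f
      N≤g f with f ≟ 0#
      ... | yes f≈0 = ℕₚ.≤-reflexive (≡.trans (N-cong xs f≈0) (N-0≡1 xs anisotropic))
      ... | no f≉0 with any? 𝓥 (λ e (a , b) → trans (Q-cong (≈ᴹ-sym e)) a , Perp-resp xs e b)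
        (λ u → (Q u ≟ f) ×-dec perp? xs u)
      ... | yes (e , Qe , We) = ℕₚ.≤-reflexive (≡.trans (represented We Qe f≉0) (≡.sym (ℕₚ.*-identityˡ (suc q))))
      ... | no none = ℕₚ.≤-trans (ℕₚ.≤-reflexive (count-empty 𝓥 (λ u → (Q u ≟ f) ×-dec perp? xs u)
        (λ u p → none (u , p)))) z≤n

  elliptic-count : ¬ 1# + 1# ≈ 0# → ∀ k xs → NonDeg xs → M xs ≡ q ^ suc k ℕ.* q ^ suc k →
                   (b : Fin k → Carrierᴹ) → TSB xs b → (∀ (d : Fin (suc k) → Carrierᴹ) → ¬ TSB xs d) →
                     NumericType Sign.- (suc k) xs
  elliptic-count 2≉0 zero xs nd Mxs b tsb none f f≉0 =
    ≡.trans (N-const f f≉0) (≡.sym (≡.cong₂ ℕ._+_ (N-0≡1 xs anisotropic) (ℕₚ.*-identityʳ q)))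
    where
    anisotropic : ∀ u → Perp xs u → Q u ≈ 0# → u ≈ᴹ 0ᴹ
    anisotropic u Wu Qu≈0 = decidable-stable (u ≟ᴹ 0ᴹ) λ u≉0 → none (λ _ → u)
      ( (λ { a e zero → decidable-stable (a zero ≟ 0#) λ a≉0 → u≉0 (≈ᴹ-trans (≈ᴹ-sym (*ₗ-identityˡ u))
            (≈ᴹ-trans (*ₗ-congʳ (sym (recip-inverse (a zero) a≉0))) (≈ᴹ-trans (*ₗ-assoc _ _ u)
            (≈ᴹ-trans (*ₗ-congˡ (≈ᴹ-trans (≈ᴹ-sym (+ᴹ-identityʳ _)) e)) (*ₗ-zeroʳ _))))) })
      , (λ (a , w≈) → Perp-resp xs (≈ᴹ-sym (≈ᴹ-trans w≈ (+ᴹ-identityʳ _))) (Perp-* xs (a zero) Wu))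
      , (λ w (a , w≈) → trans (Q-cong (≈ᴹ-trans w≈ (+ᴹ-identityʳ _))) (trans (Q-*ₗ _ u) (*-zero _ Qu≈0))))
    open AnisotropicPlane 2≉0 xs (≡.trans Mxs (≡.cong₂ ℕ._*_ (ℕₚ.*-identityʳ q) (ℕₚ.*-identityʳ q))) anisotropic
  elliptic-count 2≉0 (suc k) xs nd Mxs b tsb none f f≉0 =
    lift-split (N-split f) (N-split 0#) (elliptic-count 2≉0 k xs′ nd′ (M′ Mxs) b′ tsb′
      (λ d tsb″ → none (s Vector.∷ d) (extend {d = d} tsb″)) f f≉0)
    where open Descent xs nd b tsb

  *ₗ-inverse : ∀ {e f} → e * f ≈ 1# → ∀ u → e *ₗ (f *ₗ u) ≈ᴹ u
  *ₗ-inverse ef≈1 u = ≈ᴹ-trans (≈ᴹ-sym (*ₗ-assoc _ _ u)) (≈ᴹ-trans (*ₗ-congʳ ef≈1) (*ₗ-identityˡ u))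

  module Reflection (d : Carrierᴹ) (Qd≉0 : ¬ Q d ≈ 0#) where
    private
      κ = recip (Q d) Qd≉0

      κQd≈1 : κ * Q d ≈ 1#
      κQd≈1 = recip-inverse (Q d) Qd≉0

      α : Carrierᴹ → Carrier
      α u = - (P d u * κ)

    σ : Carrierᴹ → Carrierᴹ
    σ u = u +[ α u ] d

    σ-cong : ∀ {u w} → u ≈ᴹ w → σ u ≈ᴹ σ w
    σ-cong e = shift-cong e (-‿cong (*-congʳ (P-congˡ e))) ≈ᴹ-refl

    σ-+ : ∀ u w → σ (u +ᴹ w) ≈ᴹ σ u +ᴹ σ w
    σ-+ u w = ≈ᴹ-trans (+ᴹ-congˡ (≈ᴹ-trans (*ₗ-congʳ α-+) (*ₗ-distribʳ d (α u) (α w)))) (+ᴹ-interchange u w _ _)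
      where
      α-+ : α (u +ᴹ w) ≈ α u + α w
      α-+ = trans (-‿cong (*-congʳ (P-+ʳ d u w))) (solve 3
        (λ x y k → :- ((x :+ y) :* k) := :- (x :* k) :+ :- (y :* k)) refl (P d u) (P d w) κ)

    σ-* : ∀ a u → σ (a *ₗ u) ≈ᴹ a *ₗ σ u
    σ-* a u = ≈ᴹ-trans (+ᴹ-congˡ (≈ᴹ-trans (*ₗ-congʳ α-*) (*ₗ-assoc a (α u) d))) (≈ᴹ-sym (*ₗ-distribˡ a u _))
      where
      α-* : α (a *ₗ u) ≈ a * α u
      α-* = trans (-‿cong (*-congʳ (P-*ʳ a d u))) (solve 3 (λ a x k → :- (a :* x :* k) := a :* (:- (x :* k))) refl a
        (P d u) κ)

    private
      P-d-σ : ∀ u → P d (σ u) ≈ - P d u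
      P-d-σ u = trans (P-shiftʳ d u (α u) d) (trans (+-congˡ (*-congˡ (P-diag d)))
        (from-diff (solve 3 (λ p k x → p :+ (:- (p :* k)) :* (x :+ x) :- (:- p) := (:- (p :+ p)) :*
          (k :* x :- con (+ 1))) refl (P d u) κ (Q d))
          (*-zero _ (diff-zero κQd≈1))))

    σ-involutive : ∀ u → σ (σ u) ≈ᴹ u
    σ-involutive u = shift-inverse u d (trans (+-congˡ (-‿cong (*-congʳ (P-d-σ u))))
      (solve 2 (λ p k → :- (p :* k) :+ :- ((:- p) :* k) := con (+ 0)) refl (P d u) κ))

    P-σ : ∀ u w → P (σ u) (σ w) ≈ P u w
    P-σ u w = begin
      P (u +[ α u ] d) (σ w)  ≈⟨ P-shiftˡ u (α u) d (σ w) ⟩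
      P u (w +[ α w ] d) + α u * P d (σ w)
        ≈⟨ +-cong (trans (P-shiftʳ u w (α w) d) (+-congˡ (*-congˡ (P-sym u d)))) (*-congˡ (P-d-σ w)) ⟩
      (P u w + α w * P d u) + α u * (- P d w)
        ≈⟨ solve 4 (λ x p r k → (x :+ (:- (r :* k)) :* p) :+ (:- (p :* k)) :* (:- r) := x) refl (P u w) (P d u)
          (P d w) κ ⟩
      P u w ∎

    Q-σ : ∀ u → Q (σ u) ≈ Q u
    Q-σ u = trans (Q-shift u (α u) d) (trans (+-congʳ (+-congˡ (*-congˡ (P-sym u d))))
      (from-diff (solve 4 (λ y p k x → y :+ (:- (p :* k)) :* p :+ (:- (p :* k)) :* (:- (p :* k)) :* x :- y :=
        (p :* p :* k) :* (k :* x :- con (+ 1))) refl (Q u) (P d u) κ (Q d))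
        (*-zero _ (diff-zero κQd≈1))))

    σ-fixes : ∀ {u} → P d u ≈ 0# → σ u ≈ᴹ u
    σ-fixes {u} p = ≈ᴹ-trans (shift-cong ≈ᴹ-refl (trans (-‿cong (trans (*-congʳ p) (zeroˡ κ))) -0#≈0#) ≈ᴹ-refl)
      (shift-0 u d)

    σ-Perp : ∀ xs {u} → Perp xs d → Perp xs u → Perp xs (σ u)
    σ-Perp xs Wd Wu = Perp-shift xs _ Wu Wd

    -- P(u - e w, u) = Q(u - e w), so σ subtracts exactly d from u.
    σ-swaps : ∀ {u w e} → e * e ≈ 1# → Q u ≈ Q w → d ≈ᴹ u +[ - e ] w → σ u ≈ᴹ e *ₗ w
    σ-swaps {u} {w} {e} ee≈1 Qu≈Qw d≈ = ≈ᴹ-trans (shift-cong ≈ᴹ-refl αu≈-1 d≈)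
      (≈ᴹ-trans (+ᴹ-congˡ (*ₗ-distribˡ (- 1#) u _)) (≈ᴹ-trans (≈ᴹ-sym (+ᴹ-assoc u _ _))
      (≈ᴹ-trans (+ᴹ-cong (u-u≈0 u)
        (≈ᴹ-trans (≈ᴹ-sym (*ₗ-assoc (- 1#) (- e) w)) (*ₗ-congʳ
          (solve 1 (λ e → (:- con (+ 1)) :* (:- e) := e) refl e)))) (+ᴹ-identityˡ _))))
      where
      Pdu : P d u ≈ Q u + Q u - e * P w u
      Pdu = trans (P-congʳ d≈) (trans (P-shiftˡ u (- e) w u)
        (trans (+-congʳ (P-diag u)) (+-congˡ (sym (-‿distribˡ-* e _)))))
      Qd : Q d ≈ Q u + Q u - e * P w u
      Qd = trans (Q-cong d≈) (trans (Q-shift u (- e) w)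
        (trans (+-cong (+-congˡ (*-congˡ (P-sym u w))) (*-congˡ (sym Qu≈Qw)))
        (from-diff (solve 3 (λ y e p → y :+ (:- e) :* p :+ (:- e) :* (:- e) :* y :- (y :+ y :- e :* p) := y :*
          (e :* e :- con (+ 1))) refl (Q u) e (P w u))
          (*-zero _ (diff-zero ee≈1)))))
      αu≈-1 : α u ≈ - 1#
      αu≈-1 = -‿cong (trans (*-congʳ (trans Pdu (sym Qd))) (trans (*-comm _ _) κQd≈1))

    N-σ : ∀ x f → N (x ∷ []) f ≡ N (σ x ∷ []) f
    N-σ x f = count-bij 𝓥 𝓥 (λ u → (Q u ≟ f) ×-dec perp? (x ∷ []) u) (λ u → (Q u ≟ f) ×-dec perp? (σ x ∷ []) u)
      (λ e (a , b) → trans (Q-cong (≈ᴹ-sym e)) a , Perp-resp (x ∷ []) e b)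
      (λ e (a , b) → trans (Q-cong (≈ᴹ-sym e)) a , Perp-resp (σ x ∷ []) e b)
      σ σ σ-cong σ-cong
      (λ { {u} (a , p ∷ []) → trans (Q-σ u) a , trans (P-σ x u) p ∷ [] })
      (λ { {u} (a , p ∷ []) → trans (Q-σ u) a , trans (P-cong (≈ᴹ-sym (σ-involutive x)) ≈ᴹ-refl)
        (trans (P-σ (σ x) u) p) ∷ [] })
      (λ _ → σ-involutive _) (λ _ → σ-involutive _)

  IsSign : Carrier → Set _
  IsSign e = e ≈ 1# ⊎ e ≈ - 1#

  sign-square : ∀ {e} → IsSign e → e * e ≈ 1#
  sign-square (inj₁ e≈1)  = trans (*-cong e≈1 e≈1) (*-identityˡ 1#)
  sign-square (inj₂ e≈-1) = trans (*-cong e≈-1 e≈-1) (solve 0 ((:- con (+ 1)) :* (:- con (+ 1)) := con (+ 1)) refl)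

module OddQuadratic
  {c ℓ v ℓv} {F : CommutativeRing c ℓ} (isField : IsField F) {q} (𝓕 : HasCardinality (CommutativeRing.setoid F) q)
  (V : Module F v ℓv) {nV} (𝓥 : HasCardinality (Module.≈ᴹ-setoid V) nV)
  (Q : Module.Carrierᴹ V → CommutativeRing.Carrier F) (isQ : IsQuadraticForm V Q)
  (2≉0 : ¬ (CommutativeRing._≈_ F (CommutativeRing._+_ F (CommutativeRing.1# F) (CommutativeRing.1# F))
    (CommutativeRing.0# F)))
  where
  open FiniteQuadratic isField 𝓕 V 𝓥 Q isQ
  open SetoidReasoning setoid

  x+x≉0 : ∀ {x} → ¬ x ≈ 0# → ¬ x + x ≈ 0#
  x+x≉0 {x} x≉0 e = x*y≉0 2≉0 x≉0 (trans (solve 1 (λ x → con (+ 2) :* x := x :+ x) refl x) e)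

  -- Q(u - w) + Q(u + w) = 4 Q u, so one of the two differences is nonsingular.
  nonsingular-difference : ∀ {u w} → Q u ≈ Q w → ¬ Q u ≈ 0# → ∃[ e ] IsSign e × ¬ Q (u +[ - e ] w) ≈ 0#
  nonsingular-difference {u} {w} Qu≈Qw Qu≉0 with Q (u +[ - 1# ] w) ≟ 0#
  ... | no Q≉0  = 1# , inj₁ refl , Q≉0
  ... | yes Q≈0 = - 1# , inj₂ refl , λ Q′≈0 → x+x≉0 (x+x≉0 Qu≉0) (begin
    (Q u + Q u) + (Q u + Q u)  ≈⟨ +-cong (+-congˡ Qu≈Qw) (+-congˡ Qu≈Qw) ⟩
    (Q u + Q w) + (Q u + Q w)
      ≈⟨ solve 3 (λ x y p → (x :+ y) :+ (x :+ y) := (x :+ (:- con (+ 1)) :* p :+ (:- con (+ 1)) :* (:- con (+ 1)) :* y)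
        :+
                                                                 (x :+ (:- (:- con (+ 1))) :* p :+
                                                                   (:- (:- con (+ 1))) :* (:- (:- con (+ 1))) :* y))
                                                                   refl (Q u) (Q w) (P u w) ⟩
    (Q u + - 1# * P u w + - 1# * - 1# * Q w) + (Q u + - (- 1#) * P u w + - (- 1#) * - (- 1#) * Q w)
      ≈⟨ +-cong (Q-shift u (- 1#) w) (Q-shift u (- - 1#) w) ⟨
    Q (u +[ - 1# ] w) + Q (u +[ - (- 1#) ] w)  ≈⟨ +-zero Q≈0 Q′≈0 ⟩
    0# ∎)

  N-isometric : ∀ {u w} → Q u ≈ Q w → ¬ Q u ≈ 0# → ∀ f → N (u ∷ []) f ≡ N (w ∷ []) f
  N-isometric {u} {w} Qu≈Qw Qu≉0 f with nonsingular-difference Qu≈Qw Qu≉0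
  ... | e , isSign , Qd≉0 = ≡.trans (N-σ u f) (count-cong 𝓥 (λ z → (Q z ≟ f) ×-dec perp? (σ u ∷ []) z)
    (λ z → (Q z ≟ f) ×-dec perp? (w ∷ []) z)
      (λ { z (a , p ∷ []) → a , x*y≈0 e≉0 (trans (sym (polar-*ₗ e w z)) (trans (P-congʳ (≈ᴹ-sym σu)) p)) ∷ [] })
      (λ { z (a , p ∷ []) → a , trans (P-congʳ σu) (trans (polar-*ₗ e w z) (*-zero e p)) ∷ [] }))
    where
    open Reflection (u +[ - e ] w) Qd≉0
    σu : σ u ≈ᴹ e *ₗ w
    σu = σ-swaps (sign-square isSign) Qu≈Qw ≈ᴹ-refl
    e≉0 : ¬ e ≈ 0#
    e≉0 e≈0 = 1≉0 (trans (sym (sign-square isSign)) (*-zero e e≈0))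

  slice? : ∀ xs w f s → Dec (P w s ≈ f × Q s ≈ 0# × Perp xs s)
  slice? xs w f s = (P w s ≟ f) ×-dec ((Q s ≟ 0#) ×-dec perp? xs s)

  slice-resp : ∀ xs {w f s s′} → s ≈ᴹ s′ → P w s ≈ f × Q s ≈ 0# × Perp xs s → P w s′ ≈ f × Q s′ ≈ 0# × Perp xs s′
  slice-resp xs e (a , b , d) = trans (P-congˡ (≈ᴹ-sym e)) a , trans (Q-cong (≈ᴹ-sym e)) b , Perp-resp xs e d

  slice-isometric : ∀ xs {w w′ f} → Perp xs w → Perp xs w′ → Q w ≈ Q w′ → ¬ Q w ≈ 0# →
                    count 𝓥 (slice? xs w f) ≡ count 𝓥 (slice? xs w′ f)
  slice-isometric xs {w} {w′} {f} Ww Ww′ Qw≈Qw′ Qw≉0 with nonsingular-difference Qw≈Qw′ Qw≉0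
  ... | e , isSign , Qd≉0 = count-bij 𝓥 𝓥 (slice? xs w f) (slice? xs w′ f) (slice-resp xs) (slice-resp xs)
      (λ s → e *ₗ σ s) (λ s → e *ₗ σ s) (λ p → *ₗ-congˡ (σ-cong p)) (λ p → *ₗ-congˡ (σ-cong p))
      (λ {s} (a , b , p) → (begin
        P w′ (e *ₗ σ s)  ≈⟨ trans (P-*ʳ e w′ (σ s)) (sym (polar-*ₗ e w′ (σ s))) ⟩
        P (e *ₗ w′) (σ s)  ≈⟨ P-congʳ σw ⟨
        P (σ w) (σ s)  ≈⟨ P-σ w s ⟩
        P w s  ≈⟨ a ⟩
        f ∎) , Q-eσ b , Perp-* xs e (σ-Perp xs Wd p))
      (λ {s} (a , b , p) → (begin
        P w (e *ₗ σ s)  ≈⟨ P-congʳ (σ-involutive w) ⟨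
        P (σ (σ w)) (e *ₗ σ s)  ≈⟨ P-cong (σ-cong (≈ᴹ-sym σw)) (σ-* e s) ⟨
        P (σ (e *ₗ w′)) (σ (e *ₗ s))  ≈⟨ P-σ (e *ₗ w′) (e *ₗ s) ⟩
        P (e *ₗ w′) (e *ₗ s)  ≈⟨ trans (polar-*ₗ e w′ _) (*-congˡ (P-*ʳ e w′ s)) ⟩
        e * (e * P w′ s)  ≈⟨ trans (sym (*-assoc e e _)) (trans (*-congʳ ee≈1) (*-identityˡ _)) ⟩
        P w′ s  ≈⟨ a ⟩
        f ∎) , Q-eσ b , Perp-* xs e (σ-Perp xs Wd p))
      (λ {s} _ → eσeσ s) (λ {s} _ → eσeσ s)
    where
    d = w +[ - e ] w′
    open Reflection d Qd≉0
    ee≈1 = sign-square isSign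
    Wd : Perp xs d
    Wd = Perp-shift xs _ Ww Ww′
    σw : σ w ≈ᴹ e *ₗ w′
    σw = σ-swaps ee≈1 Qw≈Qw′ ≈ᴹ-refl
    Q-eσ : ∀ {s} → Q s ≈ 0# → Q (e *ₗ σ s) ≈ 0#
    Q-eσ {s} b = trans (Q-*ₗ e (σ s)) (*-zero _ (trans (Q-σ s) b))
    eσeσ : ∀ s → e *ₗ σ (e *ₗ σ s) ≈ᴹ s
    eσeσ s = ≈ᴹ-trans (*ₗ-congˡ (≈ᴹ-trans (σ-* e (σ s)) (*ₗ-congˡ (σ-involutive s)))) (*ₗ-inverse ee≈1 s)

  -- Double count of the pairs (u , s) with u of norm g, s singular and P(u,s) = f, all in the subspace.
  slice-count : ∀ xs → NonDeg xs → ∀ {w g f} → Perp xs w → Q w ≈ g → ¬ g ≈ 0# → ¬ f ≈ 0# →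
                q ℕ.* (q ℕ.* (N xs g ℕ.* count 𝓥 (slice? xs w f))) ℕ.+ M xs ≡ N xs 0# ℕ.* M xs
  slice-count xs nd {w} {g} {f} Ww Qw≈g g≉0 f≉0 = ≡.trans (≡.cong (λ k → q ℕ.* (q ℕ.* k) ℕ.+ M xs) double) weighted
    where
    sphere? : ∀ u → Dec (Q u ≈ g × Perp xs u)
    sphere? u = (Q u ≟ g) ×-dec perp? xs u
    cone? : ∀ s → Dec (Q s ≈ 0# × Perp xs s)
    cone? s = (Q s ≟ 0#) ×-dec perp? xs s
    opposite? : ∀ s u → Dec (Q u ≈ g × P s u ≈ f × Perp xs u)
    opposite? s u = (Q u ≟ g) ×-dec ((P s u ≟ f) ×-dec perp? xs u)
    n = count 𝓥 (slice? xs w f)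
    double : N xs g ℕ.* n ≡ ∑ 𝓥 (λ s → 𝟙 (cone? s) ℕ.* count 𝓥 (opposite? s))
    double = begin′
      where
      constant : ∀ u (d : Dec (Q u ≈ g × Perp xs u)) → 𝟙 d ℕ.* n ≡ 𝟙 d ℕ.* count 𝓥 (slice? xs u f)
      constant u (no _)          = ≡.refl
      constant u (yes (Qu , Wu)) = ≡.cong (1 ℕ.*_) (slice-isometric xs Ww Wu (trans Qw≈g (sym Qu))
        (λ p → g≉0 (trans (sym Qw≈g) p)))
      regroup : ∀ u s → 𝟙 (sphere? u) ℕ.* 𝟙 (slice? xs u f s) ≡ 𝟙 (cone? s) ℕ.* 𝟙 (opposite? s u)
      regroup u s = ≡.trans (≡.sym (𝟙-× (sphere? u) (slice? xs u f s))) (≡.trans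
        (𝟙-cong (sphere? u ×-dec slice? xs u f s) (cone? s ×-dec opposite? s u)
          (λ ((a , b) , p , k) → k , a , trans (P-sym s u) p , b)
            (λ (k , a , p , b) → (a , b) , trans (P-sym u s) p , k))
        (𝟙-× (cone? s) (opposite? s u)))
      begin′ : N xs g ℕ.* n ≡ ∑ 𝓥 (λ s → 𝟙 (cone? s) ℕ.* count 𝓥 (opposite? s))
      begin′ = ≡.trans (≡.sym (∑-*ʳ 𝓥 n _)) (≡.trans (∑-cong 𝓥
        (λ u → ≡.trans (constant u (sphere? u)) (≡.sym (∑-*ˡ 𝓥 (𝟙 (sphere? u)) _))))
        (≡.trans (∑-swap 𝓥 𝓥 (λ u s → 𝟙 (sphere? u) ℕ.* 𝟙 (slice? xs u f s)))
        (∑-cong 𝓥 (λ s → ≡.trans (∑-cong 𝓥 (λ u → regroup u s)) (∑-*ˡ 𝓥 (𝟙 (cone? s)) _)))))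
    pointwise : ∀ s (d : Dec (Q s ≈ 0# × Perp xs s)) → q ℕ.* (q ℕ.* (𝟙 d ℕ.* count 𝓥 (opposite? s))) ℕ.+ 𝟙
      (s ≟ᴹ 0ᴹ) ℕ.* M xs ≡ 𝟙 d ℕ.* M xs
    pointwise s (no ¬cone) = ≡.trans (≡.cong₂ ℕ._+_ (≡.trans (≡.cong (q ℕ.*_) (ℕₚ.*-zeroʳ q)) (ℕₚ.*-zeroʳ q))
      (≡.cong (ℕ._* M xs) (𝟙-no (s ≟ᴹ 0ᴹ) (λ s≈0 → ¬cone
        (trans (Q-cong s≈0) Q-0 , Perp-resp xs (≈ᴹ-sym s≈0) (Perp-0 xs)))))) ≡.refl
    pointwise s (yes (Qs≈0 , Ws)) with s ≟ᴹ 0ᴹ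
    ... | yes s≈0 = ≡.trans (≡.cong (λ k → q ℕ.* (q ℕ.* (1 ℕ.* k)) ℕ.+ 1 ℕ.* M xs)
            (count-empty 𝓥 (opposite? s) (λ u (_ , p , _) → f≉0 (trans (sym p) (trans (P-congʳ s≈0) (P-0ˡ u))))))
            (≡.cong (ℕ._+ 1 ℕ.* M xs) (≡.trans (≡.cong (q ℕ.*_) (ℕₚ.*-zeroʳ q)) (ℕₚ.*-zeroʳ q)))
    ... | no s≉0 = ≡.trans (ℕₚ.+-identityʳ _) (≡.trans (≡.cong (λ k → q ℕ.* (q ℕ.* k)) (ℕₚ.*-identityˡ _)) (≡.trans
            (≡.sym (≡.trans (perp-slice xs Wr Psr≉0 f) (≡.cong (q ℕ.*_) (Q-slice xs Ws Qs≈0 f≉0 g))))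
              (≡.sym (ℕₚ.*-identityˡ (M xs)))))
      where
      partner = nonorthogonal xs nd Ws s≉0
      Wr = proj₁ (proj₂ partner)
      Psr≉0 = proj₂ (proj₂ partner)
    weighted : q ℕ.* (q ℕ.* ∑ 𝓥 (λ s → 𝟙 (cone? s) ℕ.* count 𝓥 (opposite? s))) ℕ.+ M xs ≡ N xs 0# ℕ.* M xs
    weighted = ≡.trans (≡.cong₂ ℕ._+_
        (≡.trans (≡.cong (q ℕ.*_) (≡.sym (∑-*ˡ 𝓥 q _))) (≡.sym (∑-*ˡ 𝓥 q _)))
        (≡.trans (≡.sym (ℕₚ.*-identityˡ (M xs))) (≡.trans
          (≡.cong (ℕ._* M xs) (≡.sym (count-unique 𝓥 (λ u → u ≟ᴹ 0ᴹ) (λ e f → ≈ᴹ-trans (≈ᴹ-sym e) f) 0ᴹ ≈ᴹ-refl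
          (λ _ e → e))))
          (≡.sym (∑-*ʳ 𝓥 (M xs) _)))))
      (≡.trans (≡.sym (∑-+ 𝓥 _ _)) (≡.trans (∑-cong 𝓥 (λ s → pointwise s (cone? s))) (∑-*ʳ 𝓥 (M xs) _)))

  module _ (xs : List Carrierᴹ) {s t} (Ws : Perp xs s) (Wt : Perp xs t) (Qs≈0 : Q s ≈ 0#) (Qt≈0 : Q t ≈ 0#)
    (h≉0 : ¬ P s t ≈ 0#)
           {i : Carrier} (i≉0 : ¬ i ≈ 0#) {ζ A : ℕ} (N-0 : N xs 0# ≡ ζ) (N-≉0 : ∀ g → ¬ g ≈ 0# → N xs g ≡ A) where
    open Split xs Ws Wt Qs≈0 Qt≈0 h≉0

    Grid : Carrierᴹ → Set _
    Grid r = (P t r ≈ 0# ⊎ P t r ≈ i) × (P s r ≈ 0# ⊎ P s r ≈ i) × Q r ≈ 0# × Perp xs r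

    grid? : ∀ r → Dec (Grid r)
    grid? r = ((P t r ≟ 0#) ⊎-dec (P t r ≟ i)) ×-dec (((P s r ≟ 0#) ⊎-dec (P s r ≟ i)) ×-dec
      ((Q r ≟ 0#) ×-dec perp? xs r))

    grid-count : q ℕ.* (q ℕ.* (q ℕ.* count 𝓥 grid?)) ℕ.+ 4 ℕ.* (q ℕ.* M xs) ≡ q ℕ.*
      (q ℕ.* (3 ℕ.* ζ ℕ.+ A)) ℕ.+ 4 ℕ.* M xs
    grid-count = combine grid-split
      (≡.trans (≡.cong (ℕ._+ M xs′) (≡.sym N-0)) (N-split 0#))
        (≡.trans (≡.cong (ℕ._+ M xs′) (≡.sym (N-≉0 g g≉0))) (N-split g)) M-split
      where
      xs′ : List Carrierᴹ
      xs′ = s ∷ t ∷ xs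
      κ = recip (P s t) h≉0
      g = 0# - i * (i * κ)
      g≉0 : ¬ g ≈ 0#
      g≉0 p = x*y≉0 i≉0 (x*y≉0 i≉0 (recip≉0 _ h≉0)) (trans
        (solve 2 (λ i k → i :* (i :* k) := :- (con (+ 0) :- i :* (i :* k))) refl i κ) (trans (-‿cong p) -0#≈0#))
      zero-product : ∀ {a b} → a ≈ 0# ⊎ b ≈ 0# → 0# - a * (b * κ) ≈ 0#
      zero-product {a} {b} (inj₁ p) = trans (+-congˡ (-‿cong (trans (*-congʳ p) (zeroˡ _))))
        (solve 0 (con (+ 0) :- con (+ 0) := con (+ 0)) refl)
      zero-product {a} {b} (inj₂ p) = trans (+-congˡ (-‿cong (*-zero a (trans (*-congʳ p) (zeroˡ _)))))
        (solve 0 (con (+ 0) :- con (+ 0) := con (+ 0)) refl)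
      row? : ∀ b r → Dec (P t r ≈ b × (P s r ≈ 0# ⊎ P s r ≈ i) × Q r ≈ 0# × Perp xs r)
      row? b r = (P t r ≟ b) ×-dec (((P s r ≟ 0#) ⊎-dec (P s r ≟ i)) ×-dec ((Q r ≟ 0#) ×-dec perp? xs r))
      row-split : ∀ b → count 𝓥 (row? b) ≡ N xs′ (0# - 0# * (b * κ)) ℕ.+ N xs′ (0# - i * (b * κ))
      row-split b = ≡.trans (count-⊎ 𝓥 (row? b) (coordinates? 0# 0# b) (coordinates? 0# i b)
        (λ { (p , inj₁ k , l) → inj₁ (p , k , l) ; (p , inj₂ k , l) → inj₂ (p , k , l) })
        (λ (p , k , l) → p , inj₁ k , l) (λ (p , k , l) → p , inj₂ k , l)
          (λ (_ , k , _) (_ , k′ , _) → i≉0 (trans (sym k′) k)))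
        (≡.cong₂ ℕ._+_ (count-coordinates 0# 0# b) (count-coordinates 0# i b))
      grid-split : count 𝓥 grid? ≡ (N xs′ 0# ℕ.+ N xs′ 0#) ℕ.+ (N xs′ 0# ℕ.+ N xs′ g)
      grid-split = ≡.trans (count-⊎ 𝓥 grid? (row? 0#) (row? i)
        (λ { (inj₁ p , k) → inj₁ (p , k) ; (inj₂ p , k) → inj₂ (p , k) })
        (λ (p , k) → inj₁ p , k) (λ (p , k) → inj₂ p , k) (λ (p , _) (p′ , _) → i≉0 (trans (sym p′) p)))
        (≡.cong₂ ℕ._+_ (≡.trans (row-split 0#) (≡.cong₂ ℕ._+_ (N-cong xs′ (zero-product (inj₁ refl)))
          (N-cong xs′ (zero-product (inj₂ refl)))))
          (≡.trans (row-split i) (≡.cong (ℕ._+ N xs′ g) (N-cong xs′ (zero-product (inj₁ refl))))))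
      combine : ∀ {k n₀ n₁ m M′} → k ≡ (n₀ ℕ.+ n₀) ℕ.+ (n₀ ℕ.+ n₁) → ζ ℕ.+ m ≡ q ℕ.* n₀ ℕ.+ q ℕ.* m →
        A ℕ.+ m ≡ q ℕ.* n₁ ℕ.+ q ℕ.* m →
                M′ ≡ q ℕ.* (q ℕ.* m) → q ℕ.* (q ℕ.* (q ℕ.* k)) ℕ.+ 4 ℕ.* (q ℕ.* M′) ≡ q ℕ.*
                  (q ℕ.* (3 ℕ.* ζ ℕ.+ A)) ℕ.+ 4 ℕ.* M′
      combine {_} {n₀} {n₁} {m} ≡.refl e₀ e₁ ≡.refl = ≡.trans
        (S.solve 4 (λ q n₀ n₁ m → q S.:* (q S.:* (q S.:* ((n₀ S.:+ n₀) S.:+ (n₀ S.:+ n₁)))) S.:+ S.con 4 S.:*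
          (q S.:* (q S.:* (q S.:* m)))
           S.:= q S.:* (q S.:* (S.con 3 S.:* (q S.:* n₀ S.:+ q S.:* m) S.:+ (q S.:* n₁ S.:+ q S.:* m)))) ≡.refl q n₀ n₁
             m)
        (≡.trans (≡.cong₂ (λ x y → q ℕ.* (q ℕ.* (3 ℕ.* x ℕ.+ y))) (≡.sym e₀) (≡.sym e₁))
        (S.solve 4 (λ q z a m → q S.:* (q S.:* (S.con 3 S.:* (z S.:+ m) S.:+ (a S.:+ m))) S.:= q S.:*
          (q S.:* (S.con 3 S.:* z S.:+ a)) S.:+ S.con 4 S.:* (q S.:* (q S.:* m))) ≡.refl q ζ A m))
        where module S = +-*-Solver

  private
    Puu≉0 : ∀ {u} → ¬ Q u ≈ 0# → ¬ P u u ≈ 0#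
    Puu≉0 {u} Qu≉0 p = x+x≉0 Qu≉0 (trans (sym (P-diag u)) p)

  M-hyperplane : ∀ {m u} → nV ≡ q ^ (2 ℕ.* m ℕ.+ 1) → ¬ Q u ≈ 0# → M (u ∷ []) ≡ q ^ m ℕ.* q ^ m
  M-hyperplane {m} {u} nV≡ Qu≉0 = ℕₚ.*-cancelˡ-≡ _ _ q (≡.trans (≡.sym (M-∷ [] {u} {u} [] (Puu≉0 Qu≉0)))
    (≡.trans (count-all 𝓥 (perp? []) (λ _ → [])) (≡.trans nV≡ (≡.trans (≡.cong (q ^_) (ℕₚ.+-comm (2 ℕ.* m) 1))
      (≡.cong (q ℕ.*_) (≡.trans (≡.cong (λ k → q ^ (m ℕ.+ k)) (ℕₚ.+-identityʳ m)) (ℕₚ.^-distribˡ-+-* q m m)))))))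

  private
    NonDeg-⊥ : ∀ {u} → NondegenerateOn V Q (_⊥ V Q u) → NonDeg (u ∷ [])
    NonDeg-⊥ nd w (p ∷ []) orth = nd w p (λ y r → orth y (r ∷ []))

    TSB-⊥ : ∀ {u k} {b : Fin k → Carrierᴹ} → TotallySingularBasis V Q (_⊥ V Q u) b → TSB (u ∷ []) b
    TSB-⊥ (ind , sp , sing) = ind , (λ w∈ → sp w∈ ∷ []) , sing

    TSB-⊥⁻¹ : ∀ {u k} {b : Fin k → Carrierᴹ} → TSB (u ∷ []) b → TotallySingularBasis V Q (_⊥ V Q u) b
    TSB-⊥⁻¹ (ind , sp , sing) = ind , (λ w∈ → All.head (sp w∈)) , sing

  type⇒numeric : ∀ {m} ε {p : Point V} → nV ≡ q ^ (2 ℕ.* m ℕ.+ 1) → ¬ Q (vector p) ≈ 0# → HasType V Q m ε p →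
    NumericType ε m (vector p ∷ [])
  type⇒numeric {m} Sign.+ {p} nV≡ Qp≉0 h = hyperbolic-count m (vector p ∷ []) (NonDeg-⊥ nondegenerate)
    (M-hyperplane {m} nV≡ Qp≉0)
      (proj₁ (proj₁ wittIndex)) (TSB-⊥ (proj₂ (proj₁ wittIndex)))
    where open Hyperbolic h
  type⇒numeric {m} Sign.- {p} nV≡ Qp≉0 h = elliptic wittIndex
    where
    open Elliptic h
    elliptic : (∃[ k ] suc k ≡ m × HasWittIndex V Q (_⊥ V Q (vector p)) k) → NumericType Sign.- m (vector p ∷ [])
    elliptic (k , ≡.refl , (b , tsb) , maximal) = elliptic-count 2≉0 k (vector p ∷ []) (NonDeg-⊥ nondegenerate)
      (M-hyperplane {m} nV≡ Qp≉0)
      b (TSB-⊥ tsb) (λ d tsb′ → ℕₚ.<-irrefl ≡.refl (maximal (suc k) d (TSB-⊥⁻¹ {b = d} tsb′)))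

  module Numeric {ε : Sign} {m : ℕ} where

    N-constant : ∀ {xs} → NumericType ε m xs → ∀ {f g} → ¬ f ≈ 0# → ¬ g ≈ 0# → N xs f ≡ N xs g
    N-constant t {f} {g} f≉0 g≉0 = helper ε t
      where
      helper : ∀ ε {xs} → NumericType ε m xs → N xs f ≡ N xs g
      helper Sign.+ t = ℕₚ.+-cancelʳ-≡ (q ^ m) _ _ (≡.trans (≡.sym (t f f≉0)) (t g g≉0))
      helper Sign.- t = ≡.trans (t f f≉0) (≡.sym (t g g≉0))

    M-N : ∀ {xs} → NumericType ε m xs → M xs ℕ.+ N xs 1# ≡ N xs 0# ℕ.+ q ℕ.* N xs 1#
    M-N {xs} t = ≡.trans (≡.cong (ℕ._+ N xs 1#) (≡.sym (∑-N xs)))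
      (∑-const-but 𝓕 (N xs 1#) 0# (N-cong xs) (λ f f≉0 → N-constant {xs} t f≉0 1≉0))

    N-1-unique : ∀ {xs ys} → M xs ≡ M ys → NumericType ε m xs → NumericType ε m ys → N xs 1# ≡ N ys 1#
    N-1-unique {xs} {ys} eq t t′ = helper ε t t′ (M-N {xs} t) (M-N {ys} t′)
      where
      helper : ∀ ε → NumericType ε m xs → NumericType ε m ys → M xs ℕ.+ N xs 1# ≡ N xs 0# ℕ.+ q ℕ.* N xs 1# →
        M ys ℕ.+ N ys 1# ≡ N ys 0# ℕ.+ q ℕ.* N ys 1# → N xs 1# ≡ N ys 1#
      helper Sign.+ t t′ e e′ = ℕₚ.*-cancelˡ-≡ _ _ q (ℕₚ.+-cancelˡ-≡ (q ^ m) _ _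
        (≡.trans (≡.sym (solved e (t 1# 1≉0))) (≡.trans eq (solved e′ (t′ 1# 1≉0)))))
        where
        solved : ∀ {M z a} → M ℕ.+ a ≡ z ℕ.+ q ℕ.* a → z ≡ a ℕ.+ q ^ m → M ≡ q ^ m ℕ.+ q ℕ.* a
        solved {M} {z} {a} e ≡.refl = ℕₚ.+-cancelʳ-≡ a _ _
          (≡.trans e (S.solve 3 (λ a x y → a S.:+ x S.:+ y S.:= x S.:+ y S.:+ a) ≡.refl a (q ^ m) (q ℕ.* a)))
          where module S = +-*-Solver
      helper Sign.- t t′ e e′ = ℕₚ.*-cancelˡ-≡ _ _ q (≡.trans (≡.sym (solved e (t 1# 1≉0)))
        (≡.trans (≡.cong (ℕ._+ q ^ m) eq) (solved e′ (t′ 1# 1≉0))))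
        where
        solved : ∀ {M z a} → M ℕ.+ a ≡ z ℕ.+ q ℕ.* a → a ≡ z ℕ.+ q ^ m → M ℕ.+ q ^ m ≡ q ℕ.* a
        solved {M} {z} e ≡.refl = ℕₚ.+-cancelʳ-≡ z _ _
          (≡.trans (S.solve 3 (λ M x z → M S.:+ x S.:+ z S.:= M S.:+ (z S.:+ x)) ≡.refl M (q ^ m) z)
          (≡.trans e (ℕₚ.+-comm z _)))
          where module S = +-*-Solver

  sphere : ∀ u → ¬ Q u ≈ 0# → ∀ g → count 𝓥 (λ w → Q w ≟ g) ≡ ∑ 𝓕 (λ τ → N (u ∷ []) (g - τ * τ * Q u))
  sphere u Qu≉0 g = ≡.trans (count-fibre 𝓥 𝓕 (λ w → P u w * κ) (λ w → Q w ≟ g)) (∑-cong 𝓕 fibre)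
    where
    κ = recip (P u u) (Puu≉0 Qu≉0)
    κPuu≈1 : κ * P u u ≈ 1#
    κPuu≈1 = recip-inverse (P u u) (Puu≉0 Qu≉0)
    fibre? : ∀ τ w → Dec (P u w * κ ≈ τ × Q w ≈ g)
    fibre? τ w = decEq 𝓕 (P u w * κ) τ ×-dec (Q w ≟ g)
    fibre : ∀ τ → count 𝓥 (fibre? τ) ≡ N (u ∷ []) (g - τ * τ * Q u)
    fibre τ = count-bij 𝓥 𝓥 (fibre? τ) (λ w → (Q w ≟ g - τ * τ * Q u) ×-dec perp? (u ∷ []) w)
      (λ e (p , r) → trans (*-congʳ (P-congˡ (≈ᴹ-sym e))) p , trans (Q-cong (≈ᴹ-sym e)) r)
      (λ e (p , r) → trans (Q-cong (≈ᴹ-sym e)) p , Perp-resp (u ∷ []) e r)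
      (λ w → w +[ - τ ] u) (λ w → w +[ τ ] u) (λ e → shift-cong e refl ≈ᴹ-refl) (λ e → shift-cong e refl ≈ᴹ-refl)
      to back (λ _ → shift-inverse _ u (-‿inverseˡ τ)) (λ _ → shift-inverse _ u (-‿inverseʳ τ))
      where
      to : ∀ {w} → P u w * κ ≈ τ × Q w ≈ g → Q (w +[ - τ ] u) ≈ g - τ * τ * Q u × Perp (u ∷ []) (w +[ - τ ] u)
      to {w} (p , r) = Qw , trans (P-shiftʳ u w (- τ) u)
        (trans (+-congʳ Puw) (solve 2 (λ t x → t :* x :+ (:- t) :* x := con (+ 0)) refl τ (P u u))) ∷ []
        where
        Puw : P u w ≈ τ * P u u
        Puw = trans (from-diff (solve 3 (λ x k y → x :- x :* k :* y := (:- x) :* (k :* y :- con (+ 1))) refl (P u w) κ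
          (P u u)) (*-zero _ (diff-zero κPuu≈1))) (*-congʳ p)
        Qw : Q (w +[ - τ ] u) ≈ g - τ * τ * Q u
        Qw = trans (Q-shift w (- τ) u) (trans (+-congʳ
          (+-cong r (*-congˡ (trans (P-sym w u) (trans Puw (*-congˡ (P-diag u)))))))
          (solve 3 (λ g t x → g :+ (:- t) :* (t :* (x :+ x)) :+ (:- t) :* (:- t) :* x := g :- t :* t :* x) refl g τ
            (Q u)))
      back : ∀ {w} → Q w ≈ g - τ * τ * Q u × Perp (u ∷ []) w → P u (w +[ τ ] u) * κ ≈ τ × Q (w +[ τ ] u) ≈ g
      back {w} (r , p ∷ []) = trans (*-congʳ (trans (P-shiftʳ u w τ u) (+-congʳ p)))
          (from-diff (solve 3 (λ t x k → (con (+ 0) :+ t :* x) :* k :- t := t :* (k :* x :- con (+ 1))) refl τ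
            (P u u) κ) (*-zero _ (diff-zero κPuu≈1))) ,
        trans (Q-shift w τ u) (trans (+-congʳ (+-cong r (*-congˡ (trans (P-sym w u) p))))
          (solve 3 (λ g t x → g :- t :* t :* x :+ t :* con (+ 0) :+ t :* t :* x := g) refl g τ (Q u)))

  -- If Q w / Q u were not a square, then counting the vectors of norm Q w through u⊥ and through w⊥
  -- would give q N and q N ± 2 q ^ m, respectively.
  same-class : ∀ {ε m u w} → ¬ Q u ≈ 0# → ¬ Q w ≈ 0# → M (u ∷ []) ≡ M (w ∷ []) →
               NumericType ε m (u ∷ []) → NumericType ε m (w ∷ []) → ∃[ τ ] Q w ≈ τ * τ * Q u
  same-class {ε} {m} {u} {w} Qu≉0 Qw≉0 M≡ tu tw = search
    (any? 𝓕 (λ e p → trans p (*-congʳ (*-cong e e))) (λ τ → Q w ≟ τ * τ * Q u))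
    where
    open Numeric {ε} {m}
    a : ℕ
    a = N (u ∷ []) 1#
    through-w : Carrier → ℕ
    through-w τ = N (w ∷ []) (Q w - τ * τ * Q w)
    through-w-cong : ∀ {τ τ′} → τ ≈ τ′ → through-w τ ≡ through-w τ′
    through-w-cong e = N-cong (w ∷ []) (+-congˡ (-‿cong (*-congʳ (*-cong e e))))
    through-w-1 : through-w 1# ≡ N (w ∷ []) 0#
    through-w-1 = N-cong (w ∷ []) (solve 1 (λ x → x :- con (+ 1) :* con (+ 1) :* x := con (+ 0)) refl (Q w))
    generic : ∀ f → ¬ f ≈ 0# → N (w ∷ []) f ≡ a
    generic f f≉0 = ≡.trans (N-constant {w ∷ []} tw f≉0 1≉0) (≡.sym (N-1-unique {u ∷ []} {w ∷ []} M≡ tu tw))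
    module _ (none : ¬ (∃[ τ ] Q w ≈ τ * τ * Q u)) where
      equal-sums : ∑ 𝓕 (λ _ → a) ≡ ∑ 𝓕 through-w
      equal-sums = ≡.trans (∑-cong 𝓕 (λ τ → ≡.sym (N-constant {u ∷ []} tu {Q w - τ * τ * Q u}
        (λ p → none (τ , x∙y⁻¹≈ε⇒x≈y _ _ p)) 1≉0)))
        (≡.trans (≡.sym (sphere u Qu≉0 (Q w))) (sphere w Qw≉0 (Q w)))
      impossible : ∀ ε → NumericType ε m (w ∷ []) → a ≡ N (w ∷ []) 0#
      impossible Sign.+ t = ≡.trans (∑-mono-≡ 𝓕 (λ _ → ≡.refl) through-w-cong
        (λ τ → bound τ (Q w - τ * τ * Q w ≟ 0#)) equal-sums 1#) through-w-1
        where
        bound : ∀ τ → Dec (Q w - τ * τ * Q w ≈ 0#) → a ≤ through-w τ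
        bound τ (yes p) = ≡.subst₂ _≤_ (generic 1# 1≉0) (≡.trans (≡.sym (t 1# 1≉0)) (≡.sym (N-cong (w ∷ []) p)))
          (ℕₚ.m≤m+n (N (w ∷ []) 1#) (q ^ m))
        bound τ (no p)  = ℕₚ.≤-reflexive (≡.sym (generic _ p))
      impossible Sign.- t = ≡.sym (≡.trans (≡.sym through-w-1)
        (∑-mono-≡ 𝓕 through-w-cong (λ _ → ≡.refl) (λ τ → bound τ (Q w - τ * τ * Q w ≟ 0#)) (≡.sym equal-sums) 1#))
        where
        bound : ∀ τ → Dec (Q w - τ * τ * Q w ≈ 0#) → through-w τ ≤ a
        bound τ (yes p) = ≡.subst₂ _≤_ (≡.sym (N-cong (w ∷ []) p)) (≡.trans (≡.sym (t 1# 1≉0)) (generic 1# 1≉0))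
          (ℕₚ.m≤m+n (N (w ∷ []) 0#) (q ^ m))
        bound τ (no p)  = ℕₚ.≤-reflexive (generic _ p)
      grows : ∀ {k} → k ℕ.+ q ^ m ≢ k
      grows {k} e = ℕ.≢-nonZero⁻¹ (q ^ m) ⦃ ℕₚ.m^n≢0 q m ⦄ (ℕₚ.+-cancelˡ-≡ k _ _ (≡.trans e (≡.sym (ℕₚ.+-identityʳ k))))
      absurd : ∀ ε → NumericType ε m (w ∷ []) → a ≢ N (w ∷ []) 0#
      absurd Sign.+ t e = grows (≡.trans (≡.sym (t 1# 1≉0)) (≡.trans (≡.sym e) (≡.sym (generic 1# 1≉0))))
      absurd Sign.- t e = grows (≡.trans (≡.sym (t 1# 1≉0)) (≡.trans (generic 1# 1≉0) e))
    search : Dec (∃[ τ ] Q w ≈ τ * τ * Q u) → ∃[ τ ] Q w ≈ τ * τ * Q u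
    search (yes found) = found
    search (no none)   = contradiction (impossible none ε tw) (absurd none ε tw)

  module Transport {r r′} {W : Pred Carrierᴹ r} {W′ : Pred Carrierᴹ r′}
    (W-resp : ∀ {u w} → u ≈ᴹ w → W u → W w) (W′-resp : ∀ {u w} → u ≈ᴹ w → W′ u → W′ w)
    (d : Carrierᴹ) (Qd≉0 : ¬ Q d ≈ 0#) where
    private
      open module R = Reflection d Qd≉0

      σ-0 : σ 0ᴹ ≈ᴹ 0ᴹ
      σ-0 = σ-fixes (P-0ʳ d)

      σ-LC : ∀ {n} (a : Fin n → Carrier) (b : Fin n → Carrierᴹ) → LC a (σ ∘ b) ≈ᴹ σ (LC a b)
      σ-LC {zero}  a b = ≈ᴹ-sym σ-0
      σ-LC {suc n} a b = ≈ᴹ-trans (+ᴹ-cong (≈ᴹ-sym (σ-* (a zero) (b zero))) (σ-LC (a ∘ suc) (b ∘ suc)))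
        (≈ᴹ-sym (σ-+ _ _))

      σ-independent : ∀ {n} {b : Fin n → Carrierᴹ} → LinearlyIndependent V b → LinearlyIndependent V (σ ∘ b)
      σ-independent {b = b} independent a e = independent a
        (≈ᴹ-trans (≈ᴹ-sym (σ-involutive _)) (≈ᴹ-trans (σ-cong (≈ᴹ-trans (≈ᴹ-sym (σ-LC a b)) e)) σ-0))

      σ-span : ∀ {n} (b : Fin n → Carrierᴹ) {w} → w ∈ span V (σ ∘ b) → σ w ∈ span V b
      σ-span b (a , w≈) = a , ≈ᴹ-trans (σ-cong (≈ᴹ-trans w≈ (σ-LC a b))) (σ-involutive _)

    module _ (into : ∀ {u} → W u → W′ (σ u)) (onto : ∀ {u} → W′ u → W (σ u)) where

      transport-dimension : ∀ {n} → HasDimension V W n → HasDimension V W′ n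
      transport-dimension (b , independent , sp⊆W , W⊆sp) = σ ∘ b , σ-independent independent ,
        (λ w∈ → W′-resp (σ-involutive _) (into (sp⊆W (σ-span b w∈)))) ,
        (λ {w} W′w → let a , σw≈ = W⊆sp (onto W′w) in a , ≈ᴹ-trans (≈ᴹ-sym (σ-involutive w)) (≈ᴹ-trans (σ-cong σw≈) (≈ᴹ-sym (σ-LC a b))))

      transport-nondegenerate : NondegenerateOn V Q W → NondegenerateOn V Q W′
      transport-nondegenerate nd u W′u orth = ≈ᴹ-trans (≈ᴹ-sym (σ-involutive u)) (≈ᴹ-trans (σ-cong (nd (σ u) (onto W′u)
        (λ w Ww → trans (P-congˡ (≈ᴹ-sym (σ-involutive w))) (trans (P-σ u (σ w)) (orth (σ w) (into Ww)))))) σ-0)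

      transport-basis : ∀ {k} {b : Fin k → Carrierᴹ} → TotallySingularBasis V Q W b → TotallySingularBasis V Q W′
        (σ ∘ b)
      transport-basis {b = b} (independent , sp⊆W , singular) = σ-independent independent ,
        (λ w∈ → W′-resp (σ-involutive _) (into (sp⊆W (σ-span b w∈)))) ,
        (λ w w∈ → trans (sym (Q-σ w)) (singular (σ w) (σ-span b w∈)))

  transport-type : ∀ {m} ε {p p′ : Point V} {ρ} → ¬ Q (vector p) ≈ 0# → ¬ ρ ≈ 0# → Q (vector p′) ≈ ρ * ρ * Q
    (vector p) →
                   HasType V Q m ε p → HasType V Q m ε p′
  transport-type {m} ε {p} {p′} {ρ} Qu≉0 ρ≉0 Qw≈ h = reflect (nonsingular-difference (sym Qw′≈) Qu≉0)
    where
    u w w′ : Carrierᴹ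
    u = vector p
    w = vector p′
    ρ⁻¹ = recip ρ ρ≉0
    w′ = ρ⁻¹ *ₗ w
    Qw′≈ : Q w′ ≈ Q u
    Qw′≈ = trans (Q-*ₗ ρ⁻¹ w) (trans (*-congˡ Qw≈) (from-diff
      (solve 3 (λ k r x → k :* k :* (r :* r :* x) :- x := (k :* r :* x :+ x) :* (k :* r :- con (+ 1))) refl ρ⁻¹ ρ (Q u))
      (*-zero _ (diff-zero (recip-inverse ρ ρ≉0)))))
    reflect : ∃[ e ] IsSign e × ¬ Q (u +[ - e ] w′) ≈ 0# → HasType V Q m ε p′
    reflect (e , s , Qd≉0) = transported ε h
      where
      d : Carrierᴹ
      d = u +[ - e ] w′
      σ : Carrierᴹ → Carrierᴹ
      σ = Reflection.σ d Qd≉0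
      σu : σ u ≈ᴹ e *ₗ w′
      σu = Reflection.σ-swaps d Qd≉0 (sign-square s) (sym Qw′≈) ≈ᴹ-refl
      e≉0 : ¬ e ≈ 0#
      e≉0 e≈0 = 1≉0 (trans (sym (sign-square s)) (*-zero e e≈0))
      scaled : ∀ y → P (σ u) y ≈ e * (ρ⁻¹ * P w y)
      scaled y = trans (P-congʳ σu) (trans (polar-*ₗ e w′ y) (*-congˡ (polar-*ₗ ρ⁻¹ w y)))
      into : ∀ {y} → P u y ≈ 0# → P w (σ y) ≈ 0#
      into {y} o = x*y≈0 (recip≉0 ρ ρ≉0) (x*y≈0 e≉0 (trans (sym (scaled (σ y))) (trans (Reflection.P-σ d Qd≉0 u y) o)))
      onto : ∀ {y} → P w y ≈ 0# → P u (σ y) ≈ 0#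
      onto {y} o = trans (sym (Reflection.P-σ d Qd≉0 u (σ y)))
        (trans (P-congˡ (Reflection.σ-involutive d Qd≉0 y)) (trans (scaled y) (*-zero e (*-zero ρ⁻¹ o))))
      module To = Transport {W = _⊥ V Q u} {W′ = _⊥ V Q w} (λ e o → trans (P-congˡ (≈ᴹ-sym e)) o)
        (λ e o → trans (P-congˡ (≈ᴹ-sym e)) o) d Qd≉0
      module From = Transport {W = _⊥ V Q w} {W′ = _⊥ V Q u} (λ e o → trans (P-congˡ (≈ᴹ-sym e)) o)
        (λ e o → trans (P-congˡ (≈ᴹ-sym e)) o) d Qd≉0
      index : ∀ {k} → HasWittIndex V Q (_⊥ V Q u) k → HasWittIndex V Q (_⊥ V Q w) k
      index ((b , tsb) , maximal) = (σ ∘ b , To.transport-basis into onto tsb) ,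
        (λ j b′ tsb′ → maximal j (σ ∘ b′) (From.transport-basis onto into tsb′))
      transported : ∀ ε → HasType V Q m ε p → HasType V Q m ε p′
      transported Sign.+ h = record
        { dimension = To.transport-dimension into onto dimension ; nondegenerate =
          To.transport-nondegenerate into onto nondegenerate ; wittIndex = index wittIndex }
        where open Hyperbolic h
      transported Sign.- h = record
        { dimension = To.transport-dimension into onto dimension ; nondegenerate =
          To.transport-nondegenerate into onto nondegenerate
        ; wittIndex = let k , eq , wi = wittIndex in k , eq , index wi }
        where open Elliptic h

funToFin-cong : ∀ {m n} {f g : Fin m → Fin n} → (∀ i → f i ≡ g i) → funToFin f ≡ funToFin g
funToFin-cong {zero}  _   = ≡.refl
funToFin-cong {suc m} f≗g = ≡.cong₂ Fin.combine (f≗g zero) (funToFin-cong (f≗g ∘ suc))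

module _ {c ℓ v ℓv} {F : CommutativeRing c ℓ} (isField : IsField F) {q}
  (𝓕 : HasCardinality (CommutativeRing.setoid F) q)
         (V : Module F v ℓv) where
  open Field F isField 𝓕
  open Module V
  open ModuleProperties V

  private
    LC : ∀ {n} → (Fin n → Carrier) → (Fin n → Carrierᴹ) → Carrierᴹ
    LC = linearCombination V

    LC-cong : ∀ {n} {a a′ : Fin n → Carrier} (b : Fin n → Carrierᴹ) → (∀ i → a i ≈ a′ i) → LC a b ≈ᴹ LC a′ b
    LC-cong {zero}  b e = ≈ᴹ-refl
    LC-cong {suc n} b e = +ᴹ-cong (*ₗ-congʳ (e zero)) (LC-cong (b ∘ suc) (e ∘ suc))

    LC-difference : ∀ {n} (a a′ : Fin n → Carrier) (b : Fin n → Carrierᴹ) → LC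
      (λ i → a i + - 1# * a′ i) b ≈ᴹ LC a b +ᴹ - 1# *ₗ LC a′ b
    LC-difference {zero}  a a′ b = ≈ᴹ-sym (≈ᴹ-trans (+ᴹ-identityˡ _) (*ₗ-zeroʳ _))
    LC-difference {suc n} a a′ b = ≈ᴹ-trans
      (+ᴹ-cong (≈ᴹ-trans (*ₗ-distribʳ (b zero) _ _) (+ᴹ-congˡ (*ₗ-assoc _ _ _)))
        (LC-difference (a ∘ suc) (a′ ∘ suc) (b ∘ suc)))
      (≈ᴹ-trans (+ᴹ-interchange _ _ _ _) (+ᴹ-congˡ (≈ᴹ-sym (*ₗ-distribˡ _ _ _))))

  independent⇒unique : ∀ {n} {b : Fin n → Carrierᴹ} → LinearlyIndependent V b → ∀ {a a′} → LC a b ≈ᴹ LC a′ b → ∀ i →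
    a i ≈ a′ i
  independent⇒unique {b = b} independent {a} {a′} eq i = from-diff
    (solve 2 (λ x y → x :- y := x :+ (:- con (+ 1)) :* y) refl (a i) (a′ i))
    (independent (λ i → a i + - 1# * a′ i) (≈ᴹ-trans (LC-difference a a′ b) (≈ᴹ-trans (+ᴹ-congʳ eq) (u-u≈0 _))) i)

  dimension⇒cardinality : ∀ {n} → HasDimension V U n → HasCardinality ≈ᴹ-setoid (q ^ n)
  dimension⇒cardinality {n} (b , independent , _ , spans) = record
    { to        = to
    ; from      = from
    ; to-cong   = λ {u} {w} e → funToFin-cong (λ i → to-cong
      (independent⇒unique independent (≈ᴹ-trans (≈ᴹ-sym (a-spec u)) (≈ᴹ-trans e (a-spec w))) i))
    ; from-cong = λ { ≡.refl → ≈ᴹ-refl }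
    ; inverse   = (λ {k} {u} e → ≡.trans (funToFin-cong (λ i → ≡.trans
                    (to-cong (independent⇒unique independent (≈ᴹ-trans (≈ᴹ-sym (a-spec u)) e) i))
                      (strictlyInverseˡ (finToFun k i)))) (Finₚ.funToFin-finToFin {n} {q} k))
                , (λ { {u} ≡.refl → ≈ᴹ-trans (LC-cong b
                  (λ i → trans (Inverse.from-cong 𝓕 (Finₚ.finToFun-funToFin (λ i → Inverse.to 𝓕 (a u i)) i))
                  (from∘to 𝓕 (a u i)))) (≈ᴹ-sym (a-spec u)) })
    }
    where
    open Inverse 𝓕 using (to-cong; strictlyInverseˡ)
    a : Carrierᴹ → Fin n → Carrier
    a u = proj₁ (spans {u} _)
    a-spec : ∀ u → u ≈ᴹ LC (a u) b
    a-spec u = proj₂ (spans {u} _)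
    to : Carrierᴹ → Fin (q ^ n)
    to u = funToFin (λ i → Inverse.to 𝓕 (a u i))
    from : Fin (q ^ n) → Carrierᴹ
    from k = LC (λ i → Inverse.from 𝓕 (finToFun k i)) b

module _ {c ℓ} {F : CommutativeRing c ℓ} (isField : IsField F) {q}
  (𝓕 : HasCardinality (CommutativeRing.setoid F) q) where
  open Field F isField 𝓕

  -- In characteristic 2 the translation by 1 is a fixed-point-free involution of F.
  odd-order : ¬ 2 ∣ q → ¬ 1# + 1# ≈ 0#
  odd-order 2∤q 1+1≈0 = 2∤q (divides (count 𝓕 up?) (≡.trans (≡.sym (count-all 𝓕 (λ x → decEq 𝓕 x x) (λ _ → refl)))
    (≡.trans (count-⊎ 𝓕 (λ x → decEq 𝓕 x x) up? down? (λ {x} _ → split x) (λ _ → refl) (λ _ → refl)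
      (λ p r → ℕₚ.<-asym p r))
    (≡.trans (≡.cong (count 𝓕 up? ℕ.+_) (≡.sym swap)) (≡.trans (≡.cong (count 𝓕 up? ℕ.+_) (≡.sym (ℕₚ.+-identityʳ _)))
      (ℕₚ.*-comm 2 (count 𝓕 up?)))))))
    where
    rank : Carrier → ℕ
    rank x = toℕ (Inverse.to 𝓕 x)
    rank-cong : ∀ {x y} → x ≈ y → rank x ≡ rank y
    rank-cong e = ≡.cong toℕ (Inverse.to-cong 𝓕 e)
    up? : ∀ x → Dec (rank x < rank (x + 1#))
    up? x = rank x ℕₚ.<? rank (x + 1#)
    down? : ∀ x → Dec (rank (x + 1#) < rank x)
    down? x = rank (x + 1#) ℕₚ.<? rank x
    split : ∀ x → rank x < rank (x + 1#) ⊎ rank (x + 1#) < rank x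
    split x with ℕₚ.<-cmp (rank x) (rank (x + 1#))
    ... | tri< lt _ _ = inj₁ lt
    ... | tri> _ _ gt = inj₂ gt
    ... | tri≈ _ eq _ = contradiction (trans (solve 1 (λ x → con (+ 1) := (:- x) :+ (x :+ con (+ 1))) refl x)
            (trans (+-congˡ (sym (to-injective 𝓕 (Finₚ.toℕ-injective eq)))) (-‿inverseˡ x))) 1≉0
    involutive : ∀ x → (x + 1#) + 1# ≈ x
    involutive x = trans (+-assoc x 1# 1#) (trans (+-congˡ 1+1≈0) (+-identityʳ x))
    swap : count 𝓕 up? ≡ count 𝓕 down?
    swap = count-bij 𝓕 𝓕 up? down? (λ e → ≡.subst₂ _<_ (rank-cong e) (rank-cong (+-congʳ e)))
      (λ e → ≡.subst₂ _<_ (rank-cong (+-congʳ e)) (rank-cong e))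
      (_+ 1#) (_+ 1#) +-congʳ +-congʳ
      (λ {x} → ≡.subst (_< rank (x + 1#)) (rank-cong (sym (involutive x))))
        (λ {x} → ≡.subst (rank (x + 1#) <_) (rank-cong (sym (involutive x))))
      (λ _ → involutive _) (λ _ → involutive _)

does-cong : ∀ {p r} {P : Set p} {R : Set r} (d : Dec P) (e : Dec R) → (P → R) → (R → P) → does d ≡ does e
does-cong (yes p) e f g = ≡.sym (dec-true e (f p))
does-cong (no ¬p) e f g = ≡.sym (dec-false e (¬p ∘ g))

module TangentGraph
  {c ℓ v ℓv} {F : CommutativeRing c ℓ} (isField : IsField F) {q} (𝓕 : HasCardinality (CommutativeRing.setoid F) q)
  (V : Module F v ℓv) {nV} (𝓥 : HasCardinality (Module.≈ᴹ-setoid V) nV)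
  (Q : Module.Carrierᴹ V → CommutativeRing.Carrier F) (isQ : IsQuadraticForm V Q)
  (2≉0 : ¬ (CommutativeRing._≈_ F (CommutativeRing._+_ F (CommutativeRing.1# F) (CommutativeRing.1# F))
    (CommutativeRing.0# F)))
  (nondegenerate : Nondegenerate V Q)
  (ν : CommutativeRing.Carrier F) (ν≉0 : ¬ (CommutativeRing._≈_ F ν (CommutativeRing.0# F)))
  where
  open FiniteQuadratic isField 𝓕 V 𝓥 Q isQ
  open OddQuadratic isField 𝓕 V 𝓥 Q isQ 2≉0
  open SetoidReasoning setoid

  2ν : Carrier
  2ν = ν + ν

  2ν≉0 : ¬ 2ν ≈ 0#
  2ν≉0 = x+x≉0 ν≉0

  4ν≉0 : ¬ 2ν + 2ν ≈ 0#
  4ν≉0 = x+x≉0 2ν≉0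

  2ν≉-2ν : ¬ 2ν ≈ - 2ν
  2ν≉-2ν e = 4ν≉0 (trans (+-congʳ e) (-‿inverseˡ 2ν))

  sign-* : ∀ {e f} → IsSign e → IsSign f → IsSign (e * f)
  sign-* (inj₁ p) (inj₁ r) = inj₁ (trans (*-cong p r) (*-identityˡ 1#))
  sign-* (inj₁ p) (inj₂ r) = inj₂ (trans (*-cong p r) (*-identityˡ _))
  sign-* (inj₂ p) (inj₁ r) = inj₂ (trans (*-cong p r) (*-identityʳ _))
  sign-* (inj₂ p) (inj₂ r) = inj₁ (trans (*-cong p r) (solve 0 ((:- con (+ 1)) :* (:- con (+ 1)) := con (+ 1)) refl))

  Same : Carrierᴹ → Carrierᴹ → Set _
  Same u w = ∃[ e ] IsSign e × u ≈ᴹ e *ₗ w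

  same-≈ : ∀ {u w} → u ≈ᴹ w → Same u w
  same-≈ {u} {w} e = 1# , inj₁ refl , ≈ᴹ-trans e (≈ᴹ-sym (*ₗ-identityˡ w))

  same-sym : ∀ {u w} → Same u w → Same w u
  same-sym {u} {w} (e , s , p) = e , s , ≈ᴹ-trans (≈ᴹ-sym (*ₗ-inverse (sign-square s) w)) (*ₗ-congˡ (≈ᴹ-sym p))

  same-trans : ∀ {u w x} → Same u w → Same w x → Same u x
  same-trans {u} {w} {x} (e , s , p) (f , t , r) = e * f , sign-* s t , ≈ᴹ-trans p
    (≈ᴹ-trans (*ₗ-congˡ r) (≈ᴹ-sym (*ₗ-assoc e f x)))

  same-Q : ∀ {u w} → Same u w → Q u ≈ Q w
  same-Q {u} {w} (e , s , p) = trans (Q-cong p) (trans (Q-*ₗ e w) (trans (*-congʳ (sign-square s)) (*-identityˡ _)))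

  same? : ∀ u w → Dec (Same u w)
  same? u w = map′ (λ { (inj₁ p) → 1# , inj₁ refl , p ; (inj₂ p) → - 1# , inj₂ refl , p })
    (λ { (e , inj₁ s , p) → inj₁ (≈ᴹ-trans p (*ₗ-congʳ s)) ; (e , inj₂ s , p) → inj₂ (≈ᴹ-trans p (*ₗ-congʳ s)) })
    ((u ≟ᴹ 1# *ₗ w) ⊎-dec (u ≟ᴹ - 1# *ₗ w))

  neg : Carrierᴹ → Carrierᴹ
  neg u = - 1# *ₗ u

  neg-same : ∀ u → Same (neg u) u
  neg-same u = - 1# , inj₂ refl , ≈ᴹ-refl

  Adj : Carrierᴹ → Carrierᴹ → Set _
  Adj u w = ¬ Same u w × P u w * P u w ≈ 2ν * 2ν

  adj? : ∀ u w → Dec (Adj u w)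
  adj? u w = ¬? (same? u w) ×-dec (P u w * P u w ≟ 2ν * 2ν)

  P²-same : ∀ {u u′} → Same u u′ → ∀ w → P u w * P u w ≈ P u′ w * P u′ w
  P²-same {u} {u′} (e , s , p) w = begin
    P u w * P u w  ≈⟨ *-cong Pe Pe ⟩
    (e * P u′ w) * (e * P u′ w)
      ≈⟨ from-diff (solve 2 (λ e x → (e :* x) :* (e :* x) :- x :* x := (x :* x) :* (e :* e :- con (+ 1))) refl e
        (P u′ w)) (*-zero _ (diff-zero (sign-square s))) ⟩
    P u′ w * P u′ w ∎
    where
    Pe : P u w ≈ e * P u′ w
    Pe = trans (P-congʳ p) (polar-*ₗ e u′ w)

  adj-sym : ∀ {u w} → Adj u w → Adj w u
  adj-sym {u} {w} (¬s , p) = ¬s ∘ same-sym , trans (*-cong (P-sym w u) (P-sym w u)) p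

  adj-sameˡ : ∀ {u u′ w} → Same u u′ → Adj u w → Adj u′ w
  adj-sameˡ {u} {u′} {w} s (¬s , p) = (λ s′ → ¬s (same-trans s s′)) , trans (sym (P²-same s w)) p

  adj-same : ∀ {u u′ w w′} → Same u u′ → Same w w′ → Adj u w → Adj u′ w′
  adj-same s t = adj-sameˡ s ∘ adj-sym ∘ adj-sameˡ t ∘ adj-sym

  normalise : ∀ {u w} → P u w * P u w ≈ 2ν * 2ν → ∃[ w′ ] Same w′ w × P u w′ ≈ 2ν
  normalise {u} {w} p with square-roots p
  ... | inj₁ e = w , same-≈ ≈ᴹ-refl , e
  ... | inj₂ e = neg w , neg-same w , trans (P-*ʳ (- 1#) u w)
    (trans (*-congˡ e) (solve 1 (λ x → (:- con (+ 1)) :* (:- x) := x) refl 2ν))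

  normalised-unique : ∀ {u w w′} → Same w w′ → P u w ≈ 2ν → P u w′ ≈ 2ν → w ≈ᴹ w′
  normalised-unique {u} {w} {w′} (e , inj₁ s , p) _ _ = ≈ᴹ-trans p (≈ᴹ-trans (*ₗ-congʳ s) (*ₗ-identityˡ w′))
  normalised-unique {u} {w} {w′} (e , inj₂ s , p) a b = contradiction
    (trans (sym a) (trans (P-congˡ p) (trans (P-*ʳ e u w′)
      (trans (*-cong s b) (solve 1 (λ x → (:- con (+ 1)) :* x := :- x) refl 2ν))))) 2ν≉-2ν

  private
    -- Of the two vectors ±z of norm ν of a vertex, the one that 𝓥 numbers first represents it.
    IsVertex : Carrierᴹ → Set _
    IsVertex z = Q z ≈ ν × toℕ (Inverse.to 𝓥 z) ≤ toℕ (Inverse.to 𝓥 (neg z))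

    to-≤-resp : ∀ {z z′} → z ≈ᴹ z′ → toℕ (Inverse.to 𝓥 z) ≤ toℕ (Inverse.to 𝓥 (neg z)) → toℕ (Inverse.to 𝓥 z′) ≤ toℕ
      (Inverse.to 𝓥 (neg z′))
    to-≤-resp e = ≡.subst₂ (λ i j → toℕ i ≤ toℕ j) (Inverse.to-cong 𝓥 e) (Inverse.to-cong 𝓥 (*ₗ-congˡ e))

    isVertex? : ∀ z → Dec (IsVertex z)
    isVertex? z = (Q z ≟ ν) ×-dec (toℕ (Inverse.to 𝓥 z) ℕₚ.≤? toℕ (Inverse.to 𝓥 (neg z)))

    neg-neg : ∀ z → neg (neg z) ≈ᴹ z
    neg-neg = *ₗ-inverse (solve 0 ((:- con (+ 1)) :* (:- con (+ 1)) := con (+ 1)) refl)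

  opaque
    n : ℕ
    n = count 𝓥 isVertex?

    vertexEnumeration : Enumeration ≈ᴹ-setoid IsVertex n
    vertexEnumeration = enumerate 𝓥 isVertex? (λ e (a , b) → trans (Q-cong (≈ᴹ-sym e)) a , to-≤-resp e b)

  private
    module E = Enumeration vertexEnumeration
    open E using (elem-P; elem-injective; index; elem-index)

    representative : ∀ z → Q z ≈ ν → ∃[ z′ ] IsVertex z′ × Same z′ z
    representative z Qz with ℕₚ.≤-total (toℕ (Inverse.to 𝓥 z)) (toℕ (Inverse.to 𝓥 (neg z)))
    ... | inj₁ le = z , (Qz , le) , same-≈ ≈ᴹ-refl
    ... | inj₂ ge = neg z , (trans (same-Q (neg-same z)) Qz , ≡.subst (λ i → toℕ (Inverse.to 𝓥 (neg z)) ≤ toℕ i)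
      (Inverse.to-cong 𝓥 (≈ᴹ-sym (neg-neg z))) ge) , neg-same z

  opaque
    vec : Fin n → Carrierᴹ
    vec = E.elem

    Q-vec : ∀ i → Q (vec i) ≈ ν
    Q-vec i = proj₁ (elem-P i)

    idx : ∀ {z} → Q z ≈ ν → Fin n
    idx {z} Qz = index (proj₁ (proj₂ (representative z Qz)))

    vec-idx : ∀ {z} (Qz : Q z ≈ ν) → Same (vec (idx Qz)) z
    vec-idx {z} Qz = same-trans (same-≈ (elem-index (proj₁ (proj₂ (representative z Qz)))))
      (proj₂ (proj₂ (representative z Qz)))

    vec-injective : ∀ {i j} → Same (vec i) (vec j) → i ≡ j
    vec-injective {i} {j} (e , inj₁ s , p) = elem-injective (≈ᴹ-trans p (≈ᴹ-trans (*ₗ-congʳ s) (*ₗ-identityˡ _)))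
    vec-injective {i} {j} (e , inj₂ s , p) = elem-injective (to-injective 𝓥 (Finₚ.toℕ-injective (ℕₚ.≤-antisym
      (≡.subst (λ k → toℕ (Inverse.to 𝓥 (vec i)) ≤ toℕ k) (Inverse.to-cong 𝓥 neg-i) (proj₂ (elem-P i)))
      (≡.subst (λ k → toℕ (Inverse.to 𝓥 (vec j)) ≤ toℕ k) (Inverse.to-cong 𝓥 (≈ᴹ-sym i≈)) (proj₂ (elem-P j))))))
      where
      i≈ : vec i ≈ᴹ neg (vec j)
      i≈ = ≈ᴹ-trans p (*ₗ-congʳ s)
      neg-i : neg (vec i) ≈ᴹ vec j
      neg-i = ≈ᴹ-trans (*ₗ-congˡ i≈) (neg-neg _)

  idx-vec : ∀ i {z} (Qz : Q z ≈ ν) → Same z (vec i) → idx Qz ≡ i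
  idx-vec i Qz s = vec-injective (same-trans (vec-idx Qz) s)

  adj : Fin n → Fin n → Bool
  adj i j = does (adj? (vec i) (vec j))

  adj-symmetric : ∀ i j → adj i j ≡ adj j i
  adj-symmetric i j = does-cong (adj? (vec i) (vec j)) (adj? (vec j) (vec i)) adj-sym adj-sym

  adj-irreflexive : ∀ i → adj i i ≡ false
  adj-irreflexive i = dec-false (adj? (vec i) (vec i)) (λ (¬s , _) → ¬s (same-≈ ≈ᴹ-refl))

  open PairInvariants adj adj-symmetric adj-irreflexive

  does-true : ∀ {p} {A : Set p} (d : Dec A) → does d ≡ true → A
  does-true (yes a) _ = a
  does-true (no _)  ()

  edge : ∀ {i j} → adj i j ≡ true → P (vec i) (vec j) * P (vec i) (vec j) ≈ 2ν * 2ν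
  edge {i} {j} e = proj₂ (does-true (adj? (vec i) (vec j)) e)

  non-edge : ∀ {i j} → i ≢ j → adj i j ≡ false → ¬ P (vec i) (vec j) * P (vec i) (vec j) ≈ 2ν * 2ν
  non-edge {i} {j} i≢j e p = contradiction (≡.trans (≡.sym
    (dec-true (adj? (vec i) (vec j)) ((λ s → i≢j (vec-injective s)) , p))) e) λ ()

  A-adj : ∀ {u i} → Same (vec i) u → ∀ j → A i j ≡ 𝟙 (adj? u (vec j))
  A-adj {u} {i} s j = 𝟙-cong (adj i j Boolₚ.≟ true) (adj? u (vec j))
    (λ e → adj-sameˡ s (does-true (adj? (vec i) (vec j)) e))
    (λ a → dec-true (adj? (vec i) (vec j)) (adj-sameˡ (same-sym s) a))

  module _ {p} {G : Carrierᴹ → Set p} (G? : ∀ z → Dec (G z)) (G-same : ∀ {z z′} → Same z z′ → G z → G z′) where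

    Neighbour : Carrierᴹ → Carrierᴹ → Set _
    Neighbour u z = (P u z ≈ 2ν × Q z ≈ ν × ¬ z ≈ᴹ u) × G z

    neighbour? : ∀ u z → Dec (Neighbour u z)
    neighbour? u z = ((P u z ≟ 2ν) ×-dec ((Q z ≟ ν) ×-dec ¬? (z ≟ᴹ u))) ×-dec G? z

    neighbour-resp : ∀ {u z z′} → z ≈ᴹ z′ → Neighbour u z → Neighbour u z′
    neighbour-resp e ((a , b , d) , g) = (trans (P-congˡ (≈ᴹ-sym e)) a , trans (Q-cong (≈ᴹ-sym e)) b , d ∘ ≈ᴹ-trans e)
      , G-same (same-≈ e) g

    ∑-neighbours : ∀ {u i} → Q u ≈ ν → Same (vec i) u → ∑ 𝓝 (λ j → A i j ℕ.* 𝟙 (G? (vec j))) ≡ count 𝓥 (neighbour? u)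
    ∑-neighbours {u} {i} Qu s = ≡.trans
      (∑-cong 𝓝 (λ j → ≡.trans (≡.cong (ℕ._* 𝟙 (G? (vec j))) (A-adj s j)) (≡.sym (𝟙-× (adj? u (vec j)) (G? (vec j))))))
      (count-corr 𝓝 𝓥 (λ j → adj? u (vec j) ×-dec G? (vec j)) (neighbour? u) (λ j z → same? (vec j) z)
        (λ { ≡.refl p → p }) neighbour-resp (λ { ≡.refl p → p }) (λ e s → same-trans s (same-≈ e))
        (λ {j} ((¬s , p) , g) → let z , t , e = normalise p in
          z , ((e , trans (same-Q t) (Q-vec j) , λ z≈u → ¬s (same-trans (same-≈ (≈ᴹ-sym z≈u)) t)) , G-same
            (same-sym t) g) , same-sym t)
        (λ {z} ((e , Qz , z≉u) , g) → idx Qz ,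
          (adj-same (same-≈ ≈ᴹ-refl) (same-sym (vec-idx Qz))
            ((λ s → z≉u (≈ᴹ-sym (normalised-unique s (trans (P-diag u) (+-cong Qu Qu)) e))) , *-cong e e)
          , G-same (same-sym (vec-idx Qz)) g) , vec-idx Qz)
        (λ _ ((e , _) , _) ((e′ , _) , _) s s′ → normalised-unique (same-trans (same-sym s) s′) e e′)
        (λ _ _ _ s s′ → vec-injective (same-trans s (same-sym s′))))

  NonDeg-∷ : ∀ {u} → Q u ≈ ν → NonDeg (u ∷ [])
  NonDeg-∷ {u} Qu w (u⊥w ∷ []) orth = nondegenerate w _ λ z _ → begin
    P w z  ≈⟨ solve 2 (λ x a → x := x :+ a :* con (+ 0)) refl (P w z) (α z) ⟩
    P w z + α z * 0#  ≈⟨ +-congˡ (*-congˡ (trans (P-sym w u) u⊥w)) ⟨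
    P w z + α z * P w u  ≈⟨ P-shiftʳ w z (α z) u ⟨
    P w (z +[ α z ] u)  ≈⟨ orth _ (perp z ∷ []) ⟩
    0# ∎
    where
    κ = recip 2ν 2ν≉0
    α : Carrierᴹ → Carrier
    α z = - (P u z * κ)
    perp : ∀ z → P u (z +[ α z ] u) ≈ 0#
    perp z = trans (P-shiftʳ u z (α z) u) (trans (+-congˡ (*-congˡ (trans (P-diag u) (+-cong Qu Qu))))
      (trans (solve 3 (λ x k y → x :+ (:- (x :* k)) :* y := (:- x) :* (k :* y :- con (+ 1))) refl (P u z) κ 2ν)
        (*-zero _ (diff-zero (recip-inverse 2ν 2ν≉0)))))

  module Automorphism (d : Carrierᴹ) (Qd≉0 : ¬ Q d ≈ 0#) where
    private
      σ : Carrierᴹ → Carrierᴹ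
      σ = Reflection.σ d Qd≉0

    σ-same : ∀ {u w} → Same u w → Same (σ u) (σ w)
    σ-same {u} {w} (e , s , p) = e , s , ≈ᴹ-trans (Reflection.σ-cong d Qd≉0 p) (Reflection.σ-* d Qd≉0 e w)

    opaque
      π : Fin n → Fin n
      π i = idx (trans (Reflection.Q-σ d Qd≉0 (vec i)) (Q-vec i))

      vec-π : ∀ i → Same (vec (π i)) (σ (vec i))
      vec-π i = vec-idx (trans (Reflection.Q-σ d Qd≉0 (vec i)) (Q-vec i))

    π-idx : ∀ {u w} (Qu : Q u ≈ ν) (Qw : Q w ≈ ν) → Same (σ u) w → π (idx Qu) ≡ idx Qw
    π-idx Qu Qw s = ≡.sym (idx-vec (π (idx Qu)) Qw (same-sym
      (same-trans (vec-π (idx Qu)) (same-trans (σ-same (vec-idx Qu)) s))))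

    π-involutive : ∀ i → π (π i) ≡ i
    π-involutive i = vec-injective (same-trans (vec-π (π i))
      (same-trans (σ-same (vec-π i)) (same-≈ (Reflection.σ-involutive d Qd≉0 (vec i)))))

    σ-adj : ∀ {u w} → Adj u w → Adj (σ u) (σ w)
    σ-adj {u} {w} (¬s , p) = (λ s → ¬s (same-trans (same-≈ (≈ᴹ-sym (Reflection.σ-involutive d Qd≉0 u)))
      (same-trans (σ-same s) (same-≈ (Reflection.σ-involutive d Qd≉0 w))))) ,
      trans (*-cong (Reflection.P-σ d Qd≉0 u w) (Reflection.P-σ d Qd≉0 u w)) p

    π-adj : ∀ i j → adj (π i) (π j) ≡ adj i j
    π-adj i j = does-cong (adj? (vec (π i)) (vec (π j))) (adj? (vec i) (vec j))
      (λ a → adj-same (same-≈ (Reflection.σ-involutive d Qd≉0 _)) (same-≈ (Reflection.σ-involutive d Qd≉0 _))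
        (σ-adj (adj-same (vec-π i) (vec-π j) a)))
      (λ a → adj-same (same-sym (vec-π i)) (same-sym (vec-π j)) (σ-adj a))

    π-A : ∀ i j → A (π i) (π j) ≡ A i j
    π-A i j = ≡.cong (λ b → 𝟙 (b Boolₚ.≟ true)) (π-adj i j)

    ∑-π : ∀ f → ∑ 𝓝 (f ∘ π) ≡ ∑ 𝓝 f
    ∑-π f = ∑-bij 𝓝 𝓝 π π (≡.cong π) (≡.cong π) π-involutive π-involutive {f} (≡.cong f)

    π-deg : ∀ i → deg (π i) ≡ deg i
    π-deg i = ≡.trans (≡.sym (∑-π (A (π i)))) (∑-cong 𝓝 (π-A i))

    π-codeg : ∀ i j → codeg (π i) (π j) ≡ codeg i j
    π-codeg i j = ≡.trans (≡.sym (∑-π (λ z → A (π i) z ℕ.* A (π j) z)))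
      (∑-cong 𝓝 (λ z → ≡.cong₂ ℕ._*_ (π-A i z) (π-A j z)))

    π-commonEdges : ∀ i j → commonEdges (π i) (π j) ≡ commonEdges i j
    π-commonEdges i j = ≡.trans (≡.sym (∑-π (λ z → (A (π i) z ℕ.* A (π j) z) ℕ.* ∑ 𝓝
      (λ w → (A (π i) w ℕ.* A (π j) w) ℕ.* A z w))))
      (∑-cong 𝓝 (λ z → ≡.cong₂ ℕ._*_ (≡.cong₂ ℕ._*_ (π-A i z) (π-A j z))
        (≡.trans (≡.sym (∑-π (λ w → (A (π i) w ℕ.* A (π j) w) ℕ.* A (π z) w)))
          (∑-cong 𝓝 (λ w → ≡.cong₂ ℕ._*_ (≡.cong₂ ℕ._*_ (π-A i w) (π-A j w)) (π-A z w))))))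

  vertex-transitive : ∀ i j → ∃[ d ] Σ (¬ Q d ≈ 0#) λ Qd≉0 → Automorphism.π d Qd≉0 i ≡ j
  vertex-transitive i j = carry (nonsingular-difference Qi≈Qj (λ p → ν≉0 (trans (sym (Q-vec i)) p)))
    where
    Qi≈Qj : Q (vec i) ≈ Q (vec j)
    Qi≈Qj = trans (Q-vec i) (sym (Q-vec j))
    carry : ∃[ e ] IsSign e × ¬ Q (vec i +[ - e ] vec j) ≈ 0# → ∃[ d ] Σ (¬ Q d ≈ 0#) λ Qd≉0 →
      Automorphism.π d Qd≉0 i ≡ j
    carry (e , s , Qd≉0) = d , Qd≉0 , vec-injective (same-trans (Automorphism.vec-π d Qd≉0 i)
      (e , s , Reflection.σ-swaps d Qd≉0 (sign-square s) Qi≈Qj ≈ᴹ-refl))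
      where
      d : Carrierᴹ
      d = vec i +[ - e ] vec j

  deg-constant : ∀ i j → deg i ≡ deg j
  deg-constant i j = let d , Qd≉0 , πi≡j = vertex-transitive i j in
    ≡.trans (≡.sym (Automorphism.π-deg d Qd≉0 i)) (≡.cong deg πi≡j)

  record Near (u w : Carrierᴹ) : Set ℓ where
    constructor near
    field
      norm  : Q w ≈ ν
      value : P u w ≈ 2ν

  module _ (Φ : Fin n → Fin n → ℕ) (Φ-π : ∀ d (Qd≉0 : ¬ Q d ≈ 0#) i j → Φ (Automorphism.π d Qd≉0 i)
    (Automorphism.π d Qd≉0 j) ≡ Φ i j) where
    private
      module _ {u : Carrierᴹ} (Qu : Q u ≈ ν) where

        step : ∀ {w w′} (Nw : Near u w) (Nw′ : Near u w′) → ¬ Q (w +[ - 1# ] w′) ≈ 0# → Φ (idx Qu)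
          (idx (Near.norm Nw)) ≡ Φ (idx Qu) (idx (Near.norm Nw′))
        step {w} {w′} (near Qw Pw) (near Qw′ Pw′) Qd≉0 = ≡.trans (≡.sym (Φ-π d Qd≉0 (idx Qu) (idx Qw)))
          (≡.cong₂ Φ πu≡ πw≡)
          where
          d : Carrierᴹ
          d = w +[ - 1# ] w′
          σ : Carrierᴹ → Carrierᴹ
          σ = Reflection.σ d Qd≉0
          π : Fin n → Fin n
          π = Automorphism.π d Qd≉0
          d⊥u : P d u ≈ 0#
          d⊥u = trans (P-sym d u) (trans (P-shiftʳ u w (- 1#) w′)
            (trans (+-cong Pw (*-congˡ Pw′)) (solve 1 (λ x → x :+ (:- con (+ 1)) :* x := con (+ 0)) refl 2ν)))
          fixes : Same (σ u) u
          fixes = same-≈ (Reflection.σ-fixes d Qd≉0 d⊥u)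
          swaps : Same (σ w) w′
          swaps = 1# , inj₁ refl , Reflection.σ-swaps d Qd≉0 (*-identityˡ 1#) (trans Qw (sym Qw′)) ≈ᴹ-refl
          πu≡ : π (idx Qu) ≡ idx Qu
          πu≡ = Automorphism.π-idx d Qd≉0 Qu Qu fixes
          πw≡ : π (idx Qw) ≡ idx Qw′
          πw≡ = Automorphism.π-idx d Qd≉0 Qw Qw′ swaps

        direction : Carrierᴹ → Carrierᴹ
        direction w = w +[ - 1# ] u

        direction-perp : ∀ {w} → Near u w → Perp (u ∷ []) (direction w)
        direction-perp {w} (near Qw Pw) = trans (P-shiftʳ u w (- 1#) u)
          (trans (+-cong Pw (*-congˡ (trans (P-diag u) (+-cong Qu Qu))))
          (solve 1 (λ x → x :+ (:- con (+ 1)) :* x := con (+ 0)) refl 2ν)) ∷ []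

        Q-difference : ∀ {w r} → Near u w → Q r ≈ 0# → P u r ≈ 0# → Q (w +[ - 1# ] (r +[ 1# ] u)) ≈ - P (direction w) r
        Q-difference {w} {r} (near Qw Pw) Qr u⊥r = begin
          Q (w +[ - 1# ] (r +[ 1# ] u))
            ≈⟨ Q-shift w (- 1#) _ ⟩
          Q w + - 1# * P w (r +[ 1# ] u) + - 1# * - 1# * Q (r +[ 1# ] u)
            ≈⟨ +-cong (+-cong Qw (*-congˡ (trans (P-shiftʳ w r 1# u) (+-congˡ (*-congˡ (trans (P-sym w u) Pw))))))
                 (*-congˡ (trans (Q-shift r 1# u) (+-cong (+-cong Qr (*-congˡ (trans (P-sym r u) u⊥r))) (*-congˡ Qu))))
                   ⟩
          ν + - 1# * (P w r + 1# * 2ν) + - 1# * - 1# * (0# + 1# * 0# + 1# * 1# * ν)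
            ≈⟨ solve 2 (λ n x → n :+ (:- con (+ 1)) :* (x :+ con (+ 1) :* (n :+ n)) :+ (:- con (+ 1)) :*
              (:- con (+ 1)) :* (con (+ 0) :+ con (+ 1) :* con (+ 0) :+ con (+ 1) :* con (+ 1) :* n)
                 := :- (x :+ (:- con (+ 1)) :* con (+ 0))) refl ν (P w r) ⟩
          - (P w r + - 1# * 0#)
            ≈⟨ -‿cong (trans (P-shiftˡ w (- 1#) u r) (+-congˡ (*-congˡ u⊥r))) ⟨
          - P (direction w) r ∎

        common-nonorthogonal : ∀ {s s′} → Perp (u ∷ []) s → Perp (u ∷ []) s′ → ¬ s ≈ᴹ 0ᴹ → ¬ s′ ≈ᴹ 0ᴹ →
                               ∃[ r ] Perp (u ∷ []) r × ¬ P s r ≈ 0# × ¬ P s′ r ≈ 0#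
        common-nonorthogonal {s} {s′} Ws Ws′ s≉0 s′≉0
          with nonorthogonal (u ∷ []) (NonDeg-∷ Qu) Ws s≉0 | nonorthogonal (u ∷ []) (NonDeg-∷ Qu) Ws′ s′≉0
        ... | r₁ , Wr₁ , a | r₂ , Wr₂ , b with P s′ r₁ ≟ 0# | P s r₂ ≟ 0#
        ...   | no b′   | _       = r₁ , Wr₁ , a , b′
        ...   | yes _   | no a′   = r₂ , Wr₂ , a′ , b
        ...   | yes b≈0 | yes a≈0 = r₁ +[ 1# ] r₂ , Perp-shift (u ∷ []) 1# Wr₁ Wr₂ ,
          (λ p → a (trans (sym (trans (P-shiftʳ s r₁ 1# r₂) (trans (+-congˡ (*-zero 1# a≈0)) (+-identityʳ _)))) p)) ,
          (λ p → b (trans (sym (trans (P-shiftʳ s′ r₁ 1# r₂) (trans (+-cong b≈0 (*-identityˡ _)) (+-identityˡ _)))) p))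

        connected : ∀ {w w′} (Nw : Near u w) (Nw′ : Near u w′) → ¬ w ≈ᴹ u → ¬ w′ ≈ᴹ u → Φ (idx Qu)
          (idx (Near.norm Nw)) ≡ Φ (idx Qu) (idx (Near.norm Nw′))
        connected {w} {w′} Nw Nw′ w≉u w′≉u with Q (w +[ - 1# ] w′) ≟ 0#
        ... | no Q≉0 = step Nw Nw′ Q≉0
        ... | yes Q≈0 = ≡.trans (step Nw Nx Q₁≉0) (≡.sym (step Nw′ Nx Q₂≉0))
          where
          s = direction w
          s′ = direction w′
          Ws = direction-perp Nw
          Ws′ = direction-perp Nw′
          ≉0 : ∀ {w} → ¬ w ≈ᴹ u → ¬ direction w ≈ᴹ 0ᴹ
          ≉0 {w} w≉u p = w≉u (≈ᴹ-trans (≈ᴹ-sym (shift-inverse w u (-‿inverseˡ 1#)))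
            (≈ᴹ-trans (+ᴹ-congʳ p) (≈ᴹ-trans (+ᴹ-identityˡ _) (*ₗ-identityˡ u))))
          Q-direction : ∀ {w} → Near u w → Q (direction w) ≈ 0#
          Q-direction {w} (near Qw Pw) = trans (Q-shift w (- 1#) u)
            (trans (+-cong (+-cong Qw (*-congˡ (trans (P-sym w u) Pw))) (*-congˡ Qu))
            (solve 1 (λ n → n :+ (:- con (+ 1)) :* (n :+ n) :+ (:- con (+ 1)) :* (:- con (+ 1)) :* n := con (+ 0)) refl
              ν))
          found = common-nonorthogonal Ws Ws′ (≉0 w≉u) (≉0 w′≉u)
          r₀ = proj₁ found
          Wr₀ = proj₁ (proj₂ found)
          a≉0 = proj₁ (proj₂ (proj₂ found))
          b≉0 = proj₂ (proj₂ (proj₂ found))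
          s⊥s′ : P s s′ ≈ 0#
          s⊥s′ = trans (sym (-‿involutive _)) (trans (-‿cong (trans (sym (Q-difference Nw (Q-direction Nw′) u⊥s′))
            (trans (Q-cong (shift-cong ≈ᴹ-refl refl (shift-inverse w′ u (-‿inverseˡ 1#)))) Q≈0))) -0#≈0#)
            where
            u⊥s′ : P u s′ ≈ 0#
            u⊥s′ = All.head Ws′
          choose : ∃[ r ] Perp (u ∷ []) r × Q r ≈ 0# × ¬ P s r ≈ 0# × ¬ P s′ r ≈ 0#
          choose = r₀ +[ a ] s , Perp-shift (u ∷ []) a Wr₀ Ws ,
              trans (Q-shift r₀ a s) (trans (+-cong (+-congˡ (*-congˡ (P-sym r₀ s))) (*-zero _ (Q-direction Nw)))
                (trans (solve 3 (λ x k p → x :+ (:- (x :* k)) :* p :+ con (+ 0) := (:- x) :* (k :* p :- con (+ 1)))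
                  refl (Q r₀) κ (P s r₀)) (*-zero _ (diff-zero (recip-inverse _ a≉0))))) ,
              (λ p → a≉0 (trans (sym (trans (P-shiftʳ s r₀ a s)
                (trans (+-congˡ (*-zero a (trans (P-diag s) (+-zero (Q-direction Nw) (Q-direction Nw)))))
                (+-identityʳ _)))) p)) ,
              (λ p → b≉0 (trans (sym (trans (P-shiftʳ s′ r₀ a s)
                (trans (+-congˡ (*-zero a (trans (P-sym s′ s) s⊥s′))) (+-identityʳ _)))) p))
            where
            κ = recip (P s r₀) a≉0
            a = - (Q r₀ * κ)
          r = proj₁ choose
          u⊥r : P u r ≈ 0#
          u⊥r = All.head (proj₁ (proj₂ choose))
          Qr = proj₁ (proj₂ (proj₂ choose))
          x = r +[ 1# ] u
          Nx : Near u x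
          Nx = near (trans (Q-shift r 1# u) (trans (+-cong (+-cong Qr (*-congˡ (trans (P-sym r u) u⊥r))) (*-congˡ Qu))
            (solve 1 (λ n → con (+ 0) :+ con (+ 1) :* con (+ 0) :+ con (+ 1) :* con (+ 1) :* n := n) refl ν)))
               (trans (P-shiftʳ u r 1# u) (trans (+-cong u⊥r (*-congˡ (trans (P-diag u) (+-cong Qu Qu))))
                 (solve 1 (λ x → con (+ 0) :+ con (+ 1) :* x := x) refl 2ν)))
          Q₁≉0 : ¬ Q (w +[ - 1# ] x) ≈ 0#
          Q₁≉0 p = -x≉0 (proj₁ (proj₂ (proj₂ (proj₂ choose)))) (trans (sym (Q-difference Nw Qr u⊥r)) p)
          Q₂≉0 : ¬ Q (w′ +[ - 1# ] x) ≈ 0#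
          Q₂≉0 p = -x≉0 (proj₂ (proj₂ (proj₂ (proj₂ choose)))) (trans (sym (Q-difference Nw′ Qr u⊥r)) p)

    private
      Nearby : Fin n → Fin n → Set _
      Nearby x y = ∃[ w ] Near (vec x) w × ¬ w ≈ᴹ vec x × Same w (vec y)

      nearby : ∀ {x y} → adj x y ≡ true → Nearby x y
      nearby {x} {y} e = build (normalise (proj₂ xy))
        where
        xy : Adj (vec x) (vec y)
        xy = does-true (adj? (vec x) (vec y)) e
        build : ∃[ w ] Same w (vec y) × P (vec x) w ≈ 2ν → Nearby x y
        build (w , s , Pw) = w , near (trans (same-Q s) (Q-vec y)) Pw ,
          (λ w≈ → proj₁ xy (same-trans (same-≈ (≈ᴹ-sym w≈)) s)) , s

      fixed : ∀ {x y y′} → Nearby x y → Nearby x y′ → Φ x y ≡ Φ x y′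
      fixed {x} {y} {y′} (w , Nw , w≉ , s) (w′ , Nw′ , w′≉ , s′) = ≡.trans
        (≡.sym (≡.cong₂ Φ x≡ (idx-vec y (Near.norm Nw) s)))
        (≡.trans (connected (Q-vec x) Nw Nw′ w≉ w′≉) (≡.cong₂ Φ x≡ (idx-vec y′ (Near.norm Nw′) s′)))
        where
        x≡ : idx (Q-vec x) ≡ x
        x≡ = idx-vec x (Q-vec x) (same-≈ ≈ᴹ-refl)

    adjacent-invariant : ∀ {x y x′ y′} → adj x y ≡ true → adj x′ y′ ≡ true → Φ x y ≡ Φ x′ y′
    adjacent-invariant {x} {y} {x′} {y′} xy x′y′ = move (vertex-transitive x x′)
      where
      move : (∃[ d ] Σ (¬ Q d ≈ 0#) λ Qd≉0 → Automorphism.π d Qd≉0 x ≡ x′) → Φ x y ≡ Φ x′ y′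
      move (d , Qd≉0 , πx≡x′) = ≡.trans (≡.sym (Φ-π d Qd≉0 x y))
        (≡.trans (≡.cong (λ z → Φ z (Automorphism.π d Qd≉0 y)) πx≡x′)
        (fixed (nearby (≡.trans (≡.cong (λ z → adj z (Automorphism.π d Qd≉0 y)) (≡.sym πx≡x′))
          (≡.trans (Automorphism.π-adj d Qd≉0 x y) xy)))
               (nearby x′y′)))

  module _ {ζ a μ : ℕ} (N-0 : ∀ {u} → Q u ≈ ν → N (u ∷ []) 0# ≡ ζ)
    (N-≉0 : ∀ {u} → Q u ≈ ν → ∀ g → ¬ g ≈ 0# → N (u ∷ []) g ≡ a)
           (M-ν : ∀ {u} → Q u ≈ ν → M (u ∷ []) ≡ μ) where

    module NonAdjacent {u w : Carrierᴹ} (Qu : Q u ≈ ν) (Qw : Q w ≈ ν) (P²≉ : ¬ P u w * P u w ≈ 2ν * 2ν) where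
      private
        b κ : Carrier
        b = P u w
        κ = recip 2ν 2ν≉0

        κ2ν≈1 : κ * 2ν ≈ 1#
        κ2ν≈1 = recip-inverse 2ν 2ν≉0

        w⊥ : Carrierᴹ
        w⊥ = w +[ - (b * κ) ] u

        Puu : P u u ≈ 2ν
        Puu = trans (P-diag u) (+-cong Qu Qu)

        u⊥w⊥ : P u w⊥ ≈ 0#
        u⊥w⊥ = trans (P-shiftʳ u w _ u) (trans (+-congˡ (*-congˡ Puu))
          (trans (solve 3 (λ b k x → b :+ (:- (b :* k)) :* x := (:- b) :* (k :* x :- con (+ 1))) refl b κ 2ν)
            (*-zero _ (diff-zero κ2ν≈1))))

        -- 4 ν Q(w⊥) = 4 ν² - b².
        Qw⊥≉0 : ¬ Q w⊥ ≈ 0#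
        Qw⊥≉0 p = P²≉ (from-diff
          (trans (solve 3 (λ b n k → b :* b :- (n :+ n) :* (n :+ n) := (:- ((n :+ n) :+ (n :+ n))) :*
            (n :+ (:- (b :* k)) :* b :+ (:- (b :* k)) :* (:- (b :* k)) :* n) :+
                   (b :* b :* (k :* (n :+ n) :- con (+ 1))) :* (k :* (n :+ n) :- con (+ 1))) refl b ν κ)
             (+-congʳ (*-congˡ (sym Qw⊥))))
          (+-zero (*-zero _ p) (*-zero _ (diff-zero κ2ν≈1))))
          where
          Qw⊥ : Q w⊥ ≈ ν + - (b * κ) * b + - (b * κ) * - (b * κ) * ν
          Qw⊥ = trans (Q-shift w _ u) (+-cong (+-cong Qw (*-congˡ (P-sym w u))) (*-congˡ Qu))

        P-w⊥ : ∀ {s} → P u s ≈ 0# → P w⊥ s ≈ P w s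
        P-w⊥ {s} p = trans (P-shiftˡ w _ u s) (trans (+-congˡ (*-zero _ p)) (+-identityʳ _))

      level? : ∀ e z → Dec (P w z ≈ e × P u z ≈ 2ν × Q z ≈ ν)
      level? e z = (P w z ≟ e) ×-dec ((P u z ≟ 2ν) ×-dec (Q z ≟ ν))

      level-slice : ∀ e → count 𝓥 (level? e) ≡ count 𝓥 (slice? (u ∷ []) w⊥ (e - b))
      level-slice e = count-bij 𝓥 𝓥 (level? e) (slice? (u ∷ []) w⊥ (e - b))
        (λ eq (p , r , t) → trans (P-congˡ (≈ᴹ-sym eq)) p , trans (P-congˡ (≈ᴹ-sym eq)) r , trans
          (Q-cong (≈ᴹ-sym eq)) t)
        (slice-resp (u ∷ []))
        (λ z → z +[ - 1# ] u) (λ s → s +[ 1# ] u) (λ eq → shift-cong eq refl ≈ᴹ-refl)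
          (λ eq → shift-cong eq refl ≈ᴹ-refl)
        to back (λ _ → shift-inverse _ u (-‿inverseˡ 1#)) (λ _ → shift-inverse _ u (-‿inverseʳ 1#))
        where
        to : ∀ {z} → P w z ≈ e × P u z ≈ 2ν × Q z ≈ ν → P w⊥ (z +[ - 1# ] u) ≈ e - b × Q (z +[ - 1# ] u) ≈ 0# × Perp
          (u ∷ []) (z +[ - 1# ] u)
        to {z} (p , r , t) =
          trans (P-w⊥ u⊥s) (trans (P-shiftʳ w z (- 1#) u)
            (trans (+-cong p (*-congˡ (P-sym w u))) (solve 2 (λ e b → e :+ (:- con (+ 1)) :* b := e :- b) refl e b))) ,
          trans (Q-shift z (- 1#) u) (trans (+-cong (+-cong t (*-congˡ (trans (P-sym z u) r))) (*-congˡ Qu))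
            (solve 1 (λ n → n :+ (:- con (+ 1)) :* (n :+ n) :+ (:- con (+ 1)) :* (:- con (+ 1)) :* n := con (+ 0)) refl
              ν)) ,
          u⊥s ∷ []
          where
          u⊥s : P u (z +[ - 1# ] u) ≈ 0#
          u⊥s = trans (P-shiftʳ u z (- 1#) u) (trans (+-cong r (*-congˡ Puu))
            (solve 1 (λ x → x :+ (:- con (+ 1)) :* x := con (+ 0)) refl 2ν))
        back : ∀ {s} → P w⊥ s ≈ e - b × Q s ≈ 0# × Perp (u ∷ []) s → P w (s +[ 1# ] u) ≈ e × P u (s +[ 1# ] u) ≈ 2ν × Q
          (s +[ 1# ] u) ≈ ν
        back {s} (p , r , t ∷ []) =
          trans (P-shiftʳ w s 1# u) (trans (+-cong (trans (sym (P-w⊥ t)) p) (*-congˡ (P-sym w u)))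
            (solve 2 (λ e b → e :- b :+ con (+ 1) :* b := e) refl e b)) ,
          trans (P-shiftʳ u s 1# u) (trans (+-cong t (*-congˡ Puu))
            (solve 1 (λ x → con (+ 0) :+ con (+ 1) :* x := x) refl 2ν)) ,
          trans (Q-shift s 1# u) (trans (+-cong (+-cong r (*-congˡ (trans (P-sym s u) t))) (*-congˡ Qu))
            (solve 1 (λ n → con (+ 0) :+ con (+ 1) :* con (+ 0) :+ con (+ 1) :* con (+ 1) :* n := n) refl ν))

      level-count : ∀ {e} → e * e ≈ 2ν * 2ν → q ℕ.* (q ℕ.* (a ℕ.* count 𝓥 (level? e))) ℕ.+ μ ≡ ζ ℕ.* μ
      level-count {e} ee≈ = ≡.trans
        (≡.cong₂ (λ x m → q ℕ.* (q ℕ.* x) ℕ.+ m) (≡.cong₂ ℕ._*_ (≡.sym (N-≉0 Qu (Q w⊥) Qw⊥≉0)) (level-slice e))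
          (≡.sym (M-ν Qu)))
        (≡.trans (slice-count (u ∷ []) (NonDeg-∷ Qu) (u⊥w⊥ ∷ []) refl Qw⊥≉0 e-b≉0) (≡.cong₂ ℕ._*_ (N-0 Qu) (M-ν Qu)))
        where
        e-b≉0 : ¬ e - b ≈ 0#
        e-b≉0 p = P²≉ (trans (*-cong (sym e≈b) (sym e≈b)) ee≈)
          where
          e≈b : e ≈ b
          e≈b = x∙y⁻¹≈ε⇒x≈y e b p

      a≢0 : a ≢ 0
      a≢0 a≡0 = count-inhabited 𝓥 (λ z → (Q z ≟ Q w⊥) ×-dec perp? (u ∷ []) z)
        (λ e (p , r) → trans (Q-cong (≈ᴹ-sym e)) p , Perp-resp (u ∷ []) e r) {w⊥} (refl , u⊥w⊥ ∷ [])
          (≡.trans (N-≉0 Qu (Q w⊥) Qw⊥≉0) a≡0)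

    private
      ±-squares : (- 2ν) * (- 2ν) ≈ 2ν * 2ν
      ±-squares = solve 1 (λ x → (:- x) :* (:- x) := x :* x) refl 2ν

    codeg-non-edge : ∀ {i j} → i ≢ j → adj i j ≡ false → q ℕ.* (q ℕ.* (a ℕ.* codeg i j)) ℕ.+
      (μ ℕ.+ μ) ≡ ζ ℕ.* μ ℕ.+ ζ ℕ.* μ
    codeg-non-edge {i} {j} i≢j e = combine split (level-count refl) (level-count ±-squares)
      where
      u w : Carrierᴹ
      u = vec i
      w = vec j
      P²≉ : ¬ P u w * P u w ≈ 2ν * 2ν
      P²≉ = non-edge i≢j e
      open NonAdjacent {u} {w} (Q-vec i) (Q-vec j) P²≉
      adj-resp : ∀ {z z′} → Same z z′ → Adj w z → Adj w z′
      adj-resp = adj-same (same-≈ ≈ᴹ-refl)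
      split : codeg i j ≡ count 𝓥 (level? 2ν) ℕ.+ count 𝓥 (level? (- 2ν))
      split = ≡.trans (∑-cong 𝓝 (λ z → ≡.cong (A i z ℕ.*_) (A-adj {w} {j} (same-≈ ≈ᴹ-refl) z)))
        (≡.trans (∑-neighbours (adj? w) adj-resp (Q-vec i) (same-≈ ≈ᴹ-refl))
        (count-⊎ 𝓥 (neighbour? (adj? w) adj-resp u) (level? 2ν) (level? (- 2ν)) forward (λ p → backward refl p)
          (λ p → backward ±-squares p)
          (λ (p , _) (p′ , _) → 2ν≉-2ν (trans (sym p) p′))))
        where
        forward : ∀ {z} → Neighbour (adj? w) adj-resp u z → (P w z ≈ 2ν × P u z ≈ 2ν × Q z ≈ ν) ⊎
          (P w z ≈ - 2ν × P u z ≈ 2ν × Q z ≈ ν)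
        forward ((p , r , _) , (_ , t)) with square-roots t
        ... | inj₁ k = inj₁ (k , p , r)
        ... | inj₂ k = inj₂ (k , p , r)
        backward : ∀ {z e} → e * e ≈ 2ν * 2ν → P w z ≈ e × P u z ≈ 2ν × Q z ≈ ν → Neighbour (adj? w) adj-resp u z
        backward {z} {e} ee (p , r , t) = (r , t , λ z≈u → P²≉
          (square (trans (P-sym u w) (trans (P-congˡ (≈ᴹ-sym z≈u)) p)))) ,
          (λ s → P²≉ (trans (*-cong (P-sym u w) (P-sym u w))
            (trans (P²-same s u) (trans (*-cong (P-sym z u) (P-sym z u)) (*-cong r r))))) , trans (*-cong p p) ee
          where
          square : ∀ {x} → x ≈ e → x * x ≈ 2ν * 2ν
          square x≈e = trans (*-cong x≈e x≈e) ee
      combine : ∀ {k m n} → k ≡ m ℕ.+ n → q ℕ.* (q ℕ.* (a ℕ.* m)) ℕ.+ μ ≡ ζ ℕ.* μ → q ℕ.*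
        (q ℕ.* (a ℕ.* n)) ℕ.+ μ ≡ ζ ℕ.* μ →
                q ℕ.* (q ℕ.* (a ℕ.* k)) ℕ.+ (μ ℕ.+ μ) ≡ ζ ℕ.* μ ℕ.+ ζ ℕ.* μ
      combine {_} {m} {n} ≡.refl e₁ e₂ = ≡.trans
        (S.solve 5 (λ q a m n μ → q S.:* (q S.:* (a S.:* (m S.:+ n))) S.:+ (μ S.:+ μ) S.:=
          (q S.:* (q S.:* (a S.:* m)) S.:+ μ) S.:+ (q S.:* (q S.:* (a S.:* n)) S.:+ μ)) ≡.refl q a m n μ)
        (≡.cong₂ ℕ._+_ e₁ e₂)
        where module S = +-*-Solver

    -- Let z be adjacent to x and y, with signs chosen such that P(z,u) = P(z,w) = 2ν. Then z⊥ contains the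
    -- hyperbolic pair u - z, w - z, and the common neighbours of x, y, z other than z correspond to a grid.
    module CommonTriangle {u w z : Carrierᴹ} (Qu : Q u ≈ ν) (Qw : Q w ≈ ν) (Qz : Q z ≈ ν) (Pzu : P z u ≈ 2ν)
      (Pzw : P z w ≈ 2ν)
                          (P²≉ : ¬ P u w * P u w ≈ 2ν * 2ν) where
      private
        Pzz : P z z ≈ 2ν
        Pzz = trans (P-diag z) (+-cong Qz Qz)

        dir : Carrierᴹ → Carrierᴹ
        dir x = x +[ - 1# ] z

        z⊥dir : ∀ {x} → P z x ≈ 2ν → Perp (z ∷ []) (dir x)
        z⊥dir {x} p = trans (P-shiftʳ z x (- 1#) z) (trans (+-cong p (*-congˡ Pzz))
          (solve 1 (λ x → x :+ (:- con (+ 1)) :* x := con (+ 0)) refl 2ν)) ∷ []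

        Q-dir : ∀ {x} → Q x ≈ ν → P z x ≈ 2ν → Q (dir x) ≈ 0#
        Q-dir {x} Qx p = trans (Q-shift x (- 1#) z) (trans
          (+-cong (+-cong Qx (*-congˡ (trans (P-sym x z) p))) (*-congˡ Qz))
          (solve 1 (λ n → n :+ (:- con (+ 1)) :* (n :+ n) :+ (:- con (+ 1)) :* (:- con (+ 1)) :* n := con (+ 0)) refl
            ν))

        -4ν : Carrier
        -4ν = - (2ν + 2ν)

        P-dir : P (dir u) (dir w) ≈ P u w - 2ν
        P-dir = begin
          P (u +[ - 1# ] z) (dir w)  ≈⟨ P-shiftˡ u (- 1#) z (dir w) ⟩
          P u (dir w) + - 1# * P z (dir w)  ≈⟨ +-congˡ (*-zero _ (All.head (z⊥dir Pzw))) ⟩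
          P u (w +[ - 1# ] z) + 0#
            ≈⟨ +-congʳ (trans (P-shiftʳ u w (- 1#) z) (+-congˡ (*-congˡ (trans (P-sym u z) Pzu)))) ⟩
          (P u w + - 1# * 2ν) + 0#
            ≈⟨ solve 2 (λ x y → (x :+ (:- con (+ 1)) :* y) :+ con (+ 0) := x :- y) refl (P u w) 2ν ⟩
          P u w - 2ν ∎

        h≉0 : ¬ P (dir u) (dir w) ≈ 0#
        h≉0 p = P²≉ (*-cong eq eq)
          where
          eq : P u w ≈ 2ν
          eq = x∙y⁻¹≈ε⇒x≈y _ _ (trans (sym P-dir) p)

        P-translate : ∀ {x r} → P z x ≈ 2ν → P z r ≈ 0# → P x (r +[ 1# ] z) ≈ P (dir x) r + 2ν
        P-translate {x} {r} p t = begin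
          P x (r +[ 1# ] z)  ≈⟨ trans (P-shiftʳ x r 1# z) (+-congˡ (*-congˡ (trans (P-sym x z) p))) ⟩
          P x r + 1# * 2ν
            ≈⟨ solve 2 (λ y n → y :+ con (+ 1) :* n := (y :+ (:- con (+ 1)) :* con (+ 0)) :+ n) refl (P x r) 2ν ⟩
          (P x r + - 1# * 0#) + 2ν  ≈⟨ +-congʳ (trans (P-shiftˡ x (- 1#) z r) (+-congˡ (*-congˡ t))) ⟨
          P (dir x) r + 2ν ∎

        on-grid : ∀ {x} → x + 2ν ≈ 2ν ⊎ x + 2ν ≈ - 2ν → x ≈ 0# ⊎ x ≈ -4ν
        on-grid {x} (inj₁ e) = inj₁ (from-diff (solve 2 (λ x n → x :- con (+ 0) := (x :+ n) :- n) refl x 2ν)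
          (diff-zero e))
        on-grid {x} (inj₂ e) = inj₂ (from-diff (solve 2 (λ x n → x :- (:- (n :+ n)) := (x :+ n) :- (:- n)) refl x 2ν)
          (diff-zero e))

        off-grid : ∀ {x} → x ≈ 0# ⊎ x ≈ -4ν → (x + 2ν) * (x + 2ν) ≈ 2ν * 2ν
        off-grid {x} (inj₁ e) = trans (*-cong (+-congʳ e) (+-congʳ e))
          (solve 1 (λ n → (con (+ 0) :+ n) :* (con (+ 0) :+ n) := n :* n) refl 2ν)
        off-grid {x} (inj₂ e) = trans (*-cong (+-congʳ e) (+-congʳ e))
          (solve 1 (λ n → (:- (n :+ n) :+ n) :* (:- (n :+ n) :+ n) := n :* n) refl 2ν)

        Zs = z⊥dir Pzu
        Zt = z⊥dir Pzw

        Goal : Carrierᴹ → Set _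
        Goal = Grid (z ∷ []) Zs Zt (Q-dir Qu Pzu) (Q-dir Qw Pzw) h≉0 (-x≉0 4ν≉0) (N-0 Qz) (N-≉0 Qz)

        goal? : ∀ r → Dec (Goal r)
        goal? = grid? (z ∷ []) Zs Zt (Q-dir Qu Pzu) (Q-dir Qw Pzw) h≉0 (-x≉0 4ν≉0) (N-0 Qz) (N-≉0 Qz)

        proper? : ∀ r → Dec (Goal r × ¬ r ≈ᴹ 0ᴹ)
        proper? r = goal? r ×-dec ¬? (r ≟ᴹ 0ᴹ)

        goal-resp : ∀ {r r′} → r ≈ᴹ r′ → Goal r → Goal r′
        goal-resp e (x , y , k , l) = value x , value y , trans (Q-cong (≈ᴹ-sym e)) k , Perp-resp (z ∷ []) e l
          where
          value : ∀ {x g} → P x _ ≈ 0# ⊎ P x _ ≈ g → P x _ ≈ 0# ⊎ P x _ ≈ g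
          value (inj₁ p) = inj₁ (trans (P-congˡ (≈ᴹ-sym e)) p)
          value (inj₂ p) = inj₂ (trans (P-congˡ (≈ᴹ-sym e)) p)

      Both : Carrierᴹ → Set _
      Both x = Adj u x × Adj w x

      both? : ∀ x → Dec (Both x)
      both? x = adj? u x ×-dec adj? w x

      both-same : ∀ {x x′} → Same x x′ → Both x → Both x′
      both-same s (p , r) = adj-same (same-≈ ≈ᴹ-refl) s p , adj-same (same-≈ ≈ᴹ-refl) s r

      private
        forward : ∀ {r} → Goal r × ¬ r ≈ᴹ 0ᴹ → Neighbour both? both-same z (r +[ 1# ] z)
        forward {r} ((t , s , Qr , z⊥r ∷ []) , r≉0) =
          (Pzx , Qx , (λ e → r≉0 (≈ᴹ-trans (≈ᴹ-sym (shift-inverse r z (-‿inverseʳ 1#)))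
            (≈ᴹ-trans (shift-cong e refl ≈ᴹ-refl) (≈ᴹ-trans (+ᴹ-congʳ (≈ᴹ-sym (*ₗ-identityˡ z)))
            (≈ᴹ-trans (≈ᴹ-sym (*ₗ-distribʳ z 1# (- 1#))) (≈ᴹ-trans (*ₗ-congʳ (-‿inverseʳ 1#)) (*ₗ-zeroˡ z)))))))) ,
          ((λ same → P²≉ (trans (*-cong (P-sym u w) (P-sym u w)) (trans (*-cong (Pto Pzu same) (Pto Pzu same)) Pwx))) ,
            Pux) ,
          ((λ same → P²≉ (trans (*-cong (Pto Pzw same) (Pto Pzw same)) Pux)) , Pwx)
          where
          x = r +[ 1# ] z
          Pzx : P z x ≈ 2ν
          Pzx = trans (P-shiftʳ z r 1# z) (trans (+-cong z⊥r (*-congˡ Pzz))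
            (solve 1 (λ n → con (+ 0) :+ con (+ 1) :* n := n) refl 2ν))
          Qx : Q x ≈ ν
          Qx = trans (Q-shift r 1# z) (trans (+-cong (+-cong Qr (*-congˡ (trans (P-sym r z) z⊥r))) (*-congˡ Qz))
            (solve 1 (λ n → con (+ 0) :+ con (+ 1) :* con (+ 0) :+ con (+ 1) :* con (+ 1) :* n := n) refl ν))
          Pux : P u x * P u x ≈ 2ν * 2ν
          Pux = trans (*-cong (P-translate Pzu z⊥r) (P-translate Pzu z⊥r)) (off-grid s)
          Pwx : P w x * P w x ≈ 2ν * 2ν
          Pwx = trans (*-cong (P-translate Pzw z⊥r) (P-translate Pzw z⊥r)) (off-grid t)
          Pto : ∀ {y y′} → P z y ≈ 2ν → Same y x → P y′ y ≈ P y′ x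
          Pto p same = P-congˡ (normalised-unique same p Pzx)

        backward : ∀ {x} → Neighbour both? both-same z x → Goal (x +[ - 1# ] z) × ¬ x +[ - 1# ] z ≈ᴹ 0ᴹ
        backward {x} ((Pzx , Qx , x≉z) , (_ , Pux) , (_ , Pwx)) =
          (on-grid (roots Pzw Pwx) , on-grid (roots Pzu Pux) , Q-dir Qx Pzx , z⊥dir Pzx) ,
          λ e → x≉z (≈ᴹ-trans (≈ᴹ-sym (shift-inverse x z (-‿inverseˡ 1#)))
            (≈ᴹ-trans (+ᴹ-congʳ e) (≈ᴹ-trans (+ᴹ-identityˡ _) (*ₗ-identityˡ z))))
          where
          roots : ∀ {y} → P z y ≈ 2ν → P y x * P y x ≈ 2ν * 2ν → P (dir y) (dir x) + 2ν ≈ 2ν ⊎ P (dir y)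
            (dir x) + 2ν ≈ - 2ν
          roots {y} p k = square-roots (trans (*-cong eq eq) k)
            where
            eq : P (dir y) (dir x) + 2ν ≈ P y x
            eq = trans (sym (P-translate p (All.head (z⊥dir Pzx)))) (P-congˡ (shift-inverse x z (-‿inverseˡ 1#)))

      triangle-count : q ℕ.* (q ℕ.* (q ℕ.* (count 𝓥 (neighbour? both? both-same z) ℕ.+ 1))) ℕ.+ 4 ℕ.* (q ℕ.* μ) ≡ q ℕ.*
        (q ℕ.* (3 ℕ.* ζ ℕ.+ a)) ℕ.+ 4 ℕ.* μ
      triangle-count = ≡.trans
        (≡.cong₂ (λ k m → q ℕ.* (q ℕ.* (q ℕ.* k)) ℕ.+ 4 ℕ.* (q ℕ.* m)) (≡.sym grid-split) (≡.sym (M-ν Qz)))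
        (≡.trans (grid-count (z ∷ []) Zs Zt (Q-dir Qu Pzu) (Q-dir Qw Pzw) h≉0 (-x≉0 4ν≉0) (N-0 Qz) (N-≉0 Qz))
          (≡.cong (λ m → q ℕ.* (q ℕ.* (3 ℕ.* ζ ℕ.+ a)) ℕ.+ 4 ℕ.* m) (M-ν Qz)))
        where
        zero-on-grid : ∀ {r} → r ≈ᴹ 0ᴹ → Goal r
        zero-on-grid e = inj₁ (trans (P-congˡ e) (P-0ʳ _)) , inj₁ (trans (P-congˡ e) (P-0ʳ _)) , trans
          (Q-cong e) Q-0 , trans (P-congˡ e) (P-0ʳ z) ∷ []
        grid-split : count 𝓥 goal? ≡ count 𝓥 (neighbour? both? both-same z) ℕ.+ 1
        grid-split = ≡.trans (count-⊎ 𝓥 goal? proper? (λ r → r ≟ᴹ 0ᴹ)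
            (λ {r} g → cases r g (r ≟ᴹ 0ᴹ)) proj₁ zero-on-grid (λ (_ , r≉0) → r≉0))
          (≡.cong₂ ℕ._+_
            (count-bij 𝓥 𝓥 proper? (neighbour? both? both-same z) (λ e (g , r≉0) → goal-resp e g , r≉0 ∘ ≈ᴹ-trans e)
              (neighbour-resp both? both-same)
              (λ r → r +[ 1# ] z) (λ x → x +[ - 1# ] z) (λ e → shift-cong e refl ≈ᴹ-refl)
                (λ e → shift-cong e refl ≈ᴹ-refl)
              forward backward (λ _ → shift-inverse _ z (-‿inverseʳ 1#)) (λ _ → shift-inverse _ z (-‿inverseˡ 1#)))
            (count-unique 𝓥 (λ r → r ≟ᴹ 0ᴹ) (λ e f → ≈ᴹ-trans (≈ᴹ-sym e) f) 0ᴹ ≈ᴹ-refl (λ _ e → e)))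
          where
          cases : ∀ r → Goal r → Dec (r ≈ᴹ 0ᴹ) → (Goal r × ¬ r ≈ᴹ 0ᴹ) ⊎ r ≈ᴹ 0ᴹ
          cases r g (yes e) = inj₂ e
          cases r g (no ¬e) = inj₁ (g , ¬e)

  module _ {ζ a μ : ℕ} (N-0 : ∀ {u} → Q u ≈ ν → N (u ∷ []) 0# ≡ ζ)
    (N-≉0 : ∀ {u} → Q u ≈ ν → ∀ g → ¬ g ≈ 0# → N (u ∷ []) g ≡ a)
           (M-ν : ∀ {u} → Q u ≈ ν → M (u ∷ []) ≡ μ) where
    private
      R : ℕ
      R = q ℕ.* (q ℕ.* (3 ℕ.* ζ ℕ.+ a)) ℕ.+ 4 ℕ.* μ

      inner : (i j z : Fin n) → ℕ
      inner i j z = ∑ 𝓝 (λ w → (A i w ℕ.* A j w) ℕ.* A z w)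

      inner-count : ∀ {i j z} → i ≢ j → adj i j ≡ false → adj i z ≡ true → adj j z ≡ true →
                    q ℕ.* (q ℕ.* (q ℕ.* (inner i j z ℕ.+ 1))) ℕ.+ 4 ℕ.* (q ℕ.* μ) ≡ R
      inner-count {i} {j} {z} i≢j ij iz jz = count-at
          (normalise (edge (≡.trans (adj-symmetric z i) iz))) (normalise (edge (≡.trans (adj-symmetric z j) jz)))
        where
        count-at : ∃[ u ] Same u (vec i) × P (vec z) u ≈ 2ν → ∃[ w ] Same w (vec j) × P (vec z) w ≈ 2ν →
                   q ℕ.* (q ℕ.* (q ℕ.* (inner i j z ℕ.+ 1))) ℕ.+ 4 ℕ.* (q ℕ.* μ) ≡ R
        count-at (u , su , Pu) (w , sw , Pw) = ≡.trans
          (≡.cong (λ k → q ℕ.* (q ℕ.* (q ℕ.* (k ℕ.+ 1))) ℕ.+ 4 ℕ.* (q ℕ.* μ)) (≡.trans (∑-cong 𝓝 regroup)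
            (∑-neighbours both? both-same (Q-vec z) (same-≈ ≈ᴹ-refl))))
          triangle-count
          where
          P²≉ : ¬ P u w * P u w ≈ 2ν * 2ν
          P²≉ p = non-edge i≢j ij (trans (trans (sym (P²-same su (vec j)))
            (trans (*-cong (P-sym u (vec j)) (P-sym u (vec j)))
            (trans (sym (P²-same sw u)) (*-cong (P-sym w u) (P-sym w u))))) p)
          open CommonTriangle N-0 N-≉0 M-ν {u} {w} {vec z} (trans (same-Q su) (Q-vec i)) (trans (same-Q sw) (Q-vec j))
            (Q-vec z) Pu Pw P²≉
          regroup : ∀ x → (A i x ℕ.* A j x) ℕ.* A z x ≡ A z x ℕ.* 𝟙 (both? (vec x))
          regroup x = ≡.trans (ℕₚ.*-comm (A i x ℕ.* A j x) (A z x)) (≡.cong (A z x ℕ.*_)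
            (≡.trans (≡.cong₂ ℕ._*_ (A-adj (same-sym su) x) (A-adj (same-sym sw) x))
              (≡.sym (𝟙-× (adj? u (vec x)) (adj? w (vec x))))))

    commonEdges-non-edge : ∀ {i j} → i ≢ j → adj i j ≡ false →
      q ℕ.* (q ℕ.* (q ℕ.* (commonEdges i j ℕ.+ codeg i j))) ℕ.+ 4 ℕ.* (q ℕ.* μ) ℕ.* codeg i j ≡ R ℕ.* codeg i j
    commonEdges-non-edge {i} {j} i≢j ij = ≡.trans (≡.cong₂ ℕ._+_ left (≡.sym (∑-*ˡ 𝓝 (4 ℕ.* (q ℕ.* μ)) _)))
      (≡.trans (≡.sym (∑-+ 𝓝 _ _)) (≡.trans (∑-cong 𝓝 (λ z → pointwise z (adj i z Boolₚ.≟ true)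
        (adj j z Boolₚ.≟ true))) (∑-*ˡ 𝓝 R _)))
      where
      B : Fin n → ℕ
      B z = A i z ℕ.* A j z
      left : q ℕ.* (q ℕ.* (q ℕ.* (commonEdges i j ℕ.+ codeg i j))) ≡ ∑ 𝓝
        (λ z → q ℕ.* (q ℕ.* (q ℕ.* (B z ℕ.* inner i j z ℕ.+ B z))))
      left = ≡.sym (≡.trans (∑-*ˡ 𝓝 q _) (≡.cong (q ℕ.*_)
        (≡.trans (∑-*ˡ 𝓝 q _) (≡.cong (q ℕ.*_) (≡.trans (∑-*ˡ 𝓝 q _) (≡.cong (q ℕ.*_) (∑-+ 𝓝 _ _)))))))
      vanish : q ℕ.* (q ℕ.* (q ℕ.* 0)) ℕ.+ 4 ℕ.* (q ℕ.* μ) ℕ.* 0 ≡ R ℕ.* 0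
      vanish = ≡.trans (S.solve 2 (λ q m → q S.:* (q S.:* (q S.:* S.con 0)) S.:+ S.con 4 S.:*
        (q S.:* m) S.:* S.con 0 S.:= S.con 0) ≡.refl q μ) (≡.sym (ℕₚ.*-zeroʳ R))
        where module S = +-*-Solver
      pointwise : ∀ z (d : Dec (adj i z ≡ true)) (e : Dec (adj j z ≡ true)) →
                  q ℕ.* (q ℕ.* (q ℕ.* (𝟙 d ℕ.* 𝟙 e ℕ.* inner i j z ℕ.+ 𝟙 d ℕ.* 𝟙 e))) ℕ.+ 4 ℕ.* (q ℕ.* μ) ℕ.*
                    (𝟙 d ℕ.* 𝟙 e) ≡ R ℕ.* (𝟙 d ℕ.* 𝟙 e)
      pointwise z (yes iz) (yes jz) = ≡.trans
        (≡.cong₂ (λ k m → q ℕ.* (q ℕ.* (q ℕ.* (k ℕ.+ 1))) ℕ.+ m) (ℕₚ.*-identityˡ (inner i j z))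
          (ℕₚ.*-identityʳ (4 ℕ.* (q ℕ.* μ))))
        (≡.trans (inner-count i≢j ij iz jz) (≡.sym (ℕₚ.*-identityʳ R)))
      pointwise z (yes _) (no _) = vanish
      pointwise z (no _) _       = vanish

    private
      split-cases : ∀ {Φ : Fin n → Fin n → ℕ} → (∀ {x y x′ y′} → adj x y ≡ true → adj x′ y′ ≡ true → Φ x y ≡ Φ x′ y′) →
                    (∀ {x y x′ y′} → x ≢ y → x′ ≢ y′ → adj x y ≡ false → adj x′ y′ ≡ false → Φ x y ≡ Φ x′ y′) →
                      Invariant Φ
      split-cases {Φ} edges non-edges {x} {y} {x′} {y′} x≢y x′≢y′ e = cases (adj x y) ≡.refl
        where
        cases : ∀ b → adj x y ≡ b → Φ x y ≡ Φ x′ y′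
        cases true  xy = edges xy (≡.trans (≡.sym e) xy)
        cases false xy = non-edges x≢y x′≢y′ xy (≡.trans (≡.sym e) xy)

    codeg-invariant : Invariant codeg
    codeg-invariant = split-cases (adjacent-invariant codeg Automorphism.π-codeg) λ
      {x} {y} {x′} {y′} x≢y x′≢y′ xy x′y′ →
      ℕₚ.*-cancelˡ-≡ _ _ a ⦃ ℕ.≢-nonZero (NonAdjacent.a≢0 N-0 N-≉0 M-ν (Q-vec x) (Q-vec y) (non-edge x≢y xy)) ⦄
        (ℕₚ.*-cancelˡ-≡ _ _ q (ℕₚ.*-cancelˡ-≡ _ _ q (ℕₚ.+-cancelʳ-≡ (μ ℕ.+ μ) _ _
        (≡.trans (codeg-non-edge N-0 N-≉0 M-ν x≢y xy) (≡.sym (codeg-non-edge N-0 N-≉0 M-ν x′≢y′ x′y′))))))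

    commonEdges-invariant : Invariant commonEdges
    commonEdges-invariant = split-cases (adjacent-invariant commonEdges Automorphism.π-commonEdges) λ
      {x} {y} {x′} {y′} x≢y x′≢y′ xy x′y′ →
      cancel (codeg-invariant x≢y x′≢y′ (≡.trans xy (≡.sym x′y′))) (commonEdges-non-edge x≢y xy)
        (commonEdges-non-edge x′≢y′ x′y′)
      where
      cancel : ∀ {c c′ e e′} → c ≡ c′ → q ℕ.* (q ℕ.* (q ℕ.* (e ℕ.+ c))) ℕ.+ 4 ℕ.* (q ℕ.* μ) ℕ.* c ≡ R ℕ.* c →
               q ℕ.* (q ℕ.* (q ℕ.* (e′ ℕ.+ c′))) ℕ.+ 4 ℕ.* (q ℕ.* μ) ℕ.* c′ ≡ R ℕ.* c′ → e ≡ e′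
      cancel {c} ≡.refl p p′ = ℕₚ.+-cancelʳ-≡ c _ _ (ℕₚ.*-cancelˡ-≡ _ _ q (ℕₚ.*-cancelˡ-≡ _ _ q (ℕₚ.*-cancelˡ-≡ _ _ q
        (ℕₚ.+-cancelʳ-≡ (4 ℕ.* (q ℕ.* μ) ℕ.* c) _ _ (≡.trans p (≡.sym p′))))))

  ⟨⟩-trans : ∀ {x y z} → x ∈ ⟨_⟩ V y → y ∈ ⟨_⟩ V z → x ∈ ⟨_⟩ V z
  ⟨⟩-trans {z = z} (a , x≈) (b , y≈) = a * b , ≈ᴹ-trans x≈ (≈ᴹ-trans (*ₗ-congˡ y≈) (≈ᴹ-sym (*ₗ-assoc a b z)))

  same⇒⟨⟩ : ∀ {u w} → Same u w → u ∈ ⟨_⟩ V w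
  same⇒⟨⟩ (e , _ , p) = e , p

  ⟨⟩⇒same : ∀ {u w} → Q u ≈ ν → Q w ≈ ν → u ∈ ⟨_⟩ V w → Same u w
  ⟨⟩⇒same {u} {w} Qu Qw (a , p) = a , square-roots aa≈1 , p
    where
    aa≈1 : a * a ≈ 1# * 1#
    aa≈1 = *-cancelˡ-≉0 ν≉0 (begin
      ν * (a * a)  ≈⟨ *-comm ν (a * a) ⟩
      a * a * ν  ≈⟨ *-congˡ Qw ⟨
      a * a * Q w  ≈⟨ Q-*ₗ a w ⟨
      Q (a *ₗ w)  ≈⟨ Q-cong p ⟨
      Q u  ≈⟨ Qu ⟩
      ν  ≈⟨ solve 1 (λ n → n := n :* (con (+ 1) :* con (+ 1))) refl ν ⟩
      ν * (1# * 1#) ∎)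

  rescale : ∀ {a u w} → ¬ a ≈ 0# → u ≈ᴹ a *ₗ w → w ∈ ⟨_⟩ V u
  rescale {a} {u} {w} a≉0 p = recip a a≉0 , ≈ᴹ-sym (≈ᴹ-trans (*ₗ-congˡ p) (*ₗ-inverse (recip-inverse a a≉0) w))

  module _ {u w : Carrierᴹ} (Qu : Q u ≈ ν) (Qw : Q w ≈ ν) (u≁w : ¬ Same u w) where
    private
      u≉0 : ¬ u ≈ᴹ 0ᴹ
      u≉0 p = ν≉0 (trans (sym Qu) (trans (Q-cong p) Q-0))

      combination : Carrier → Carrier → Carrierᴹ
      combination α β = α *ₗ u +ᴹ β *ₗ w

      combination-cong : ∀ {α α′ β β′} → α ≈ α′ → β ≈ β′ → combination α β ≈ᴹ combination α′ β′
      combination-cong e f = +ᴹ-cong (*ₗ-congʳ e) (*ₗ-congʳ f)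

      scale-combination : ∀ κ α β → κ *ₗ combination α β ≈ᴹ combination (κ * α) (κ * β)
      scale-combination κ α β = ≈ᴹ-trans (*ₗ-distribˡ κ _ _)
        (+ᴹ-cong (≈ᴹ-sym (*ₗ-assoc κ α u)) (≈ᴹ-sym (*ₗ-assoc κ β w)))

      Q-combination : ∀ α β → Q (combination α β) ≈ (α * α + β * β) * ν + α * β * P u w
      Q-combination α β = begin
        Q (combination α β)  ≈⟨ Q-shift (α *ₗ u) β w ⟩
        Q (α *ₗ u) + β * P (α *ₗ u) w + β * β * Q w
          ≈⟨ +-cong (+-cong (trans (Q-*ₗ α u) (*-congˡ Qu)) (*-congˡ (polar-*ₗ α u w))) (*-congˡ Qw) ⟩
        α * α * ν + β * (α * P u w) + β * β * ν
          ≈⟨ solve 4 (λ a b n x → a :* a :* n :+ b :* (a :* x) :+ b :* b :* n :=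
            (a :* a :+ b :* b) :* n :+ a :* b :* x) refl α β ν (P u w) ⟩
        (α * α + β * β) * ν + α * β * P u w ∎

      coefficient-w : ∀ {α β} → combination α β ≈ᴹ 0ᴹ → β ≈ 0#
      coefficient-w {α} {β} e = decidable-stable (β ≟ 0#) λ β≉0 → u≁w
        (same-sym (⟨⟩⇒same Qw Qu (⟨⟩-trans (rescale β≉0 ≈ᴹ-refl)
        (- α , ≈ᴹ-trans (≈ᴹ-sym (+ᴹ-identityʳ _)) (≈ᴹ-trans (+ᴹ-congˡ (≈ᴹ-sym cancelled))
          (≈ᴹ-trans (≈ᴹ-sym (+ᴹ-assoc _ _ _)) (≈ᴹ-trans (+ᴹ-congʳ (≈ᴹ-trans (+ᴹ-comm _ _) e)) (+ᴹ-identityˡ _))))))))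
        where
        cancelled : α *ₗ u +ᴹ - α *ₗ u ≈ᴹ 0ᴹ
        cancelled = ≈ᴹ-trans (≈ᴹ-sym (*ₗ-distribʳ u α (- α))) (≈ᴹ-trans (*ₗ-congʳ (-‿inverseʳ α)) (*ₗ-zeroˡ u))

      coefficient-u : ∀ {α β} → combination α β ≈ᴹ 0ᴹ → α ≈ 0#
      coefficient-u {α} {β} e = decidable-stable (α ≟ 0#) λ α≉0 → u≉0
        (≈ᴹ-trans (≈ᴹ-sym (*ₗ-inverse (recip-inverse α α≉0) u))
        (≈ᴹ-trans (*ₗ-congˡ (≈ᴹ-trans (≈ᴹ-sym (≈ᴹ-trans (+ᴹ-congˡ (≈ᴹ-trans (*ₗ-congʳ (coefficient-w e)) (*ₗ-zeroˡ w)))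
          (+ᴹ-identityʳ _))) e)) (*ₗ-zeroʳ _)))

      coefficients-≈ : ∀ {α β α′ β′} → combination α β ≈ᴹ combination α′ β′ → α ≈ α′ × β ≈ β′
      coefficients-≈ {α} {β} {α′} {β′} e = from-diff (solve 2 (λ x y → x :- y := x :+ (:- con (+ 1)) :* y) refl α α′)
        (coefficient-u difference) ,
                                             from-diff (solve 2 (λ x y → x :- y := x :+ (:- con (+ 1)) :* y) refl β β′)
                                               (coefficient-w difference)
        where
        difference : combination (α + - 1# * α′) (β + - 1# * β′) ≈ᴹ 0ᴹ
        difference = ≈ᴹ-trans (+ᴹ-cong (*ₗ-distribʳ u α _) (*ₗ-distribʳ w β _)) (≈ᴹ-trans (+ᴹ-interchange _ _ _ _)
          (≈ᴹ-trans (+ᴹ-cong e (≈ᴹ-sym (scale-combination (- 1#) α′ β′))) (u-u≈0 _)))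

    -- Exchanging the two coordinates of the singular point gives a singular point of the line, hence the same point.
    tangent⇒ : Tangent V Q (Line V u w) → P u w * P u w ≈ 2ν * 2ν
    tangent⇒ (p , (α , β , p≈) , Qp≈0 , unique) = from-swap (proj₁ (unique p′ (β , α , ≈ᴹ-refl) Qp′≈0))
      where
      Q₀ : (α * α + β * β) * ν + α * β * P u w ≈ 0#
      Q₀ = trans (sym (Q-combination α β)) (trans (Q-cong (≈ᴹ-sym p≈)) Qp≈0)
      p′ : Point V
      p′ = record { vector = combination β α ; nonzero = λ e → nonzero p
        (≈ᴹ-trans p≈ (≈ᴹ-trans (combination-cong (coefficient-w e) (coefficient-u e))
        (≈ᴹ-trans (+ᴹ-cong (*ₗ-zeroˡ u) (*ₗ-zeroˡ w)) (+ᴹ-identityˡ 0ᴹ)))) }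
      Qp′≈0 : Q (combination β α) ≈ 0#
      Qp′≈0 = trans (Q-combination β α) (trans (solve 4
        (λ a b n x → (b :* b :+ a :* a) :* n :+ b :* a :* x := (a :* a :+ b :* b) :* n :+ a :* b :* x) refl α β ν
        (P u w)) Q₀)
      from-swap : combination β α ∈ ⟨_⟩ V (vector p) → P u w * P u w ≈ 2ν * 2ν
      from-swap (κ , e) = finish (square-roots κκ≈1)
        where
        coefficients : β ≈ κ * α × α ≈ κ * β
        coefficients = coefficients-≈ (≈ᴹ-trans e (≈ᴹ-trans (*ₗ-congˡ p≈) (scale-combination κ α β)))
        α≉0 : ¬ α ≈ 0#
        α≉0 α≈0 = nonzero p (≈ᴹ-trans p≈ (≈ᴹ-trans (combination-cong α≈0 (trans (proj₁ coefficients) (*-zero κ α≈0)))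
          (≈ᴹ-trans (+ᴹ-cong (*ₗ-zeroˡ u) (*ₗ-zeroˡ w)) (+ᴹ-identityˡ 0ᴹ))))
        κκ≈1 : κ * κ ≈ 1# * 1#
        κκ≈1 = *-cancelˡ-≉0 α≉0 (trans (solve 2 (λ a k → a :* (k :* k) := k :* (k :* a)) refl α κ)
          (trans (*-congˡ (sym (proj₁ coefficients)))
          (trans (sym (proj₂ coefficients)) (solve 1 (λ a → a := a :* (con (+ 1) :* con (+ 1))) refl α))))
        finish : κ ≈ 1# ⊎ κ ≈ - 1# → P u w * P u w ≈ 2ν * 2ν
        finish s = from-diff
            (solve 3 (λ n k x → x :* x :- (n :+ n) :* (n :+ n) := (k :* x :- (n :+ n)) :* ((n :+ n) :+ k :* x) :+
              (:- (x :* x)) :* (k :* k :- con (+ 1))) refl ν κ (P u w))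
            (+-zero (*-zero _ 2ν+κP) (*-zero _ (diff-zero (sign-square s))))
          where
          2ν+κP : (ν + ν) + κ * P u w ≈ 0#
          2ν+κP = x*y≈0 (x*y≉0 α≉0 α≉0) (trans (trans (solve 4
            (λ a k n x → a :* a :* ((n :+ n) :+ k :* x) :=
            ((a :* a :+ (k :* a) :* (k :* a)) :* n :+ a :* (k :* a) :* x) :+ (:- (a :* a :* n)) :*
            (k :* k :- con (+ 1))) refl α κ ν (P u w))
            (+-cong (sym (+-cong (*-congʳ (+-congˡ (*-cong (proj₁ coefficients) (proj₁ coefficients))))
              (*-congʳ (*-congˡ (proj₁ coefficients))))) refl))
            (+-zero Q₀ (*-zero _ (diff-zero (sign-square s)))))

    tangent⇐ : P u w * P u w ≈ 2ν * 2ν → Tangent V Q (Line V u w)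
    tangent⇐ P² = build (sign (square-roots P²))
      where
      sign : P u w ≈ 2ν ⊎ P u w ≈ - 2ν → ∃[ e ] IsSign e × P u w ≈ e * 2ν
      sign (inj₁ p) = 1# , inj₁ refl , trans p (sym (*-identityˡ _))
      sign (inj₂ p) = - 1# , inj₂ refl , trans p (solve 1 (λ x → :- x := (:- con (+ 1)) :* x) refl 2ν)
      build : ∃[ e ] IsSign e × P u w ≈ e * 2ν → Tangent V Q (Line V u w)
      build (e , s , Puw) = p , (1# , - e , ≈ᴹ-refl) , Qp , unique
        where
        p : Point V
        p = record { vector = combination 1# (- e) ; nonzero = λ z → 1≉0 (coefficient-u z) }
        Qp : Q (combination 1# (- e)) ≈ 0#
        Qp = trans (Q-combination 1# (- e)) (trans (+-congˡ (*-congˡ Puw))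
          (trans (solve 2 (λ e n → (con (+ 1) :* con (+ 1) :+ (:- e) :* (:- e)) :* n :+ con (+ 1) :* (:- e) :*
            (e :* (n :+ n)) := (:- n) :* (e :* e :- con (+ 1))) refl e ν)
            (*-zero _ (diff-zero (sign-square s)))))
        unique : ∀ R → vector R ∈ Line V u w → Singular V Q R → Setoid._≈_ (points V) R p
        unique R (α , β , R≈) QR≈0 = (- (e * β) , R≈p) , rescale -eβ≉0 R≈p
          where
          α+eβ : α + e * β ≈ 0#
          α+eβ = decidable-stable (α + e * β ≟ 0#) λ ≉0 → x*y≉0 ν≉0 (x*y≉0 ≉0 ≉0) (begin
            ν * ((α + e * β) * (α + e * β))
              ≈⟨ solve 4 (λ a b e n → n :* ((a :+ e :* b) :* (a :+ e :* b)) :=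
                ((a :* a :+ b :* b) :* n :+ a :* b :* (e :* (n :+ n))) :+ (b :* b :* n) :* (e :* e :- con (+ 1))) refl
                α β e ν ⟩
            ((α * α + β * β) * ν + α * β * (e * 2ν)) + (β * β * ν) * (e * e - 1#)
              ≈⟨ trans (+-congˡ (*-zero _ (diff-zero (sign-square s)))) (+-identityʳ _) ⟩
            (α * α + β * β) * ν + α * β * (e * 2ν)  ≈⟨ +-congˡ (*-congˡ Puw) ⟨
            (α * α + β * β) * ν + α * β * P u w  ≈⟨ Q-combination α β ⟨
            Q (combination α β)  ≈⟨ Q-cong R≈ ⟨
            Q (vector R)  ≈⟨ QR≈0 ⟩
            0# ∎)
          R≈p : vector R ≈ᴹ - (e * β) *ₗ combination 1# (- e)
          R≈p = ≈ᴹ-trans R≈ (≈ᴹ-trans (combination-cong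
            (from-diff (solve 2 (λ a x → a :- (:- x) :* con (+ 1) := a :+ x) refl α (e * β)) α+eβ)
            (from-diff (solve 2 (λ b e → b :- (:- (e :* b)) :* (:- e) := (:- b) :* (e :* e :- con (+ 1))) refl β e)
              (*-zero _ (diff-zero (sign-square s)))))
            (≈ᴹ-sym (scale-combination _ 1# (- e))))
          -eβ≉0 : ¬ - (e * β) ≈ 0#
          -eβ≉0 z = nonzero R (≈ᴹ-trans R≈p (≈ᴹ-trans (*ₗ-congʳ z) (*ₗ-zeroˡ _)))

  module VertexSet {m : ℕ} {ε : Sign} (nV≡ : nV ≡ q ^ (2 ℕ.* m ℕ.+ 1)) {x₀ : Carrierᴹ} (Qx₀ : Q x₀ ≈ ν)
    (numeric₀ : NumericType ε m (x₀ ∷ [])) where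
    private
      Q≉0 : ∀ {u} → Q u ≈ ν → ¬ Q u ≈ 0#
      Q≉0 Qu p = ν≉0 (trans (sym Qu) p)

      N-ν : ∀ {u} → Q u ≈ ν → ∀ g → N (u ∷ []) g ≡ N (x₀ ∷ []) g
      N-ν Qu = N-isometric (trans Qu (sym Qx₀)) (Q≉0 Qu)

      N-≉0 : ∀ {u} → Q u ≈ ν → ∀ g → ¬ g ≈ 0# → N (u ∷ []) g ≡ N (x₀ ∷ []) 1#
      N-≉0 Qu g g≉0 = ≡.trans (N-ν Qu g) (Numeric.N-constant {ε} {m} {x₀ ∷ []} numeric₀ g≉0 1≉0)

      M-u : ∀ {u} → Q u ≈ ν → M (u ∷ []) ≡ q ^ m ℕ.* q ^ m
      M-u Qu = M-hyperplane {m} nV≡ (Q≉0 Qu)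

      opaque
        degree : ∀ i → deg i ≡ deg (idx Qx₀)
        degree i = deg-constant i (idx Qx₀)

        codegrees : Invariant codeg
        codegrees = codeg-invariant (λ Qu → N-ν Qu 0#) N-≉0 M-u

        edgeCounts : Invariant commonEdges
        edgeCounts = commonEdges-invariant (λ Qu → N-ν Qu 0#) N-≉0 M-u

    module _ (T : Graph (≡.setoid (Fin 4)) 0ℓ) (T? : Decidable (Graph.Adj T)) (s₀ t₀ : Fin 4) (s₀≢t₀ : s₀ ≢ t₀) where
      private
        module Counted = CountCopies adj adj-symmetric adj-irreflexive

      opaque
        copyNumber : Bool → ℕ
        copyNumber = Counted.number degree codegrees edgeCounts T T? s₀ t₀ s₀≢t₀

        copyNumber-correct : ∀ {a b r} {S : Setoid a b} (Γ : Graph S r) (𝓘 : HasCardinality S n) →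
          (∀ z z′ → Graph.Adj Γ z z′ ⇔ (adj (Inverse.to 𝓘 z) (Inverse.to 𝓘 z′) ≡ true)) → ∀ x y → ¬ Setoid._≈_ S x y →
          HasCardinality (copies T s₀ t₀ Γ x y) (copyNumber (adj (Inverse.to 𝓘 x) (Inverse.to 𝓘 y)))
        copyNumber-correct = Counted.copies-card degree codegrees edgeCounts T T? s₀ t₀ s₀≢t₀

      module _ (x y : Vertex V Q m ε) where
        private
          module NO = Graph (NO V Q m ε)
          module 𝕍 = Setoid (vertices V Q m ε)
          open Vertex

          vect : Vertex V Q m ε → Carrierᴹ
          vect z = vector (point z)

          scale : ∀ z → ∃[ ρ ] ν ≈ ρ * ρ * Q (vect z)
          scale z = let ρ , e = same-class {ε} {m} (nonsingular z) (Q≉0 Qx₀) (≡.trans (M-hyperplane {m} nV≡ (nonsingular z)) (≡.sym (M-u Qx₀)))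
                                  (type⇒numeric {m} ε {point z} nV≡ (nonsingular z) (hasType z)) numeric₀
                    in ρ , trans (sym Qx₀) e

          scale≉0 : ∀ z → ¬ proj₁ (scale z) ≈ 0#
          scale≉0 z p = ν≉0 (trans (proj₂ (scale z)) (trans (*-congʳ (*-zero _ p)) (zeroˡ _)))

          unit : Vertex V Q m ε → Carrierᴹ
          unit z = proj₁ (scale z) *ₗ vect z

          Q-unit : ∀ z → Q (unit z) ≈ ν
          Q-unit z = trans (Q-*ₗ _ (vect z)) (sym (proj₂ (scale z)))

          opaque
            to : Vertex V Q m ε → Fin n
            to z = idx (Q-unit z)

            to-unit : ∀ z → Same (vec (to z)) (unit z)
            to-unit z = vec-idx (Q-unit z)

          vec∈ : ∀ z → vec (to z) ∈ ⟨_⟩ V (vect z)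
          vec∈ z = ⟨⟩-trans (same⇒⟨⟩ (to-unit z)) (proj₁ (scale z) , ≈ᴹ-refl)

          ∈vec : ∀ z → vect z ∈ ⟨_⟩ V (vec (to z))
          ∈vec z = ⟨⟩-trans (rescale (scale≉0 z) ≈ᴹ-refl) (same⇒⟨⟩ (same-sym (to-unit z)))

          to-cong : ∀ {z z′} → z 𝕍.≈ z′ → to z ≡ to z′
          to-cong {z} {z′} (p , _) = vec-injective (⟨⟩⇒same (Q-vec _) (Q-vec _)
            (⟨⟩-trans (vec∈ z) (⟨⟩-trans p (∈vec z′))))

          same-index⇒≈ : ∀ {z z′} → to z ≡ to z′ → z 𝕍.≈ z′
          same-index⇒≈ {z} {z′} e = ⟨⟩-trans (∈vec z) (≡.subst (λ i → vec i ∈ ⟨_⟩ V (vect z′)) (≡.sym e) (vec∈ z′)) ,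
                                     ⟨⟩-trans (∈vec z′) (≡.subst (λ i → vec i ∈ ⟨_⟩ V (vect z)) e (vec∈ z))

          pointAt : Fin n → Point V
          pointAt i = record { vector = vec i ; nonzero = λ e → Q≉0 (Q-vec i) (trans (Q-cong e) Q-0) }

          from : Fin n → Vertex V Q m ε
          from i = record
            { point       = pointAt i
            ; nonsingular = Q≉0 (Q-vec i)
            ; hasType     = transport-type {m} ε {point x} {pointAt i} (nonsingular x) (scale≉0 x)
              (trans (Q-vec i) (proj₂ (scale x))) (hasType x)
            }

          to-from : ∀ i → to (from i) ≡ i
          to-from i = vec-injective (⟨⟩⇒same (Q-vec _) (Q-vec _) (vec∈ (from i)))

        vertexCardinality : HasCardinality (vertices V Q m ε) n
        vertexCardinality = record
          { to        = to
          ; from      = from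
          ; to-cong   = λ {z} {z′} → to-cong {z} {z′}
          ; from-cong = λ { {i} ≡.refl → 𝕍.refl {from i} }
          ; inverse   = (λ {i} {z} z≈ → ≡.trans (to-cong {z} {from i} z≈) (to-from i))
                      , (λ {z} {i} i≡ → same-index⇒≈ {from i} {z} (≡.trans (to-from i) i≡))
          }

        adjacency : ∀ z z′ → NO.Adj z z′ ⇔ (adj (to z) (to z′) ≡ true)
        adjacency z z′ = mk⇔
          (λ (z≉z′ , tangent) → dec-true (adj? (vec (to z)) (vec (to z′)))
            (let ¬same = λ s → z≉z′ (same-index⇒≈ {z} {z′} (vec-injective s)) in
             ¬same , tangent⇒ (Q-vec _) (Q-vec _) ¬same
               (Tangent-resp V Q (Line-mono V (∈vec z) (∈vec z′)) (Line-mono V (vec∈ z) (vec∈ z′)) tangent)))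
          (λ e → let ¬same , p = does-true (adj? (vec (to z)) (vec (to z′))) e in
             (λ z≈z′ → ¬same (same-≈ (≡.subst (λ i → vec (to z) ≈ᴹ vec i) (to-cong {z} {z′} z≈z′) ≈ᴹ-refl))) ,
             Tangent-resp V Q (Line-mono V (vec∈ z) (vec∈ z′)) (Line-mono V (∈vec z) (∈vec z′))
               (tangent⇐ (Q-vec _) (Q-vec _) ¬same p))

        copies-counted : ¬ x 𝕍.≈ y → (NO.Adj x y → HasCardinality (copies T s₀ t₀ (NO V Q m ε) x y) (copyNumber true)) ×
                         (¬ NO.Adj x y → HasCardinality (copies T s₀ t₀ (NO V Q m ε) x y) (copyNumber false))
        copies-counted x≉y =
          (λ xy → ≡.subst (λ b → HasCardinality (copies T s₀ t₀ (NO V Q m ε) x y) (copyNumber b))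
            (Equivalence.to (adjacency x y) xy) counted) ,
          (λ ¬xy → ≡.subst (λ b → HasCardinality (copies T s₀ t₀ (NO V Q m ε) x y) (copyNumber b))
            (Boolₚ.¬-not (λ e → ¬xy (Equivalence.from (adjacency x y) e))) counted)
          where
          counted : HasCardinality (copies T s₀ t₀ (NO V Q m ε) x y) (copyNumber (adj (to x) (to y)))
          counted = copyNumber-correct (NO V Q m ε) vertexCardinality adjacency x y x≉y

    vertexCondition : VertexCondition 4 (NO V Q m ε)
    vertexCondition T T? s₀ t₀ s₀≢t₀ = copyNumber T T? s₀ t₀ s₀≢t₀ true , copyNumber T T? s₀ t₀ s₀≢t₀ false ,
      copies-counted T T? s₀ t₀ s₀≢t₀

module _ {c ℓ v ℓv} {F : CommutativeRing c ℓ} (isField : IsField F) {q}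
  (𝓕 : HasCardinality (CommutativeRing.setoid F) q)
  (V : Module F v ℓv) {m : ℕ} (𝓥 : HasCardinality (Module.≈ᴹ-setoid V) (q ^ (2 ℕ.* m ℕ.+ 1)))
  (Q : Module.Carrierᴹ V → CommutativeRing.Carrier F) (isQ : IsQuadraticForm V Q)
  (2≉0 : ¬ (CommutativeRing._≈_ F (CommutativeRing._+_ F (CommutativeRing.1# F) (CommutativeRing.1# F))
    (CommutativeRing.0# F)))
  (nondegenerate : Nondegenerate V Q) (ε : Sign)
  where
  open FiniteQuadratic isField 𝓕 V 𝓥 Q isQ
  open OddQuadratic isField 𝓕 V 𝓥 Q isQ 2≉0

  private
    numeric? : ∀ ε xs → Dec (NumericType ε m xs)
    numeric? Sign.+ xs = map′ (λ none f f≉0 → decidable-stable (N xs 0# ℕₚ.≟ N xs f ℕ.+ q ^ m)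
      (λ p → none (f , f≉0 , p))) (λ t (f , f≉0 , p) → p (t f f≉0))
      (¬? (any? 𝓕 (λ e (p , r) → p ∘ trans e , λ t → r (≡.trans t (≡.cong (ℕ._+ q ^ m) (N-cong xs (sym e)))))
        (λ f → ¬? (f ≟ 0#) ×-dec ¬? (N xs 0# ℕₚ.≟ N xs f ℕ.+ q ^ m))))
    numeric? Sign.- xs = map′ (λ none f f≉0 → decidable-stable (N xs f ℕₚ.≟ N xs 0# ℕ.+ q ^ m)
      (λ p → none (f , f≉0 , p))) (λ t (f , f≉0 , p) → p (t f f≉0))
      (¬? (any? 𝓕 (λ e (p , r) → p ∘ trans e , λ t → r (≡.trans (N-cong xs e) t))
        (λ f → ¬? (f ≟ 0#) ×-dec ¬? (N xs f ℕₚ.≟ N xs 0# ℕ.+ q ^ m))))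

    numeric-resp : ∀ ε {u w} → u ≈ᴹ w → NumericType ε m (u ∷ []) → NumericType ε m (w ∷ [])
    numeric-resp ε {u} {w} e t = helper ε t
      where
      N-≈ : ∀ f → N (u ∷ []) f ≡ N (w ∷ []) f
      N-≈ f = count-cong 𝓥 (λ z → (Q z ≟ f) ×-dec perp? (u ∷ []) z) (λ z → (Q z ≟ f) ×-dec perp? (w ∷ []) z)
        (λ { z (a , p ∷ []) → a , trans (P-congʳ (≈ᴹ-sym e)) p ∷ [] })
          (λ { z (a , p ∷ []) → a , trans (P-congʳ e) p ∷ [] })
      helper : ∀ ε → NumericType ε m (u ∷ []) → NumericType ε m (w ∷ [])
      helper Sign.+ t f f≉0 = ≡.trans (≡.sym (N-≈ 0#)) (≡.trans (t f f≉0) (≡.cong (ℕ._+ q ^ m) (N-≈ f)))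
      helper Sign.- t f f≉0 = ≡.trans (≡.sym (N-≈ f)) (≡.trans (t f f≉0) (≡.cong (ℕ._+ q ^ m) (N-≈ 0#)))

    -- Having the numeric type is decidable and implied by being a vertex, so it is not necessary to decide
    -- whether a vertex exists before n₁ and n₂ are chosen.
    search : Dec (∃[ u ] ¬ Q u ≈ 0# × NumericType ε m (u ∷ []))
    search = any? 𝓥 (λ e (p , t) → p ∘ trans (Q-cong e) , numeric-resp ε e t)
      (λ u → ¬? (Q u ≟ 0#) ×-dec numeric? ε (u ∷ []))

  vertexCondition : VertexCondition 4 (NO V Q m ε)
  vertexCondition T T? s₀ t₀ s₀≢t₀ = decide search
    where
    decide : Dec (∃[ u ] ¬ Q u ≈ 0# × NumericType ε m (u ∷ [])) →
      ∃₂ λ (n₁ n₂ : ℕ) → ∀ (x y : Vertex V Q m ε) → ¬ (Setoid._≈_ (vertices V Q m ε) x y) →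
        (Graph.Adj (NO V Q m ε) x y → HasCardinality (copies T s₀ t₀ (NO V Q m ε) x y) n₁) ×
        (¬ Graph.Adj (NO V Q m ε) x y → HasCardinality (copies T s₀ t₀ (NO V Q m ε) x y) n₂)
    decide (yes (u , Qu≉0 , numeric)) =
      TangentGraph.VertexSet.vertexCondition isField 𝓕 V 𝓥 Q isQ 2≉0 nondegenerate
        (Q u) Qu≉0 {m} {ε} ≡.refl {u} refl numeric T T? s₀ t₀ s₀≢t₀
    decide (no none) = 0 , 0 , λ x _ _ → contradiction
      (vector (Vertex.point x) , Vertex.nonsingular x , type⇒numeric {m} ε {Vertex.point x} ≡.refl
        (Vertex.nonsingular x) (Vertex.hasType x)) none

open import Data.Nat.Base using (_+_; _*_)

proposition6p3 : ∀ {c ℓ v ℓv} (q m : ℕ) (ε : Sign) →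
    PrimePower q → ¬ (2 ∣ q) → 1 ≤ m →
    (F : CommutativeRing c ℓ) → IsFiniteField F q →
    (V : Module F v ℓv) → HasDimension V U (2 * m + 1) →
    (Q : Module.Carrierᴹ V → CommutativeRing.Carrier F) →
    IsQuadraticForm V Q → Nondegenerate V Q →
    VertexCondition 4 (NO V Q m ε)
proposition6p3 q m ε _ 2∤q _ F finite V dim Q isQ nondegenerate =
  vertexCondition isField cardinality V {m} (dimension⇒cardinality isField cardinality V dim) Q isQ
    (odd-order isField cardinality 2∤q) nondegenerate ε
  where open IsFiniteField finite
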